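{- Let $k$ be a positive integer. For each word $w\in[\overline{k}]^{*}$ there exists a unique King tableau $T\in \mathrm{KT}_k$ such that $w\equiv_{C}\operatorname{row}T$. In particular, $T=P_{C}(w)$.
   Context: Alphabet and tableaux. $[\overline{k}]=\{1,\overline1,\dots,k,\overline k\}$ with the total order $1<\overline1<2<\overline2<\cdots<k<\overline k$; $[\overline k]^{*}$ is the set of all finite words (including the empty word) in $[\overline k]$. Partitions are identified with Young diagrams in English notation. A King tableau of shape $\lambda$ is a filling of the Young diagram $\lambda$ by elements of $[\overline k]$ such that entries weakly increase along rows, strictly increase down columns, and all entries in row $i$ are $\ge i$ (for the order $1<\overline1<2<\overline2<\cdots<k<\overline k$) for every $i$. $\mathrm{KT}_k(\lambda)$ is the set of these and $\mathrm{KT}_k=\bigcup_\lambda \mathrm{KT}_k(\lambda)$ (the empty tableau is included). The row word $\operatorname{row}T$ is obtained by reading the rows of $T$ from bottom to top, each row from left to right. Berele insertion $T\leftarrow_C x$ ($T\in\mathrm{KT}_k$, $x\in[\overline k]$). Start as in Schensted row insertion: insert $x$ into row 1; inserting a letter $a$ into a row replaces (bumps) the leftmost entry that is strictly larger than $a$, and the bumped entry is then inserted into the next row; if no entry of the row is larger than $a$, then $a$ is put at the end of the row and the procedure stops. Exception: if at some moment the letter $i$ is to be inserted into row $i$ and row $i$ contains at least one $\overline i$, then instead: replace the first $\overline i$ of row $i$ by $i$, replace the first $i$ of row $i$ by an empty box, and play jeu de taquin with this empty box: repeatedly, if the empty box has a box with entry $b$ below it and/or a box with entry $r$ to its right, slide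 $b$ up when only $b$ exists or when both exist and $b\le r$, and slide $r$ left when only $r$ exists or when both exist and $b>r$; once the empty box is at a corner of the shape, delete it and stop. The result is again a King tableau. For a word $w=w_1\cdots w_n$, $P_C(w)=(\cdots((\emptyset\leftarrow_C w_1)\leftarrow_C w_2)\cdots)\leftarrow_C w_n$. Knuth equivalences. $\equiv_A$ is the equivalence relation on $[\overline k]^{*}$ generated by the following replacements of three adjacent letters in a word: $yxz\leftrightarrow yzx$ for $x<y\le z$, and $xzy\leftrightarrow zxy$ for $x\le y<z$. A column word is a word $c=c_n\cdots c_1$ in $[\overline k]$ with $c_{i+1}>c_i$ for all $i$ (the empty word is allowed). For column words, $c\sim c'$ means $P_C(c)=P_C(c')$. Write $w\equiv_5 w'$ if there exist a word $v$ and column words $c,c'$ with $w\equiv_A cv$, $w'\equiv_A c'v$ and $c\sim c'$. Type C Knuth equivalence $\equiv_C$: $w\equiv_C w'$ if there is a finite sequence of words $w=w_0,w_1,\dots,w_n=w'$ such that each $w_{j+1}$ is obtained from $w_j$ by one of the three-letter replacements $yxz\leftrightarrow yzx$ (for $x<y\le z$) and $xzy\leftrightarrow zxy$ (for $x\le y<z$) or satisfies $w_j\equiv_5 w_{j+1}$. -}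

module Defs where

open import Data.Fin using (Fin; toℕ)
import Data.Fin as Fin
open import Data.List using (List; []; _∷_; _++_; map; length; lookup; foldl; concat; reverse; break; splitAt)
open import Data.List.Membership.Propositional using (_∈_)
open import Data.List.Relation.Binary.Prefix.Heterogeneous using (Prefix)
open import Data.List.Relation.Unary.All using (All)
open import Data.List.Relation.Unary.Any using (any?)
open import Data.List.Relation.Unary.Linked using (Linked)
open import Data.Nat using (ℕ; suc; _*_)
import Data.Nat as ℕ
open import Data.Product using (_×_; _,_; ∃-syntax)
open import Level using (0ℓ)
open import Relation.Binary using (Rel; Decidable; DecidableEquality)
open import Relation.Binary.Construct.Closure.Equivalence using (EqClosure)
open import Relation.Binary.Construct.Closure.ReflexiveTransitive using (Star)
open import Relation.Binary.Construct.Closure.Symmetric using (SymClosure)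
open import Relation.Binary.Construct.Union using (_∪_)
open import Relation.Binary.PropositionalEquality using (_≡_; refl; cong)
open import Relation.Nullary using (Dec; yes; no; _×-dec_)
open import Relation.Nullary.Decidable using (map′)

-- Indices are 0-based: plain i and bar i stand for the letters i+1 and
-- its barred version, and row n of a tableau is its (n+1)-st row.

data Letter (k : ℕ) : Set where
  plain bar : Fin k → Letter k

-- The position of a letter in 1 < 1̄ < 2 < 2̄ < ⋯ < k < k̄.
rank : ∀ {k} → Letter k → ℕ
rank (plain i) = 2 * toℕ i
rank (bar i)   = suc (2 * toℕ i)

infix 4 _<_ _≤_ _>_ _<?_ _≤?_ _≟_

_<_ _≤_ _>_ : ∀ {k} → Rel (Letter k) 0ℓ
x < y = rank x ℕ.< rank y
x ≤ y = rank x ℕ.≤ rank y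
x > y = y < x

_<?_ : ∀ {k} → Decidable (_<_ {k})
x <? y = rank x ℕ.<? rank y

_≤?_ : ∀ {k} → Decidable (_≤_ {k})
x ≤? y = rank x ℕ.≤? rank y

_≟_ : ∀ {k} → DecidableEquality (Letter k)
plain i ≟ plain j = map′ (cong plain) (λ { refl → refl }) (i Fin.≟ j)
plain i ≟ bar j   = no λ ()
bar i   ≟ plain j = no λ ()
bar i   ≟ bar j   = map′ (cong bar) (λ { refl → refl }) (i Fin.≟ j)

Word : ℕ → Set
Word k = List (Letter k)

-- The list of rows, from top to bottom, each row from left to right.
Filling : ℕ → Set
Filling k = List (List (Letter k))

shape : ∀ {k} → Filling k → List ℕ
shape = map length

record IsPartition (λs : List ℕ) : Set where
  field
    decreasing : Linked ℕ._≥_ λs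
    positive   : All (ℕ._> 0) λs

record IsKing {k : ℕ} (T : Filling k) : Set where
  field
    partition : IsPartition (shape T)
    rows      : All (Linked _≤_) T
    -- Each entry of a lower row exceeds the entry directly above it.
    columns   : Linked (λ upper lower → Prefix _>_ lower upper) T
    -- 2 * n is the rank of the letter plain n; comparing ranks also makes
    -- sense for rows beyond the k-th, which must then be empty.
    bounded   : (n : Fin (length T)) → All (λ x → 2 * toℕ n ℕ.≤ rank x) (lookup T n)

row : ∀ {k} → Filling k → Word k
row T = concat (reverse T)

-- Jeu de taquin: slide p s rs starts from the filling whose top row is p,
-- then the empty box, then s, and whose remaining rows are rs.  The box
-- below the empty one is the entry of the next row at position length p.

-- Deletes the empty box at the end of the row p; a row left with no box disappears.
finish : ∀ {k} → List (Letter k) → Filling k → Filling k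
finish []      rs = rs
finish (x ∷ p) rs = (x ∷ p) ∷ rs

slide     : ∀ {k} → List (Letter k) → List (Letter k) → Filling k → Filling k
slideOver : ∀ {k} → List (Letter k) → List (Letter k) →
            List (Letter k) → Filling k → Filling k

slide p s       (t ∷ rs) = slideOver p s t rs
slide p []      []       = finish p []
slide p (r ∷ s) []       = slide (p ++ r ∷ []) s []

slideOver p []      t rs with splitAt (length p) t
... | _ , []     = finish p (t ∷ rs)
... | q , b ∷ s′ = (p ++ b ∷ []) ∷ slide q s′ rs
slideOver p (r ∷ s) t rs with splitAt (length p) t
... | _ , []     = slideOver (p ++ r ∷ []) s t rs
... | q , b ∷ s′ with b ≤? r
...   | yes _ = (p ++ b ∷ r ∷ s) ∷ slide q s′ rs
...   | no  _ = slideOver (p ++ r ∷ []) s t rs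

-- cancel i r rs: the exceptional step for inserting plain i into the row r
-- (with rows rs below), where bar i ∈ r.
cancel : ∀ {k} → Fin k → List (Letter k) → Filling k → Filling k
cancel i r rs with break (_≟ bar i) r
... | _ , []    = r ∷ rs   -- unreachable, as bar i ∈ r
... | p , _ ∷ s with break (_≟ plain i) (p ++ plain i ∷ s)
...   | _  , []     = r ∷ rs   -- unreachable, as plain i has just been put in
...   | p′ , _ ∷ s′ = slide p′ s′ rs

Exceptional : ∀ {k} → ℕ → Letter k → List (Letter k) → Set
Exceptional n x r = ∃[ i ] x ≡ plain i × toℕ i ≡ n × bar i ∈ r

exceptional? : ∀ {k} n (x : Letter k) r → Dec (Exceptional n x r)
exceptional? n (plain i) r =
  map′ (λ (e , m) → i , refl , e , m) (λ { (_ , refl , e , m) → e , m })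
       ((toℕ i ℕ.≟ n) ×-dec any? (bar i ≟_) r)
exceptional? n (bar i)   r = no λ { (_ , () , _) }

-- insertAt n x T inserts x into T, whose top row is row n of the tableau.
insertAt : ∀ {k} → ℕ → Letter k → Filling k → Filling k
insertAt n x []       = (x ∷ []) ∷ []
insertAt n x (r ∷ rs) with exceptional? n x r
... | yes (i , _) = cancel i r rs
... | no  _       with break (x <?_) r
...   | _ , []    = (r ++ x ∷ []) ∷ rs
...   | p , y ∷ s = (p ++ x ∷ s) ∷ insertAt (suc n) y rs

infixl 5 _←C_

_←C_ : ∀ {k} → Filling k → Letter k → Filling k
T ←C x = insertAt 0 x T

P-C : ∀ {k} → Word k → Filling k
P-C = foldl _←C_ []

infix 4 _⇝_ _≡A_ _∼_ _≡₅_ _≡C_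

data _⇝_ {k : ℕ} : Rel (Word k) 0ℓ where
  yxz : ∀ u v {x y z} → x < y → y ≤ z →
        u ++ y ∷ x ∷ z ∷ v ⇝ u ++ y ∷ z ∷ x ∷ v
  xzy : ∀ u v {x y z} → x ≤ y → y < z →
        u ++ x ∷ z ∷ y ∷ v ⇝ u ++ z ∷ x ∷ y ∷ v

_≡A_ : ∀ {k} → Rel (Word k) 0ℓ
_≡A_ = EqClosure _⇝_

-- Strictly decreasing when read from left to right.
IsColumnWord : ∀ {k} → Word k → Set
IsColumnWord = Linked _>_

_∼_ : ∀ {k} → Rel (Word k) 0ℓ
c ∼ c′ = P-C c ≡ P-C c′

_≡₅_ : ∀ {k} → Rel (Word k) 0ℓ
w ≡₅ w′ = ∃[ v ] ∃[ c ] ∃[ c′ ]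
  IsColumnWord c × IsColumnWord c′ × w ≡A c ++ v × w′ ≡A c′ ++ v × c ∼ c′

_≡C_ : ∀ {k} → Rel (Word k) 0ℓ
_≡C_ = Star (SymClosure _⇝_ ∪ _≡₅_)

{-# OPTIONS --safe #-}
module Submission where

-- Existence. Berele insertion of x into a King tableau T either is Schensted insertion, or the first column d
-- of the Schensted tableau S of row T · x contains i in row i and bar i in row i + 1. In the latter case jeu de
-- taquin produces a tableau with reading word ≡A d′ · u, where u is the word of the other columns of S and d′
-- is d without i and bar i, and P-C d = P-C d′ as column words.
--
-- Uniqueness amounts to the invariance of P-C under Knuth moves. By induction on the length it suffices that a
-- word d · v, whose prefix d is a column violating the King condition, may be replaced by the word D · U of its
-- Schensted tableau with first column D. One moves from the former to the latter by letters sliding from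
-- one column to the column on its left. Slides away from d are Knuth moves after the reduction of d, which
-- shortens the word. A slide from the second column z into d is a question about two columns only: slides and
-- cancellations are the raising operators of an sp₄-crystal on pairs of columns, so both pairs reduce to the same
-- highest weight element. This is shown by two functionals of max-plus type that are invariant under both moves.

open import Defs

-- The functionals come from skew Howe duality. Reading the levels of the alphabet in order, a pair
-- of columns traces a lattice path in the weight space of sp₄, and `F` and `G` are its pairings
-- with the two simple coroots: beyond the letters concerned, a slide changes them by 2 and -1, a
-- cancellation by -2 and 2, the entries of the Cartan matrix. `H₁` and `H₂` are multiples of the
-- fundamental coweights; cancellations leave the first unchanged, slides the second. Subtracting
-- values of `F` and `G` at alternating points, as in the iterated Pitman transform, gives
-- quantities whose maxima depend only on the dominant path where all raisings end. The obstacle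
-- behind this is confluence. Slides and cancellations do not commute, and the relations between the
-- raising operators of a doubly laced crystal are long. Moreover a slide into `d` keeps the length
-- of the word, so the induction hypothesis says nothing about the two words until both first
-- columns have been reduced, and then the two reductions have to be known to end alike.

module LatticePath where

  open import Data.Nat using (ℕ; zero; suc; z≤n; s≤s)
  import Data.Nat as ℕ
  import Data.Nat.Properties as ℕₚ
  import Data.Integer as ℤ
  open import Data.Integer using (ℤ; +_; -[1+_]; 0ℤ; _+_; _-_; -_) renaming (_≤_ to _≤ᶻ_; _≤?_ to _≤ᶻ?_)
  import Data.Integer.Properties as ℤₚ
  open import Data.Integer.Tactic.RingSolver using (solve-∀)
  open import Relation.Binary.PropositionalEquality using (_≡_; refl; sym; trans; cong; cong₂; subst; subst₂)
  open import Relation.Nullary using (yes; no)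
  open import Relation.Nullary.Decidable using (True; toWitness)

  -- Integer inequalities with a numerical slack

  cross : (H H′ q q′ : ℤ) → H′ + q ≤ᶻ H + q′ → H′ - q′ ≤ᶻ H - q
  cross H H′ q q′ l = subst₂ _≤ᶻ_ (eq H′ q q′) (eq′ H q q′) (ℤₚ.+-monoˡ-≤ (- (q + q′)) l)
    where
    eq : ∀ H′ q q′ → H′ + q + - (q + q′) ≡ H′ - q′
    eq = solve-∀
    eq′ : ∀ H q q′ → H + q′ + - (q + q′) ≡ H - q
    eq′ = solve-∀

  -- A record instead of the bare inequality, so that `c` can be inferred from the type of an
  -- argument; unification could not read it off from a sum `y + c`.
  record Slack (x y c : ℤ) : Set where
    constructor slack
    field
      within : x ≤ᶻ y + c

  exactly : ∀ {x y c} → x ≡ y + c → Slack x y c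
  exactly e = slack (ℤₚ.≤-reflexive e)

  flip : ∀ {x y} c → x ≡ y + c → Slack y x (- c)
  flip {x} {y} c refl = slack (ℤₚ.≤-reflexive (eq y c))
    where
    eq : ∀ y c → y ≡ y + c + - c
    eq = solve-∀

  bound : ∀ {H H′ p p′ q q′ r r′ h a b c} → Slack H′ H h → Slack p p′ a → Slack q q′ b → Slack r r′ c →
          h + (a + b + c) ≤ᶻ 0ℤ → H′ - (p′ + q′ + r′) ≤ᶻ H - (p + q + r)
  bound {H} {H′} {p} {p′} {q} {q′} {r} {r′} {h} {a} {b} {c} (slack H≤) (slack p≤) (slack q≤) (slack r≤) total =
    cross H H′ (p + q + r) (p′ + q′ + r′) (begin
    H′ + (p + q + r)                              ≤⟨ ℤₚ.+-mono-≤ H≤ (ℤₚ.+-mono-≤ (ℤₚ.+-mono-≤ p≤ q≤) r≤) ⟩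
    H + h + (p′ + a + (q′ + b) + (r′ + c))        ≡⟨ eq H h p′ a q′ b r′ c ⟩
    H + (p′ + q′ + r′) + (h + (a + b + c))        ≤⟨ ℤₚ.+-monoʳ-≤ (H + (p′ + q′ + r′)) total ⟩
    H + (p′ + q′ + r′) + 0ℤ                       ≡⟨ ℤₚ.+-identityʳ _ ⟩
    H + (p′ + q′ + r′)                            ∎)
    where
    open ℤₚ.≤-Reasoning
    eq : ∀ H h p a q b r c → H + h + (p + a + (q + b) + (r + c)) ≡ H + (p + q + r) + (h + (a + b + c))
    eq = solve-∀

  double : ∀ {g g′ b} → Slack g g′ b → Slack (g + g) (g′ + g′) (b + b)
  double {g} {g′} {b} (slack l) = slack (ℤₚ.≤-trans (ℤₚ.+-mono-≤ l l) (ℤₚ.≤-reflexive (eq g′ b)))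
    where
    eq : ∀ g b → g + b + (g + b) ≡ g + g + (b + b)
    eq = solve-∀

  -- Max-plus functionals of a path

  infix 4 _⊑_
  record Path : Set where
    constructor path
    field
      F G : ℕ → ℤ
  open Path

  H₁ H₂ : Path → ℕ → ℤ
  H₁ π L = F π (2 ℕ.* L) + G π L
  H₂ π L = F π (2 ℕ.* L) + (G π L + G π L)

  -- Greene-type functionals: if F and G are nonnegative and start at 0, their maxima over s, j, t
  -- and over i, s, j are H₁ and H₂.
  value₁ value₂ : Path → ℕ → ℕ → ℕ → ℕ → ℤ
  value₁ π L s j t = H₁ π L - (F π s + (G π j + G π j) + F π t)
  value₂ π L i s j = H₂ π L - ((G π i + G π i) + (F π s + F π s) + (G π j + G π j))

  record Reaches₁ (π : Path) (L : ℕ) (v : ℤ) : Set where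
    constructor reaches
    field
      s j t : ℕ
      s≤2j : s ℕ.≤ 2 ℕ.* j
      2j≤t : 2 ℕ.* j ℕ.≤ t
      t≤2L : t ℕ.≤ 2 ℕ.* L
      v≤   : v ≤ᶻ value₁ π L s j t

  record Reaches₂ (π : Path) (L : ℕ) (v : ℤ) : Set where
    constructor reaches
    field
      i s j : ℕ
      2i≤s : 2 ℕ.* i ℕ.≤ s
      s≤2j : s ℕ.≤ 2 ℕ.* j
      j≤L  : j ℕ.≤ L
      v≤   : v ≤ᶻ value₂ π L i s j

  -- A comparison of maxima without forming them: mutual `⊑` says that both functionals have equal
  -- maxima at every end point `L`, while a proof only has to exhibit admissible indices.
  record _⊑_ (π ρ : Path) : Set where
    constructor _,_
    field
      reach₁ : ∀ L s j t → s ℕ.≤ 2 ℕ.* j → 2 ℕ.* j ℕ.≤ t → t ℕ.≤ 2 ℕ.* L → Reaches₁ ρ L (value₁ π L s j t)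
      reach₂ : ∀ L i s j → 2 ℕ.* i ℕ.≤ s → s ℕ.≤ 2 ℕ.* j → j ℕ.≤ L → Reaches₂ ρ L (value₂ π L i s j)

  ⊑-refl : ∀ {π} → π ⊑ π
  ⊑-refl = (λ _ _ _ _ l₁ l₂ l₃ → reaches _ _ _ l₁ l₂ l₃ ℤₚ.≤-refl) , (λ _ _ _ _ l₁ l₂ l₃ → reaches _ _ _ l₁ l₂ l₃ ℤₚ.≤-refl)

  ⊑-trans : ∀ {π ρ σ} → π ⊑ ρ → ρ ⊑ σ → π ⊑ σ
  ⊑-trans {π} {ρ} {σ} (f₁ , f₂) (g₁ , g₂) = h₁ , h₂
    where
    h₁ : ∀ L s j t → s ℕ.≤ 2 ℕ.* j → 2 ℕ.* j ℕ.≤ t → t ℕ.≤ 2 ℕ.* L → Reaches₁ σ L (value₁ π L s j t)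
    h₁ L s j t l₁ l₂ l₃ with reaches s′ j′ t′ m₁ m₂ m₃ v ← f₁ L s j t l₁ l₂ l₃
      with reaches s″ j″ t″ n₁ n₂ n₃ w ← g₁ L s′ j′ t′ m₁ m₂ m₃ = reaches s″ j″ t″ n₁ n₂ n₃ (ℤₚ.≤-trans v w)
    h₂ : ∀ L i s j → 2 ℕ.* i ℕ.≤ s → s ℕ.≤ 2 ℕ.* j → j ℕ.≤ L → Reaches₂ σ L (value₂ π L i s j)
    h₂ L i s j l₁ l₂ l₃ with reaches s′ j′ t′ m₁ m₂ m₃ v ← f₂ L i s j l₁ l₂ l₃
      with reaches s″ j″ t″ n₁ n₂ n₃ w ← g₂ L s′ j′ t′ m₁ m₂ m₃ = reaches s″ j″ t″ n₁ n₂ n₃ (ℤₚ.≤-trans v w)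

  module Compare (π ρ : Path) where

    -- The offsets are closed numerals at every call, so the final implicit argument is settled by
    -- evaluation. What remains for the caller is to choose the new indices and to check their
    -- order.
    compare₁ : ∀ {L s j t s′ j′ t′ h a b c} → s′ ℕ.≤ 2 ℕ.* j′ → 2 ℕ.* j′ ℕ.≤ t′ → t′ ℕ.≤ 2 ℕ.* L →
               Slack (H₁ π L) (H₁ ρ L) h → Slack (F ρ s′) (F π s) a → Slack (G ρ j′) (G π j) b → Slack (F ρ t′) (F π t) c →
               {True (h + (a + (b + b) + c) ≤ᶻ? 0ℤ)} → Reaches₁ ρ L (value₁ π L s j t)
    compare₁ l₁ l₂ l₃ H p q r {total} = reaches _ _ _ l₁ l₂ l₃ (bound H p (double q) r (toWitness total))

    compare₂ : ∀ {L i s j i′ s′ j′ h a b c} → 2 ℕ.* i′ ℕ.≤ s′ → s′ ℕ.≤ 2 ℕ.* j′ → j′ ℕ.≤ L →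
               Slack (H₂ π L) (H₂ ρ L) h → Slack (G ρ i′) (G π i) a → Slack (F ρ s′) (F π s) b → Slack (G ρ j′) (G π j) c →
               {True (h + (a + a + (b + b) + (c + c)) ≤ᶻ? 0ℤ)} → Reaches₂ ρ L (value₂ π L i s j)
    compare₂ l₁ l₂ l₃ H p q r {total} = reaches _ _ _ l₁ l₂ l₃ (bound H (double p) (double q) (double r) (toWitness total))

  data Side (n t : ℕ) : Set where
    before : t ℕ.≤ n → Side n t
    after  : suc n ℕ.≤ t → Side n t

  side : ∀ n t → Side n t
  side n t with t ℕ.≤? n
  ... | yes l = before l
  ... | no ¬l = after (ℕₚ.≰⇒> ¬l)

  2* : ∀ {i j} → i ℕ.≤ j → 2 ℕ.* i ℕ.≤ 2 ℕ.* j
  2* = ℕₚ.*-monoʳ-≤ 2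

  2+2* : ∀ {i j} → i ℕ.< j → suc (suc (2 ℕ.* i)) ℕ.≤ 2 ℕ.* j
  2+2* {i} {j} i<j = subst (ℕ._≤ 2 ℕ.* j) (ℕₚ.*-suc 2 i) (2* i<j)

  half-< : ∀ {i j} → 2 ℕ.* i ℕ.< 2 ℕ.* j → i ℕ.< j
  half-< {i} {j} l = ℕₚ.*-cancelˡ-< 2 i j l

  -1ℤ : ℤ
  -1ℤ = -[1+ 0 ]

  -- Effect on a path of moving the letter of rank a from the second column to the first one.
  record Shift (π π′ : Path) (a : ℕ) (m : ℤ) : Set where
    field
      F-before : ∀ t → t ℕ.≤ a → F π′ t ≡ F π t + 0ℤ
      F-after  : ∀ t → a ℕ.< t → F π′ t ≡ F π t + + 2
      G-before : ∀ j → 2 ℕ.* j ℕ.≤ a → G π′ j ≡ G π j + 0ℤ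
      G-after  : ∀ j → a ℕ.< 2 ℕ.* j → G π′ j ≡ G π j + -1ℤ
      above    : ∀ t → t ℕ.≤ a → m + + 1 ≤ᶻ F π t
      least    : ∀ t → m ≤ᶻ F π t
      at       : F π a ≡ m + + 1
      at-suc   : F π (suc a) ≡ m

    -- `drop` moves an index lying before the first minimum of `F` onto that minimum and gains at
    -- least one; `raise` moves an index to `a`, the last point that the slide leaves unchanged, and
    -- loses at most one. No other change of indices occurs in the two comparisons below.
    drop : ∀ t → t ℕ.≤ a → Slack (F π (suc a)) (F π′ t) -1ℤ
    drop t l = slack (begin
      F π (suc a)       ≡⟨ trans at-suc (eq m) ⟩
      m + + 1 + -1ℤ     ≤⟨ ℤₚ.+-monoˡ-≤ -1ℤ (above t l) ⟩
      F π t + -1ℤ       ≡⟨ cong (_+ -1ℤ) (trans (F-before t l) (ℤₚ.+-identityʳ (F π t))) ⟨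
      F π′ t + -1ℤ      ∎)
      where
      open ℤₚ.≤-Reasoning
      eq : ∀ m → m ≡ m + + 1 + -1ℤ
      eq = solve-∀

    raise : ∀ t → Slack (F π′ a) (F π t) (+ 1)
    raise t = slack (begin
      F π′ a         ≡⟨ trans (F-before a ℕₚ.≤-refl) (trans (ℤₚ.+-identityʳ _) at) ⟩
      m + + 1        ≤⟨ ℤₚ.+-monoˡ-≤ (+ 1) (least t) ⟩
      F π t + + 1    ∎)
      where open ℤₚ.≤-Reasoning

    H₁-before : ∀ L → 2 ℕ.* L ℕ.≤ a → H₁ π′ L ≡ H₁ π L + 0ℤ
    H₁-before L l = trans (cong₂ _+_ (F-before _ l) (G-before L l)) (eq (F π (2 ℕ.* L)) (G π L))
      where
      eq : ∀ x y → x + 0ℤ + (y + 0ℤ) ≡ x + y + 0ℤ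
      eq = solve-∀

    H₁-after : ∀ L → a ℕ.< 2 ℕ.* L → H₁ π′ L ≡ H₁ π L + + 1
    H₁-after L l = trans (cong₂ _+_ (F-after _ l) (G-after L l)) (eq (F π (2 ℕ.* L)) (G π L))
      where
      eq : ∀ x y → x + + 2 + (y + -1ℤ) ≡ x + y + + 1
      eq = solve-∀

    H₂-same : ∀ L → H₂ π′ L ≡ H₂ π L + 0ℤ
    H₂-same L with side a (2 ℕ.* L)
    ... | before l = trans (cong₂ _+_ (F-before _ l) (cong₂ _+_ (G-before L l) (G-before L l))) (eq (F π (2 ℕ.* L)) (G π L))
      where
      eq : ∀ x y → x + 0ℤ + (y + 0ℤ + (y + 0ℤ)) ≡ x + (y + y) + 0ℤ
      eq = solve-∀
    ... | after l = trans (cong₂ _+_ (F-after _ l) (cong₂ _+_ (G-after L l) (G-after L l))) (eq (F π (2 ℕ.* L)) (G π L))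
      where
      eq : ∀ x y → x + + 2 + (y + -1ℤ + (y + -1ℤ)) ≡ x + (y + y) + 0ℤ
      eq = solve-∀

    shift-⊒ : π′ ⊑ π
    shift-⊒ = r₁ , r₂
      where
      open Compare π′ π
      r₁ : ∀ L s j t → s ℕ.≤ 2 ℕ.* j → 2 ℕ.* j ℕ.≤ t → t ℕ.≤ 2 ℕ.* L → Reaches₁ π L (value₁ π′ L s j t)
      r₁ L s j t l₁ l₂ l₃ with side a (2 ℕ.* L)
      ... | before l = compare₁ {L} {j = j} {j′ = j} l₁ l₂ l₃ (exactly (H₁-before L l)) (flip 0ℤ (F-before s (ℕₚ.≤-trans l₁ lj))) (flip 0ℤ (G-before j lj)) (flip 0ℤ (F-before t lt))
        where
        lt = ℕₚ.≤-trans l₃ l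
        lj = ℕₚ.≤-trans l₂ lt
      ... | after l with side a t
      ...   | before lt = compare₁ {L} {j = j} {j′ = j} {t′ = suc a} l₁ (ℕₚ.m≤n⇒m≤1+n lj) l (exactly (H₁-after L l)) (flip 0ℤ (F-before s (ℕₚ.≤-trans l₁ lj))) (flip 0ℤ (G-before j lj)) (drop t lt)
        where lj = ℕₚ.≤-trans l₂ lt
      ...   | after lt with side a (2 ℕ.* j)
      ...     | before lj = compare₁ {L} {j = j} {j′ = j} l₁ l₂ l₃ (exactly (H₁-after L l)) (flip 0ℤ (F-before s (ℕₚ.≤-trans l₁ lj))) (flip 0ℤ (G-before j lj)) (flip (+ 2) (F-after t lt))
      ...     | after lj with side a s
      ...       | before ls = compare₁ {L} {j = j} {s′ = suc a} {j′ = j} lj l₂ l₃ (exactly (H₁-after L l)) (drop s ls) (flip -1ℤ (G-after j lj)) (flip (+ 2) (F-after t lt))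
      ...       | after ls  = compare₁ {L} {j = j} {j′ = j} l₁ l₂ l₃ (exactly (H₁-after L l)) (flip (+ 2) (F-after s ls)) (flip -1ℤ (G-after j lj)) (flip (+ 2) (F-after t lt))
      r₂ : ∀ L i s j → 2 ℕ.* i ℕ.≤ s → s ℕ.≤ 2 ℕ.* j → j ℕ.≤ L → Reaches₂ π L (value₂ π′ L i s j)
      r₂ L i s j l₁ l₂ l₃ with side a (2 ℕ.* i)
      ... | after li = compare₂ {L} {i} {i′ = i} {j′ = j} l₁ l₂ l₃ (exactly (H₂-same L)) (flip -1ℤ (G-after i li)) (flip (+ 2) (F-after s ls)) (flip -1ℤ (G-after j (ℕₚ.<-≤-trans ls l₂)))
        where ls = ℕₚ.<-≤-trans li l₁
      ... | before li with side a (2 ℕ.* j)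
      ...   | before lj = compare₂ {L} {i} {i′ = i} {j′ = j} l₁ l₂ l₃ (exactly (H₂-same L)) (flip 0ℤ (G-before i li)) (flip 0ℤ (F-before s (ℕₚ.≤-trans l₂ lj))) (flip 0ℤ (G-before j lj))
      ...   | after lj with side a s
      ...     | before ls = compare₂ {L} {i} {i′ = i} {s′ = suc a} {j′ = j} (ℕₚ.m≤n⇒m≤1+n li) lj l₃ (exactly (H₂-same L)) (flip 0ℤ (G-before i li)) (drop s ls) (flip -1ℤ (G-after j lj))
      ...     | after ls  = compare₂ {L} {i} {i′ = i} {j′ = j} l₁ l₂ l₃ (exactly (H₂-same L)) (flip 0ℤ (G-before i li)) (flip (+ 2) (F-after s ls)) (flip -1ℤ (G-after j lj))

    shift-⊑ : π ⊑ π′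
    shift-⊑ = r₁ , r₂
      where
      open Compare π π′
      r₁ : ∀ L s j t → s ℕ.≤ 2 ℕ.* j → 2 ℕ.* j ℕ.≤ t → t ℕ.≤ 2 ℕ.* L → Reaches₁ π′ L (value₁ π L s j t)
      r₁ L s j t l₁ l₂ l₃ with side a (2 ℕ.* L)
      ... | before l = compare₁ {L} {j = j} {j′ = j} l₁ l₂ l₃ (flip 0ℤ (H₁-before L l)) (exactly (F-before s (ℕₚ.≤-trans l₁ lj))) (exactly (G-before j lj)) (exactly (F-before t lt))
        where
        lt = ℕₚ.≤-trans l₃ l
        lj = ℕₚ.≤-trans l₂ lt
      ... | after l with side a t
      ...   | before lt = compare₁ {L} {j = j} {j′ = j} l₁ l₂ l₃ (flip (+ 1) (H₁-after L l)) (exactly (F-before s (ℕₚ.≤-trans l₁ lj))) (exactly (G-before j lj)) (exactly (F-before t lt))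
        where lj = ℕₚ.≤-trans l₂ lt
      ...   | after lt with side a (2 ℕ.* j)
      ...     | before lj = compare₁ {L} {j = j} {j′ = j} {t′ = a} l₁ lj (ℕₚ.<⇒≤ l) (flip (+ 1) (H₁-after L l)) (exactly (F-before s (ℕₚ.≤-trans l₁ lj))) (exactly (G-before j lj)) (raise t)
      ...     | after lj with side a s
      ...       | before ls = compare₁ {L} {j = j} {j′ = j} l₁ l₂ l₃ (flip (+ 1) (H₁-after L l)) (exactly (F-before s ls)) (exactly (G-after j lj)) (exactly (F-after t lt))
      ...       | after ls  = compare₁ {L} {j = j} {s′ = a} {j′ = j} (ℕₚ.<⇒≤ lj) l₂ l₃ (flip (+ 1) (H₁-after L l)) (raise s) (exactly (G-after j lj)) (exactly (F-after t lt))
      r₂ : ∀ L i s j → 2 ℕ.* i ℕ.≤ s → s ℕ.≤ 2 ℕ.* j → j ℕ.≤ L → Reaches₂ π′ L (value₂ π L i s j)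
      r₂ L i s j l₁ l₂ l₃ with side a (2 ℕ.* i)
      ... | after li = compare₂ {L} {i} {i′ = i} {j′ = j} l₁ l₂ l₃ (flip 0ℤ (H₂-same L)) (exactly (G-after i li)) (exactly (F-after s ls)) (exactly (G-after j (ℕₚ.<-≤-trans ls l₂)))
        where ls = ℕₚ.<-≤-trans li l₁
      ... | before li with side a s
      ...   | after ls = compare₂ {L} {i} {i′ = i} {s′ = a} {j′ = j} li (ℕₚ.≤-trans (ℕₚ.<⇒≤ ls) l₂) l₃ (flip 0ℤ (H₂-same L)) (exactly (G-before i li)) (raise s) (exactly (G-after j (ℕₚ.<-≤-trans ls l₂)))
      ...   | before ls with side a (2 ℕ.* j)
      ...     | before lj = compare₂ {L} {i} {i′ = i} {j′ = j} l₁ l₂ l₃ (flip 0ℤ (H₂-same L)) (exactly (G-before i li)) (exactly (F-before s ls)) (exactly (G-before j lj))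
      ...     | after lj  = compare₂ {L} {i} {i′ = i} {j′ = j} l₁ l₂ l₃ (flip 0ℤ (H₂-same L)) (exactly (G-before i li)) (exactly (F-before s ls)) (exactly (G-after j lj))

  -- Effect on a path of removing plain i and bar i from the first column.
  record Erase (π π′ : Path) (i : ℕ) (m : ℤ) : Set where
    field
      F-low  : ∀ t → t ℕ.≤ 2 ℕ.* i → F π′ t ≡ F π t + 0ℤ
      F-mid  : F π′ (suc (2 ℕ.* i)) ≡ F π (suc (2 ℕ.* i)) + -1ℤ
      F-high : ∀ t → suc (2 ℕ.* i) ℕ.< t → F π′ t ≡ F π t + -[1+ 1 ]
      G-low  : ∀ j → j ℕ.≤ i → G π′ j ≡ G π j + 0ℤ
      G-high : ∀ j → i ℕ.< j → G π′ j ≡ G π j + + 2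
      above  : ∀ j → j ℕ.≤ i → m + + 1 ≤ᶻ G π j
      least  : ∀ j → m ≤ᶻ G π j
      at     : G π i ≡ m + + 1
      at-suc : G π (suc i) ≡ m
      -- The first column contains both letters and the second one contains each at most once, so
      -- `F` does not fall across plain i and rises by at most one across bar i.
      first  : F π (2 ℕ.* i) ≤ᶻ F π (suc (2 ℕ.* i))
      second : F π (2 ℕ.* suc i) ≤ᶻ F π (suc (2 ℕ.* i)) + + 1

    drop : ∀ j → j ℕ.≤ i → Slack (G π (suc i)) (G π′ j) -1ℤ
    drop j l = slack (begin
      G π (suc i)       ≡⟨ trans at-suc (eq m) ⟩
      m + + 1 + -1ℤ     ≤⟨ ℤₚ.+-monoˡ-≤ -1ℤ (above j l) ⟩
      G π j + -1ℤ       ≡⟨ cong (_+ -1ℤ) (trans (G-low j l) (ℤₚ.+-identityʳ (G π j))) ⟨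
      G π′ j + -1ℤ      ∎)
      where
      open ℤₚ.≤-Reasoning
      eq : ∀ m → m ≡ m + + 1 + -1ℤ
      eq = solve-∀

    raise : ∀ j → Slack (G π′ i) (G π j) (+ 1)
    raise j = slack (begin
      G π′ i         ≡⟨ trans (G-low i ℕₚ.≤-refl) (trans (ℤₚ.+-identityʳ _) at) ⟩
      m + + 1        ≤⟨ ℤₚ.+-monoˡ-≤ (+ 1) (least j) ⟩
      G π j + + 1    ∎)
      where open ℤₚ.≤-Reasoning

    weaken : ∀ {x y c} d → Slack x y c → c ≤ᶻ d → Slack x y d
    weaken {y = y} d (slack l) c≤d = slack (ℤₚ.≤-trans l (ℤₚ.+-monoʳ-≤ y c≤d))

    ≤-mid : ∀ {t} → t ℕ.≤ suc (2 ℕ.* i) → 2 ℕ.* i ℕ.< t → t ≡ suc (2 ℕ.* i)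
    ≤-mid l l′ = ℕₚ.≤-antisym l l′

    F-old-mid : ∀ t → t ℕ.≤ suc (2 ℕ.* i) → Slack (F π t) (F π′ t) (+ 1)
    F-old-mid t l with side (2 ℕ.* i) t
    ... | before l′ = weaken (+ 1) (flip 0ℤ (F-low t l′)) (ℤ.+≤+ z≤n)
    ... | after l′ with refl ← ≤-mid l l′ = flip -1ℤ F-mid

    F-old : ∀ t → Slack (F π t) (F π′ t) (+ 2)
    F-old t with side (suc (2 ℕ.* i)) t
    ... | before l = weaken (+ 2) (F-old-mid t l) (ℤ.+≤+ (s≤s z≤n))
    ... | after l  = flip -[1+ 1 ] (F-high t l)

    F-new-mid : ∀ t → 2 ℕ.* i ℕ.< t → Slack (F π′ t) (F π t) -1ℤ
    F-new-mid t l with side (suc (2 ℕ.* i)) t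
    ... | before l′ with refl ← ≤-mid l′ l = exactly F-mid
    ... | after l′ = weaken -1ℤ (exactly (F-high t l′)) (ℤ.-≤- z≤n)

    F-new : ∀ t → Slack (F π′ t) (F π t) 0ℤ
    F-new t with side (2 ℕ.* i) t
    ... | before l = exactly (F-low t l)
    ... | after l  = weaken 0ℤ (F-new-mid t l) ℤ.-≤+

    ≥-high : ∀ {j t} → i ℕ.< j → 2 ℕ.* j ℕ.≤ t → suc (2 ℕ.* i) ℕ.< t
    ≥-high l l′ = ℕₚ.≤-trans (2+2* l) l′

    H₁-same : ∀ L → H₁ π′ L ≡ H₁ π L + 0ℤ
    H₁-same L with side i L
    ... | before l = trans (cong₂ _+_ (F-low _ (2* l)) (G-low L l)) (eq (F π (2 ℕ.* L)) (G π L))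
      where
      eq : ∀ x y → x + 0ℤ + (y + 0ℤ) ≡ x + y + 0ℤ
      eq = solve-∀
    ... | after l = trans (cong₂ _+_ (F-high _ (≥-high l ℕₚ.≤-refl)) (G-high L l)) (eq (F π (2 ℕ.* L)) (G π L))
      where
      eq : ∀ x y → x + -[1+ 1 ] + (y + + 2) ≡ x + y + 0ℤ
      eq = solve-∀

    H₂-low : ∀ L → L ℕ.≤ i → H₂ π′ L ≡ H₂ π L + 0ℤ
    H₂-low L l = trans (cong₂ _+_ (F-low _ (2* l)) (cong₂ _+_ (G-low L l) (G-low L l))) (eq (F π (2 ℕ.* L)) (G π L))
      where
      eq : ∀ x y → x + 0ℤ + (y + 0ℤ + (y + 0ℤ)) ≡ x + (y + y) + 0ℤ
      eq = solve-∀

    H₂-high : ∀ L → i ℕ.< L → H₂ π′ L ≡ H₂ π L + + 2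
    H₂-high L l = trans (cong₂ _+_ (F-high _ (≥-high l ℕₚ.≤-refl)) (cong₂ _+_ (G-high L l) (G-high L l))) (eq (F π (2 ℕ.* L)) (G π L))
      where
      eq : ∀ x y → x + -[1+ 1 ] + (y + + 2 + (y + + 2)) ≡ x + (y + y) + + 2
      eq = solve-∀

    ≤-2suc : ∀ {t} → t ℕ.≤ 2 ℕ.* i → t ℕ.≤ 2 ℕ.* suc i
    ≤-2suc l = ℕₚ.≤-trans l (2* (ℕₚ.n≤1+n i))

    2suc-≤ : ∀ {t} → suc (2 ℕ.* i) ℕ.< t → 2 ℕ.* suc i ℕ.≤ t
    2suc-≤ {t} = subst (ℕ._≤ t) (sym (ℕₚ.*-suc 2 i))

    erase-⊒ : π′ ⊑ π
    erase-⊒ = r₁ , r₂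
      where
      open Compare π′ π
      r₁ : ∀ L s j t → s ℕ.≤ 2 ℕ.* j → 2 ℕ.* j ℕ.≤ t → t ℕ.≤ 2 ℕ.* L → Reaches₁ π L (value₁ π′ L s j t)
      r₁ L s j t l₁ l₂ l₃ with side i j
      ... | after lj = compare₁ {L} {j = j} {j′ = j} l₁ l₂ l₃ (exactly (H₁-same L)) (F-old s) (flip (+ 2) (G-high j lj)) (F-old t)
      ... | before lj with side (2 ℕ.* i) t
      ...   | before lt = compare₁ {L} {j = j} {j′ = j} l₁ l₂ l₃ (exactly (H₁-same L)) (flip 0ℤ (F-low s (ℕₚ.≤-trans l₁ (2* lj)))) (flip 0ℤ (G-low j lj)) (flip 0ℤ (F-low t lt))
      ...   | after lt with side (suc (2 ℕ.* i)) t
      ...     | after lt′ = compare₁ {L} {j = j} {j′ = suc i} (≤-2suc ls) (2suc-≤ lt′) l₃ (exactly (H₁-same L)) (flip 0ℤ (F-low s ls)) (drop j lj) (F-old t)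
        where ls = ℕₚ.≤-trans l₁ (2* lj)
      -- Here `t` lies between plain i and bar i, where only half of the cancellation is visible. As
      -- the middle index moves up to `suc i`, `t` has to move to `2 * suc i`, and `second` bounds
      -- the loss.
      ...     | before lt′ with refl ← ≤-mid lt′ lt = compare₁ {L} {j = j} {j′ = suc i} (≤-2suc ls) ℕₚ.≤-refl (2* {suc i} {L} (half-< {i} {L} (ℕₚ.<-≤-trans lt l₃))) (exactly (H₁-same L)) (flip 0ℤ (F-low s ls)) (drop j lj) (slack last)
        where
        ls = ℕₚ.≤-trans l₁ (2* lj)
        open ℤₚ.≤-Reasoning
        eq : ∀ x → x + + 1 ≡ x + -1ℤ + + 2
        eq = solve-∀
        last : F π (2 ℕ.* suc i) ≤ᶻ F π′ t + + 2
        last = begin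
          F π (2 ℕ.* suc i)          ≤⟨ second ⟩
          F π t + + 1                ≡⟨ eq (F π t) ⟩
          F π t + -1ℤ + + 2          ≡⟨ cong (_+ + 2) F-mid ⟨
          F π′ t + + 2               ∎
      r₂ : ∀ L i₀ s j → 2 ℕ.* i₀ ℕ.≤ s → s ℕ.≤ 2 ℕ.* j → j ℕ.≤ L → Reaches₂ π L (value₂ π′ L i₀ s j)
      r₂ L i₀ s j l₁ l₂ l₃ with side i L
      ... | before l = compare₂ {L} {i₀} {i′ = i₀} {j′ = j} l₁ l₂ l₃ (exactly (H₂-low L l)) (flip 0ℤ (G-low i₀ (ℕₚ.*-cancelˡ-≤ 2 (ℕₚ.≤-trans l₁ ls)))) (flip 0ℤ (F-low s ls)) (flip 0ℤ (G-low j lj))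
        where
        lj = ℕₚ.≤-trans l₃ l
        ls = ℕₚ.≤-trans l₂ (2* lj)
      ... | after l with side i j
      ...   | before lj = compare₂ {L} {i₀} {i′ = i₀} {j′ = suc i} l₁ (≤-2suc ls) l (exactly (H₂-high L l)) (flip 0ℤ (G-low i₀ (ℕₚ.*-cancelˡ-≤ 2 (ℕₚ.≤-trans l₁ ls)))) (flip 0ℤ (F-low s ls)) (drop j lj)
        where ls = ℕₚ.≤-trans l₂ (2* lj)
      ...   | after lj with side i i₀
      ...     | after li = compare₂ {L} {i₀} {i′ = i₀} {j′ = j} l₁ l₂ l₃ (exactly (H₂-high L l)) (flip (+ 2) (G-high i₀ li)) (F-old s) (flip (+ 2) (G-high j lj))
      ...     | before li with side (suc (2 ℕ.* i)) s
      ...       | before ls = compare₂ {L} {i₀} {i′ = i₀} {j′ = j} l₁ l₂ l₃ (exactly (H₂-high L l)) (flip 0ℤ (G-low i₀ li)) (F-old-mid s ls) (flip (+ 2) (G-high j lj))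
      ...       | after ls  = compare₂ {L} {i₀} {i′ = suc i} {j′ = j} (2suc-≤ ls) l₂ l₃ (exactly (H₂-high L l)) (drop i₀ li) (F-old s) (flip (+ 2) (G-high j lj))

    erase-⊑ : π ⊑ π′
    erase-⊑ = r₁ , r₂
      where
      open Compare π π′
      r₁ : ∀ L s j t → s ℕ.≤ 2 ℕ.* j → 2 ℕ.* j ℕ.≤ t → t ℕ.≤ 2 ℕ.* L → Reaches₁ π′ L (value₁ π L s j t)
      r₁ L s j t l₁ l₂ l₃ with side i j
      ... | before lj = compare₁ {L} {j = j} {j′ = j} l₁ l₂ l₃ (flip 0ℤ (H₁-same L)) (F-new s) (exactly (G-low j lj)) (F-new t)
      ... | after lj with side (2 ℕ.* i) s
      ...   | before ls = compare₁ {L} {j = j} {j′ = i} ls (ℕₚ.≤-trans (2* (ℕₚ.<⇒≤ lj)) l₂) l₃ (flip 0ℤ (H₁-same L)) (F-new s) (raise j) (exactly (F-high t (≥-high lj l₂)))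
      ...   | after ls with side (suc (2 ℕ.* i)) s
      ...     | after ls′ = compare₁ {L} {j = j} {j′ = j} l₁ l₂ l₃ (flip 0ℤ (H₁-same L)) (exactly (F-high s ls′)) (exactly (G-high j lj)) (exactly (F-high t (≥-high lj l₂)))
      -- Here `s` lies between the two letters. As the middle index moves down to `i`, `s` moves to
      -- `2 * i`, where `F` is no larger by `first`.
      ...     | before ls′ with refl ← ≤-mid ls′ ls = compare₁ {L} {j = j} {s′ = 2 ℕ.* i} {j′ = i} ℕₚ.≤-refl (ℕₚ.≤-trans (2* (ℕₚ.<⇒≤ lj)) l₂) l₃ (flip 0ℤ (H₁-same L)) (slack start) (raise j) (exactly (F-high t (≥-high lj l₂)))
        where
        start : F π′ (2 ℕ.* i) ≤ᶻ F π s + 0ℤ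
        start = subst (_≤ᶻ F π s + 0ℤ) (sym (F-low _ ℕₚ.≤-refl)) (ℤₚ.+-monoˡ-≤ 0ℤ first)
      r₂ : ∀ L i₀ s j → 2 ℕ.* i₀ ℕ.≤ s → s ℕ.≤ 2 ℕ.* j → j ℕ.≤ L → Reaches₂ π′ L (value₂ π L i₀ s j)
      r₂ L i₀ s j l₁ l₂ l₃ with side i L
      ... | before l = compare₂ {L} {i₀} {i′ = i₀} {j′ = j} l₁ l₂ l₃ (flip 0ℤ (H₂-low L l)) (exactly (G-low i₀ (ℕₚ.*-cancelˡ-≤ 2 (ℕₚ.≤-trans l₁ ls)))) (F-new s) (exactly (G-low j lj))
        where
        lj = ℕₚ.≤-trans l₃ l
        ls = ℕₚ.≤-trans l₂ (2* lj)
      ... | after l with side i j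
      ...   | before lj = compare₂ {L} {i₀} {i′ = i₀} {j′ = j} l₁ l₂ l₃ (flip (+ 2) (H₂-high L l)) (exactly (G-low i₀ (ℕₚ.*-cancelˡ-≤ 2 (ℕₚ.≤-trans l₁ (ℕₚ.≤-trans l₂ (2* lj)))))) (F-new s) (exactly (G-low j lj))
      ...   | after lj with side i i₀
      ...     | after li = compare₂ {L} {i₀} {i′ = i} {j′ = j} (ℕₚ.≤-trans (2* (ℕₚ.<⇒≤ li)) l₁) l₂ l₃ (flip (+ 2) (H₂-high L l)) (raise i₀) (exactly (F-high s (≥-high li l₁))) (exactly (G-high j lj))
      ...     | before li with side (2 ℕ.* i) s
      ...       | before ls = compare₂ {L} {i₀} {i′ = i₀} {j′ = i} l₁ ls (ℕₚ.<⇒≤ l) (flip (+ 2) (H₂-high L l)) (exactly (G-low i₀ li)) (F-new s) (raise j)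
      ...       | after ls  = compare₂ {L} {i₀} {i′ = i₀} {j′ = j} l₁ l₂ l₃ (flip (+ 2) (H₂-high L l)) (exactly (G-low i₀ li)) (F-new-mid s ls) (exactly (G-high j lj))

open import Data.Fin as Fin using (Fin; toℕ)
import Data.Fin.Properties as Finₚ
open import Data.Integer as ℤ using (ℤ; +_; 0ℤ)
import Data.Integer.Properties as ℤₚ
open import Data.Integer.Tactic.RingSolver using () renaming (solve-∀ to solveℤ)
open import Data.List using ([]; _∷_; _++_; _∷ʳ_; [_]; map; length; foldl; concat; reverse; break; splitAt; lookup)
open import Data.List.Base using (InitLast; initLast; _∷ʳ′_)
open import Data.List.Membership.Propositional using (_∈_)
open import Data.List.Membership.Propositional.Properties using (∈-++⁺ʳ)
open import Data.List.Properties as Listₚ using (++-assoc; ++-identityʳ; concat-++; unfold-reverse; foldl-++; length-++; length-reverse; foldl-∷ʳ)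
open import Data.List.Relation.Binary.Pointwise using (Pointwise; []; _∷_)
open import Data.List.Relation.Binary.Prefix.Heterogeneous using (Prefix; []; _∷_; _++ᵖ_)
import Data.List.Relation.Binary.Prefix.Heterogeneous.Properties as Prefixₚ
open import Data.List.Relation.Unary.All as All using (All; []; _∷_)
import Data.List.Relation.Unary.All.Properties as Allₚ
open import Data.List.Relation.Unary.AllPairs using (AllPairs; []; _∷_)
open import Data.List.Relation.Unary.Any using (here; there)
open import Data.List.Relation.Unary.Linked as Linked using (Linked; []; [-]; _∷_)
import Data.List.Relation.Unary.Linked.Properties as Linkedₚ
open import Data.Maybe using (Maybe; just; nothing)
open import Data.Nat as ℕ using (ℕ; zero; suc; z≤n; s≤s; _+_; _*_; _∸_; NonZero)
import Data.Nat.Properties as ℕₚ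
open import Data.Nat.Tactic.RingSolver using () renaming (solve-∀ to solveℕ)
open import Data.Product using (_×_; _,_; ∃-syntax; proj₁; proj₂; ∃!)
open import Data.Sum using (_⊎_; inj₁; inj₂)
open import Level using (0ℓ)
import Relation.Binary.Construct.Closure.Equivalence as Eq
open import Relation.Binary.Construct.Closure.ReflexiveTransitive as Star using (Star; ε; _◅_; _◅◅_)
open import Relation.Binary.Construct.Closure.Symmetric as Sym using (SymClosure)
open import Relation.Binary.Construct.Union using (_∪_)
open import Relation.Binary.Definitions using (tri<; tri≈; tri>)
open import Relation.Binary.PropositionalEquality using (_≡_; refl; sym; trans; cong; cong₂; subst; subst₂; module ≡-Reasoning)
import Relation.Binary.PropositionalEquality.Properties as Eqₚ
import Relation.Binary.Reasoning.Setoid as SetoidReasoning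
open import Relation.Nullary using (yes; no; contradiction; ¬_; Dec)
open import Relation.Unary using (Pred; Decidable)

variable
  k : ℕ
  x y z a b h : Letter k
  p q r r′ s t u v w out : Word k
  o : Maybe (Letter k)
  T : Filling k

-- Plactic congruence

≡A-refl : {w : Word k} → w ≡A w
≡A-refl = Eq.reflexive _⇝_

≡A-sym : {v w : Word k} → v ≡A w → w ≡A v
≡A-sym = Eq.symmetric _⇝_

≡A-trans : {u v w : Word k} → u ≡A v → v ≡A w → u ≡A w
≡A-trans = Eq.transitive _⇝_

≡⇒≡A : {v w : Word k} → v ≡ w → v ≡A w
≡⇒≡A refl = ≡A-refl

module ≡A-Reasoning {k} = SetoidReasoning (Eq.setoid (_⇝_ {k}))

⇝-++ˡ : (p : Word k) → u ⇝ v → p ++ u ⇝ p ++ v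
⇝-++ˡ p (yxz u v x<y y≤z) = subst₂ _⇝_ (++-assoc p u _) (++-assoc p u _) (yxz (p ++ u) v x<y y≤z)
⇝-++ˡ p (xzy u v x≤y y<z) = subst₂ _⇝_ (++-assoc p u _) (++-assoc p u _) (xzy (p ++ u) v x≤y y<z)

⇝-++ʳ : (q : Word k) → u ⇝ v → u ++ q ⇝ v ++ q
⇝-++ʳ q (yxz u v x<y y≤z) = subst₂ _⇝_ (sym (++-assoc u _ q)) (sym (++-assoc u _ q)) (yxz u (v ++ q) x<y y≤z)
⇝-++ʳ q (xzy u v x≤y y<z) = subst₂ _⇝_ (sym (++-assoc u _ q)) (sym (++-assoc u _ q)) (xzy u (v ++ q) x≤y y<z)

++ˡ : (p : Word k) → u ≡A v → p ++ u ≡A p ++ v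
++ˡ p = Eq.gmap (p ++_) (⇝-++ˡ p)

++ʳ : (q : Word k) → u ≡A v → u ++ q ≡A v ++ q
++ʳ q = Eq.gmap (_++ q) (⇝-++ʳ q)

yxz-≡A : (x y z : Letter k) (v : Word k) → x < y → y ≤ z → y ∷ x ∷ z ∷ v ≡A y ∷ z ∷ x ∷ v
yxz-≡A x y z v x<y y≤z = Eq.return (yxz [] v {x} {y} {z} x<y y≤z)

xzy-≡A : (x y z : Letter k) (v : Word k) → x ≤ y → y < z → x ∷ z ∷ y ∷ v ≡A z ∷ x ∷ y ∷ v
xzy-≡A x y z v x≤y y<z = Eq.return (xzy [] v {x} {y} {z} x≤y y<z)

-- Row insertion into a single row

Sorted : Word k → Set
Sorted = AllPairs _≤_

data Ins {k} (x : Letter k) : Word k → Word k → Maybe (Letter k) → Set where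
  end  : Ins x [] [ x ] nothing
  hit  : x < a → Ins x (a ∷ r) (x ∷ r) (just a)
  pass : a ≤ x → Ins x r r′ o → Ins x (a ∷ r) (a ∷ r′) o

toWord : Maybe (Letter k) → Word k
toWord nothing  = []
toWord (just x) = [ x ]

infixr 5 _∷_
-- A single derivation yields both a Knuth equivalence of words (`Proc-≡A`) and an equality of
-- tableaux (`◂-Proc`): the bumped letters, in order, form the word that enters the next row.
data Proc {k} : Word k → Word k → Word k → Word k → Set where
  []  : Proc r [] r []
  _∷_ : Ins x r r′ o → Proc r′ w s out → Proc r (x ∷ w) s (toWord o ++ out)

newRow : Letter k → Word k → Word k
newRow x []      = [ x ]
newRow x (a ∷ r) with x <? a
... | yes _ = x ∷ r
... | no  _ = a ∷ newRow x r

bumped : Letter k → Word k → Maybe (Letter k)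
bumped x []      = nothing
bumped x (a ∷ r) with x <? a
... | yes _ = just a
... | no  _ = bumped x r

ins : (x : Letter k) (r : Word k) → Ins x r (newRow x r) (bumped x r)
ins x []      = end
ins x (a ∷ r) with x <? a
... | yes x<a = hit x<a
... | no  x≮a = pass (ℕₚ.≮⇒≥ x≮a) (ins x r)

Ins⇒≡ : Ins x r r′ o → newRow x r ≡ r′ × bumped x r ≡ o
Ins⇒≡ end = refl , refl
Ins⇒≡ {x = x} (hit {a = a} x<a) with x <? a
... | yes _  = refl , refl
... | no x≮a = contradiction x<a x≮a
Ins⇒≡ {x = x} (pass {a = a} a≤x i) with x <? a
... | yes x<a = contradiction a≤x (ℕₚ.<⇒≱ x<a)
... | no  _   = let e , f = Ins⇒≡ i in cong (a ∷_) e , f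

Ins-All : {P : Letter k → Set} → Ins x r r′ o → P x → All P r → All P r′
Ins-All end         px _          = px ∷ []
Ins-All (hit _)     px (_ ∷ pr)   = px ∷ pr
Ins-All (pass _ i)  px (pa ∷ pr)  = pa ∷ Ins-All i px pr

Ins-All-bumped : {P : Letter k → Set} → Ins x r r′ (just y) → All P r → P y
Ins-All-bumped (hit _)    (pa ∷ _)  = pa
Ins-All-bumped (pass _ i) (_ ∷ pr)  = Ins-All-bumped i pr

Ins-< : Ins x r r′ (just y) → x < y
Ins-< (hit x<a)  = x<a
Ins-< (pass _ i) = Ins-< i

Ins-Sorted : Ins x r r′ o → Sorted r → Sorted r′
Ins-Sorted end          _            = [] ∷ []
Ins-Sorted (hit x<a)    (a≤r ∷ sr)   = All.map (ℕₚ.≤-trans (ℕₚ.<⇒≤ x<a)) a≤r ∷ sr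
Ins-Sorted (pass a≤x i) (a≤r ∷ sr)   = Ins-All i a≤x a≤r ∷ Ins-Sorted i sr

moveLeft : (x y : Letter k) → x < y → All (y ≤_) r → Sorted r → y ∷ r ∷ʳ x ≡A y ∷ x ∷ r
moveLeft x y x<y []            _            = ≡A-refl
moveLeft {r = s ∷ r} x y x<y (y≤s ∷ _) (s≤r ∷ sr) =
  ≡A-trans (++ˡ [ y ] (moveLeft x s (ℕₚ.<-≤-trans x<y y≤s) s≤r sr)) (≡A-sym (yxz-≡A x y s r x<y y≤s))

-- The new letter travels left until it stands just behind the letter that it bumps; the latter then
-- travels left to the front. Every move is an elementary Knuth relation.
Ins-≡A : Ins x r r′ o → Sorted r → r ∷ʳ x ≡A toWord o ++ r′
Ins-≡A end _ = ≡A-refl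
Ins-≡A {x = x} (hit {a = a} x<a) (a≤r ∷ sr) = moveLeft x a x<a a≤r sr
Ins-≡A {o = nothing} (pass {a = a} _ i) (_ ∷ sr) = ++ˡ [ a ] (Ins-≡A i sr)
Ins-≡A {x = x} {o = just y} (pass {a = a} a≤x i) (a≤r ∷ sr) = ≡A-trans (++ˡ [ a ] (Ins-≡A i sr)) (go i a≤r)
  where
  go : Ins x r r′ (just y) → All (a ≤_) r → a ∷ y ∷ r′ ≡A y ∷ a ∷ r′
  go (hit {r = r} x<y)     _           = xzy-≡A a x y r a≤x x<y
  go (pass {a = b} {r′ = r′} b≤x i) (a≤b ∷ _) = xzy-≡A a b y r′ a≤b (ℕₚ.≤-<-trans b≤x (Ins-< i))

Proc-≡A : Proc r w r′ out → Sorted r → r ++ w ≡A out ++ r′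
Proc-≡A {r = r} [] _ = ≡⇒≡A (++-identityʳ r)
Proc-≡A {r = r} {r′ = s} (_∷_ {x = x} {r′ = r′} {o = o} {w = w} {out = out} i π) sr = begin
  r ++ x ∷ w                  ≡⟨ ++-assoc r [ x ] w ⟨
  (r ∷ʳ x) ++ w               ≈⟨ ++ʳ w (Ins-≡A i sr) ⟩
  (toWord o ++ r′) ++ w       ≡⟨ ++-assoc (toWord o) r′ w ⟩
  toWord o ++ (r′ ++ w)       ≈⟨ ++ˡ (toWord o) (Proc-≡A π (Ins-Sorted i sr)) ⟩
  toWord o ++ (out ++ s)      ≡⟨ ++-assoc (toWord o) out s ⟨
  (toWord o ++ out) ++ s      ∎
  where open ≡A-Reasoning

passProc : All (a ≤_) w → Proc r w r′ out → Proc (a ∷ r) w (a ∷ r′) out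
passProc []         []      = []
passProc (a≤x ∷ as) (i ∷ π) = pass a≤x i ∷ passProc as π

-- Rows may be empty, but only below all non-empty rows.

topRow : Filling k → Word k
topRow []      = []
topRow (r ∷ _) = r

Above : Word k → Word k → Set
Above upper lower = Prefix _>_ lower upper

data Tab {k} : Filling k → Set where
  []  : Tab []
  tab : Sorted r → Above r (topRow T) → Tab T → Tab (r ∷ T)

-- Each letter of the upper row passes its predecessors and bumps the letter below it, or is
-- appended if there is none; so the lower row leaves intact.
Proc-column : Sorted r → Above r t → Proc t r r t
Proc-column [] [] = []
Proc-column {t = []} (x≤r ∷ sr) [] = end ∷ passProc x≤r (Proc-column sr [])
Proc-column {t = y ∷ t} (x≤r ∷ sr) (x<y ∷ ab) = hit x<y ∷ passProc x≤r (Proc-column sr ab)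

above-≤ : Sorted r → Above r t → All (h ≤_) r → All (h ≤_) t
above-≤ _ [] _ = []
above-≤ {h = h} (_ ∷ sr) (x<y ∷ ab) (h≤x ∷ h≤r) =
  ℕₚ.≤-trans h≤x (ℕₚ.<⇒≤ x<y) ∷ above-≤ {h = h} sr ab h≤r

row-∷ : (r : Word k) (T : Filling k) → row (r ∷ T) ≡ row T ++ r
row-∷ r T = begin
  concat (reverse (r ∷ T))        ≡⟨ cong concat (unfold-reverse r T) ⟩
  concat (reverse T ∷ʳ r)         ≡⟨ concat-++ (reverse T) [ r ] ⟨
  concat (reverse T) ++ (r ++ []) ≡⟨ cong (row T ++_) (++-identityʳ r) ⟩
  row T ++ r                      ∎
  where open ≡-Reasoning

-- Being at most every letter of `t`, `h` stays at the front of its row while `t` expels `v`. In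
-- this way it passes one row at a time on its way to the front of the word.
row-∷-head : (h : Letter k) → All (h ≤_) t → Sorted t → Above t (topRow T) → Tab T →
             row T ++ h ∷ t ≡A h ∷ row T ++ t
row-∷-head h h≤t st ab [] = ≡A-refl
row-∷-head {t = t} {T = v ∷ T} h h≤t st ab (tab sv ab′ tT) = begin
  row (v ∷ T) ++ h ∷ t   ≡⟨ cong (_++ h ∷ t) (row-∷ v T) ⟩
  (row T ++ v) ++ h ∷ t  ≡⟨ ++-assoc (row T) v (h ∷ t) ⟩
  row T ++ v ++ h ∷ t    ≈⟨ ++ˡ (row T) (Proc-≡A (passProc h≤t (Proc-column st ab)) (h≤v ∷ sv)) ⟨
  row T ++ (h ∷ v) ++ t  ≡⟨ ++-assoc (row T) (h ∷ v) t ⟨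
  (row T ++ h ∷ v) ++ t  ≈⟨ ++ʳ t (row-∷-head h h≤v sv ab′ tT) ⟩
  h ∷ (row T ++ v) ++ t  ≡⟨ cong (λ w → h ∷ w ++ t) (row-∷ v T) ⟨
  h ∷ row (v ∷ T) ++ t   ∎
  where
  open ≡A-Reasoning
  h≤v : All (h ≤_) v
  h≤v = above-≤ {h = h} st ab h≤t

heads : Filling k → Word k
heads []            = []
heads ([] ∷ T)      = heads T
heads ((x ∷ _) ∷ T) = x ∷ heads T

tails : Filling k → Filling k
tails []            = []
tails ([] ∷ T)      = [] ∷ tails T
tails ((_ ∷ r) ∷ T) = r ∷ tails T

data NonEmpty {k} : Word k → Set where
  nonEmpty : NonEmpty (x ∷ r)

Ascending : Word k → Set
Ascending = AllPairs _<_

tab-tails : All NonEmpty T → Tab T → Tab (tails T)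
tab-tails [] [] = []
tab-tails (nonEmpty ∷ []) (tab (_ ∷ sr) _ []) = tab sr [] []
tab-tails (nonEmpty ∷ nT@(nonEmpty ∷ _)) (tab (_ ∷ sr) (_ ∷ ab) tT) = tab sr ab (tab-tails nT tT)

heads-Ascending : All NonEmpty T → Tab T → Ascending (heads T)
heads-Ascending [] [] = []
heads-Ascending {T = (x ∷ _) ∷ T} (nonEmpty ∷ nT) (tab _ ab tT) = below x nT ab tT ∷ heads-Ascending nT tT
  where
  below : ∀ {T r} (x : Letter k) → All NonEmpty T → Above (x ∷ r) (topRow T) → Tab T → All (x <_) (heads T)
  below x [] _ _ = []
  below x (nonEmpty {x = y} ∷ nT) (x<y ∷ _) (tab _ ab tT) = x<y ∷ All.map (ℕₚ.<-trans x<y) (below y nT ab tT)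

reverse-∷ : (h : Letter k) (hs : Word k) (w : Word k) → reverse (h ∷ hs) ++ w ≡ reverse hs ++ h ∷ w
reverse-∷ h hs w = trans (cong (_++ w) (unfold-reverse h hs)) (++-assoc (reverse hs) [ h ] w)

row-++ : (r : Word k) (T : Filling k) (w : Word k) → row (r ∷ T) ++ w ≡ row T ++ r ++ w
row-++ r T w = trans (cong (_++ w) (row-∷ r T)) (++-assoc (row T) r w)

row-extend : (ds : Word k) (U : Filling k) → All (h ≤_) t → Tab (t ∷ U) → w ≡A ds ++ row U →
             w ++ h ∷ t ≡A ds ++ h ∷ row (t ∷ U)
row-extend {h = h} {t = t} {w = w} ds U h≤t (tab st ab tU) w≡ = begin
  w ++ h ∷ t                ≈⟨ ++ʳ (h ∷ t) w≡ ⟩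
  (ds ++ row U) ++ h ∷ t    ≡⟨ ++-assoc ds (row U) (h ∷ t) ⟩
  ds ++ row U ++ h ∷ t      ≈⟨ ++ˡ ds (row-∷-head h h≤t st ab tU) ⟩
  ds ++ h ∷ row U ++ t      ≡⟨ cong (λ v → ds ++ h ∷ v) (row-∷ t U) ⟨
  ds ++ h ∷ row (t ∷ U)     ∎
  where open ≡A-Reasoning

-- The head of each row passes the tails of all rows below and then stands right behind the heads of
-- those rows.
row-heads-tails : All NonEmpty T → Tab T → row T ≡A reverse (heads T) ++ row (tails T)
row-heads-tails [] [] = ≡A-refl
row-heads-tails {T = (h ∷ t) ∷ T} nT₀@(nonEmpty ∷ nT) tT₀@(tab (h≤t ∷ _) _ tT) = begin
  row ((h ∷ t) ∷ T)                             ≡⟨ row-∷ (h ∷ t) T ⟩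
  row T ++ h ∷ t                                ≈⟨ row-extend (reverse (heads T)) (tails T) h≤t (tab-tails nT₀ tT₀) (row-heads-tails nT tT) ⟩
  reverse (heads T) ++ h ∷ row (t ∷ tails T)    ≡⟨ reverse-∷ h (heads T) (row (t ∷ tails T)) ⟨
  reverse (h ∷ heads T) ++ row (t ∷ tails T)    ∎
  where open ≡A-Reasoning

-- Schensted insertion

insA : Letter k → Filling k → Filling k
insA x []      = [ x ] ∷ []
insA x (r ∷ T) with bumped x r
... | nothing = newRow x r ∷ T
... | just y  = newRow x r ∷ insA y T

infixl 5 _◂_
_◂_ : Filling k → Word k → Filling k
T ◂ w = foldl (λ T x → insA x T) T w

P-A : Word k → Filling k
P-A w = [] ◂ w

◂-++ : (T : Filling k) (v w : Word k) → T ◂ (v ++ w) ≡ T ◂ v ◂ w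
◂-++ T v w = foldl-++ _ T v w

insA-Ins : Ins x r r′ o → insA x (r ∷ T) ≡ r′ ∷ (T ◂ toWord o)
insA-Ins {x = x} {r = r} i with refl , refl ← Ins⇒≡ i with bumped x r
... | nothing = refl
... | just _  = refl

◂-Proc : Proc r w r′ out → (r ∷ T) ◂ w ≡ r′ ∷ (T ◂ out)
◂-Proc [] = refl
◂-Proc {T = T} (_∷_ {o = o} {w = w} {out = out} i π) =
  trans (cong (_◂ w) (insA-Ins i)) (trans (◂-Proc π) (cong (_ ∷_) (sym (◂-++ T (toWord o) out))))

topRow-insA : (x : Letter k) (T : Filling k) → topRow (insA x T) ≡ newRow x (topRow T)
topRow-insA x []      = refl
topRow-insA x (r ∷ T) with bumped x r
... | nothing = refl
... | just _  = refl

above-Ins : Ins x r r′ o → Above r t → Above r′ t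
above-Ins end        []         = []
above-Ins (hit _)    []         = []
above-Ins {x = x} (hit x<a) (a<b ∷ ab) = ℕₚ.<-trans x<a a<b ∷ ab
above-Ins (pass _ _) []         = []
above-Ins (pass _ i) (a<b ∷ ab) = a<b ∷ above-Ins i ab

-- The entry below the old place of the bumped letter, if any, is larger than it. So it lands weakly
-- to the left, under a letter that is at most `x`.
above-Ins-bumped : Ins x r r′ (just y) → Above r t → Above r′ (newRow y t)
above-Ins-bumped (hit x<y)  [] = x<y ∷ []
above-Ins-bumped (pass a≤x i) [] = ℕₚ.≤-<-trans a≤x (Ins-< i) ∷ []
above-Ins-bumped {y = y} (hit x<y) (_∷_ {a = b} y<b ab) with y <? b
... | yes _ = x<y ∷ ab
... | no y≮b = contradiction y<b y≮b
above-Ins-bumped {y = y} (pass a≤x i) (_∷_ {a = b} a<b ab) with y <? b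
... | yes _ = ℕₚ.≤-<-trans a≤x (Ins-< i) ∷ above-Ins i ab
... | no _  = a<b ∷ above-Ins-bumped i ab

tab-insA : (x : Letter k) → Tab T → Tab (insA x T)
tab-insA x [] = tab ([] ∷ []) [] []
tab-insA x (tab {r = r} {T = T} sr ab tT) with bumped x r | ins x r
... | nothing | i = tab (Ins-Sorted i sr) (above-Ins i ab) tT
... | just y  | i = tab (Ins-Sorted i sr) (subst (Above (newRow x r)) (sym (topRow-insA y T)) (above-Ins-bumped i ab)) (tab-insA y tT)

Ins-NonEmpty : Ins x r r′ o → NonEmpty r′
Ins-NonEmpty end        = nonEmpty
Ins-NonEmpty (hit _)    = nonEmpty
Ins-NonEmpty (pass _ _) = nonEmpty

insA-NonEmpty : (x : Letter k) → All NonEmpty T → All NonEmpty (insA x T)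
insA-NonEmpty x [] = nonEmpty ∷ []
insA-NonEmpty x (_∷_ {x = r} _ nT) with bumped x r | ins x r
... | nothing | i = Ins-NonEmpty i ∷ nT
... | just y  | i = Ins-NonEmpty i ∷ insA-NonEmpty y nT

insA-≡A : (x : Letter k) → Tab T → row T ∷ʳ x ≡A row (insA x T)
insA-≡A x [] = ≡A-refl
insA-≡A x (tab {r = r} {T = T} sr ab tT) with bumped x r | ins x r
... | nothing | i = begin
  row (r ∷ T) ∷ʳ x  ≡⟨ row-++ r T [ x ] ⟩
  row T ++ r ∷ʳ x   ≈⟨ ++ˡ (row T) (Ins-≡A i sr) ⟩
  row T ++ newRow x r       ≡⟨ row-∷ (newRow x r) T ⟨
  row (newRow x r ∷ T)      ∎
  where open ≡A-Reasoning
... | just y  | i = begin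
  row (r ∷ T) ∷ʳ x        ≡⟨ row-++ r T [ x ] ⟩
  row T ++ r ∷ʳ x         ≈⟨ ++ˡ (row T) (Ins-≡A i sr) ⟩
  row T ++ y ∷ newRow x r         ≡⟨ ++-assoc (row T) [ y ] (newRow x r) ⟨
  (row T ∷ʳ y) ++ newRow x r      ≈⟨ ++ʳ (newRow x r) (insA-≡A y tT) ⟩
  row (insA y T) ++ newRow x r    ≡⟨ row-∷ (newRow x r) (insA y T) ⟨
  row (newRow x r ∷ insA y T)     ∎
  where open ≡A-Reasoning

◂-Tab : (w : Word k) → Tab T → Tab (T ◂ w)
◂-Tab []      tT = tT
◂-Tab (x ∷ w) tT = ◂-Tab w (tab-insA x tT)

◂-NonEmpty : (w : Word k) → All NonEmpty T → All NonEmpty (T ◂ w)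
◂-NonEmpty []      nT = nT
◂-NonEmpty (x ∷ w) nT = ◂-NonEmpty w (insA-NonEmpty x nT)

◂-≡A : (w : Word k) → Tab T → row T ++ w ≡A row (T ◂ w)
◂-≡A {T = T} []      tT = ≡⇒≡A (++-identityʳ (row T))
◂-≡A {T = T} (x ∷ w) tT = begin
  row T ++ x ∷ w          ≡⟨ ++-assoc (row T) [ x ] w ⟨
  (row T ∷ʳ x) ++ w       ≈⟨ ++ʳ w (insA-≡A x tT) ⟩
  row (insA x T) ++ w     ≈⟨ ◂-≡A w (tab-insA x tT) ⟩
  row (T ◂ (x ∷ w))       ∎
  where open ≡A-Reasoning

-- Invariance of Schensted insertion under Knuth moves

data _⇝₃_ {k} : Word k → Word k → Set where
  yxz : x < y → y ≤ z → (y ∷ x ∷ z ∷ []) ⇝₃ (y ∷ z ∷ x ∷ [])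
  xzy : x ≤ y → y < z → (x ∷ z ∷ y ∷ []) ⇝₃ (z ∷ x ∷ y ∷ [])

-- A single row turns a Knuth move of the entering letters into at most one move of the leaving
-- letters, possibly reversed: an `xzy` can come out as a backward `yxz`. Hence an induction over
-- the rows never meets longer rewritings.
data _⇝₀_ {k} : Word k → Word k → Set where
  same : w ⇝₀ w
  fwd₃ : v ⇝₃ w → v ⇝₀ w
  bwd₃ : v ⇝₃ w → w ⇝₀ v

record Parallel {k} (r v w : Word k) : Set where
  constructor parallel
  field
    {new out-v out-w} : Word k
    proc-v : Proc r v new out-v
    proc-w : Proc r w new out-w
    outs   : out-v ⇝₀ out-w

bumps-ascending : Sorted r → x ≤ y → Ins x r s (just a) → Ins y s t (just b) → a ≤ b
bumps-ascending (a≤r ∷ _) x≤y (hit x<a) (hit y<x) = contradiction x≤y (ℕₚ.<⇒≱ y<x)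
bumps-ascending (a≤r ∷ _) x≤y (hit _) (pass _ j) = Ins-All-bumped j a≤r
bumps-ascending _ x≤y (pass c≤x i) (hit y<c) = contradiction x≤y (ℕₚ.<⇒≱ (ℕₚ.<-≤-trans y<c c≤x))
bumps-ascending {x = x} {y = y} (_ ∷ sr) x≤y (pass _ i) (pass _ j) = bumps-ascending {x = x} {y = y} sr x≤y i j

bumps-ascending-nothing : x ≤ y → Ins x r s nothing → Ins y s t o → o ≡ nothing
bumps-ascending-nothing x≤y end (hit y<x) = contradiction x≤y (ℕₚ.<⇒≱ y<x)
bumps-ascending-nothing x≤y end (pass _ end) = refl
bumps-ascending-nothing x≤y (pass c≤x i) (hit y<c) = contradiction x≤y (ℕₚ.<⇒≱ (ℕₚ.<-≤-trans y<c c≤x))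
bumps-ascending-nothing {x = x} {y = y} x≤y (pass _ i) (pass _ j) = bumps-ascending-nothing {x = x} {y = y} x≤y i j

bumps-last : y < z → Ins z r s o → ∃[ a ] ∃[ t ] Ins y s t (just a) × a ≤ z
bumps-last y<z end     = _ , _ , hit y<z , ℕₚ.≤-refl
bumps-last y<z (hit _) = _ , _ , hit y<z , ℕₚ.≤-refl
bumps-last {y = y} {z = z} y<z (pass {a = c} c≤z i) with y <? c
... | yes y<c = c , _ , hit y<c , c≤z
... | no  y≮c = let a , t , j , a≤z = bumps-last {y = y} {z = z} y<z i in a , _ , pass (ℕₚ.≮⇒≥ y≮c) j , a≤z

pass-all : a ≤ x → a ≤ y → a ≤ z → Parallel r (x ∷ y ∷ z ∷ []) w → All (a ≤_) w → Parallel (a ∷ r) (x ∷ y ∷ z ∷ []) w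
pass-all a≤x a≤y a≤z (parallel π ρ outs) a≤w = parallel (passProc (a≤x ∷ a≤y ∷ a≤z ∷ []) π) (passProc a≤w ρ) outs

knuth-[] : v ⇝₃ w → ∃[ r ] ∃[ out ] Proc [] v r out × Proc [] w r out
knuth-[] (yxz x<y y≤z) = _ , _ ,
  end ∷ hit x<y ∷ pass (ℕₚ.<⇒≤ (ℕₚ.<-≤-trans x<y y≤z)) end ∷ [] , end ∷ pass y≤z end ∷ hit x<y ∷ []
knuth-[] (xzy x≤y y<z) = _ , _ ,
  end ∷ pass (ℕₚ.<⇒≤ (ℕₚ.≤-<-trans x≤y y<z)) end ∷ pass x≤y (hit y<z) ∷ [] ,
  end ∷ hit (ℕₚ.≤-<-trans x≤y y<z) ∷ pass x≤y end ∷ []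

knuth-row : Sorted r → v ⇝₃ w → Parallel r v w
knuth-row [] v⇝w = let _ , _ , π , ρ = knuth-[] v⇝w in parallel π ρ same
knuth-row {r = a ∷ r} (a≤r ∷ sr) (yxz {x = x} {y = y} {z = z} x<y y≤z) with x <? a
... | no x≮a = pass-all a≤y a≤x a≤z (knuth-row sr (yxz {x = x} {y = y} {z = z} x<y y≤z)) (a≤y ∷ a≤z ∷ a≤x ∷ [])
  where
  a≤x : a ≤ x
  a≤x = ℕₚ.≮⇒≥ x≮a
  a≤y : a ≤ y
  a≤y = ℕₚ.≤-trans a≤x (ℕₚ.<⇒≤ x<y)
  a≤z : a ≤ z
  a≤z = ℕₚ.≤-trans a≤y y≤z
... | yes x<a with y <? a
...   | yes y<a = parallel (hit y<a ∷ hit x<y ∷ pass x≤z (ins z r) ∷ []) (hit y<a ∷ pass y≤z (ins z r) ∷ hit x<y ∷ []) (go (ins z r))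
  where
  x≤z : x ≤ z
  x≤z = ℕₚ.<⇒≤ (ℕₚ.<-≤-trans x<y y≤z)
  go : Ins z r s o → (a ∷ y ∷ toWord o ++ []) ⇝₀ (a ∷ toWord o ++ y ∷ [])
  go {o = nothing} _ = same
  go {o = just c}  i = fwd₃ (yxz {x = y} {y = a} {z = c} y<a (Ins-All-bumped i a≤r))
...   | no y≮a = parallel (pass a≤y i ∷ hit x<a ∷ pass x≤z j ∷ []) (pass a≤y i ∷ pass (ℕₚ.≤-trans a≤y y≤z) j ∷ hit x<a ∷ []) (go i j)
  where
  x≤z : x ≤ z
  x≤z = ℕₚ.<⇒≤ (ℕₚ.<-≤-trans x<y y≤z)
  a≤y : a ≤ y
  a≤y = ℕₚ.≮⇒≥ y≮a
  i = ins y r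
  j = ins z (newRow y r)
  go : ∀ {s t o o′} → Ins y r s o → Ins z s t o′ → (toWord o ++ a ∷ toWord o′ ++ []) ⇝₀ (toWord o ++ toWord o′ ++ a ∷ [])
  go {o = nothing} i j with bumps-ascending-nothing {x = y} {y = z} y≤z i j
  ... | refl = same
  go {o = just p} {o′ = nothing} i j = same
  go {o = just p} {o′ = just q}  i j = fwd₃ (yxz {x = a} {y = p} {z = q} (ℕₚ.≤-<-trans a≤y (Ins-< i)) (bumps-ascending {x = y} {y = z} sr y≤z i j))
knuth-row {r = a ∷ r} (a≤r ∷ sr) (xzy {x = x} {y = y} {z = z} x≤y y<z) with x <? a
... | no x≮a = pass-all a≤x a≤z a≤y (knuth-row sr (xzy {x = x} {y = y} {z = z} x≤y y<z)) (a≤z ∷ a≤x ∷ a≤y ∷ [])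
  where
  a≤x : a ≤ x
  a≤x = ℕₚ.≮⇒≥ x≮a
  a≤y : a ≤ y
  a≤y = ℕₚ.≤-trans a≤x x≤y
  a≤z : a ≤ z
  a≤z = ℕₚ.≤-trans a≤y (ℕₚ.<⇒≤ y<z)
... | yes x<a with z <? a
...   | yes z<a = go a≤r
  where
  x<z : x < z
  x<z = ℕₚ.≤-<-trans x≤y y<z
  go : All (a ≤_) r → Parallel (a ∷ r) (x ∷ z ∷ y ∷ []) (z ∷ x ∷ y ∷ [])
  go [] = parallel (hit x<a ∷ pass (ℕₚ.<⇒≤ x<z) end ∷ pass x≤y (hit y<z) ∷ []) (hit z<a ∷ hit x<z ∷ pass x≤y end ∷ []) same
  go (_∷_ {x = b} a≤b _) = parallel (hit x<a ∷ pass (ℕₚ.<⇒≤ x<z) (hit z<b) ∷ pass x≤y (hit y<z) ∷ []) (hit z<a ∷ hit x<z ∷ pass x≤y (hit (ℕₚ.<-trans y<z z<b)) ∷ []) (bwd₃ (yxz {x = z} {y = a} {z = b} z<a a≤b))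
    where
    z<b : z < b
    z<b = ℕₚ.<-≤-trans z<a a≤b
...   | no z≮a = go (ins z r)
  where
  a≤z : a ≤ z
  a≤z = ℕₚ.≮⇒≥ z≮a
  x≤z : x ≤ z
  x≤z = ℕₚ.<⇒≤ (ℕₚ.≤-<-trans x≤y y<z)
  go : Ins z r s o → Parallel (a ∷ r) (x ∷ z ∷ y ∷ []) (z ∷ x ∷ y ∷ [])
  go {o = o} i with bumps-last {y = y} {z = z} y<z i
  ... | q , t , j , q≤z = parallel (hit x<a ∷ pass x≤z i ∷ pass x≤y j ∷ []) (pass a≤z i ∷ hit x<a ∷ pass x≤y j ∷ []) (outs o i)
    where
    outs : ∀ o → Ins z r _ o → (a ∷ toWord o ++ q ∷ []) ⇝₀ (toWord o ++ a ∷ q ∷ [])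
    outs nothing  _  = same
    outs (just p) i′ = fwd₃ (xzy {x = a} {y = q} {z = p} (Ins-All-bumped j (Ins-All i a≤z a≤r)) (ℕₚ.≤-<-trans q≤z (Ins-< i′)))

◂-[] : (x : Letter k) (w : Word k) → Proc [] (x ∷ w) r out → [] ◂ (x ∷ w) ≡ r ∷ ([] ◂ out)
◂-[] x w π = ◂-Proc π

◂-⇝₃ : Tab T → v ⇝₃ w → T ◂ v ≡ T ◂ w
◂-⇝₃ [] v⇝w@(yxz _ _) = let _ , _ , π , ρ = knuth-[] v⇝w in trans (◂-[] _ _ π) (sym (◂-[] _ _ ρ))
◂-⇝₃ [] v⇝w@(xzy _ _) = let _ , _ , π , ρ = knuth-[] v⇝w in trans (◂-[] _ _ π) (sym (◂-[] _ _ ρ))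
◂-⇝₃ (tab sr ab tT) v⇝w with knuth-row sr v⇝w
... | parallel π ρ same      = trans (◂-Proc π) (sym (◂-Proc ρ))
... | parallel π ρ (fwd₃ m)  = trans (◂-Proc π) (trans (cong (_ ∷_) (◂-⇝₃ tT m)) (sym (◂-Proc ρ)))
... | parallel π ρ (bwd₃ m)  = trans (◂-Proc π) (trans (cong (_ ∷_) (sym (◂-⇝₃ tT m))) (sym (◂-Proc ρ)))

P-A-⇝ : v ⇝ w → P-A v ≡ P-A w
P-A-⇝ {v = v} {w = w} v⇝w with v⇝w
... | yxz u t {x} {y} {z} x<y y≤z = trans (◂-++ [] u _) (trans (cong (_◂ t) (◂-⇝₃ (◂-Tab u []) (yxz {x = x} {y = y} {z = z} x<y y≤z))) (sym (◂-++ [] u _)))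
... | xzy u t {x} {y} {z} x≤y y<z = trans (◂-++ [] u _) (trans (cong (_◂ t) (◂-⇝₃ (◂-Tab u []) (xzy {x = x} {y = y} {z = z} x≤y y<z))) (sym (◂-++ [] u _)))

P-A-≡A : v ≡A w → P-A v ≡ P-A w
P-A-≡A = Eq.gfold Eqₚ.isEquivalence P-A P-A-⇝

◂-row : All NonEmpty T → Tab T → NonEmpty r → Sorted r → Above r (topRow T) → T ◂ r ≡ r ∷ T
◂-row [] [] nonEmpty sr ab = ◂-[] _ _ (Proc-column sr ab)
◂-row (nt ∷ nT) (tab st ab′ tT) nr sr ab = trans (◂-Proc (Proc-column sr ab)) (cong (_ ∷_) (◂-row nT tT nt st ab′))

P-A-row : All NonEmpty T → Tab T → P-A (row T) ≡ T
P-A-row [] [] = refl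
P-A-row {T = r ∷ T} (nr ∷ nT) (tab sr ab tT) = begin
  P-A (row (r ∷ T))   ≡⟨ cong P-A (row-∷ r T) ⟩
  P-A (row T ++ r)    ≡⟨ ◂-++ [] (row T) r ⟩
  P-A (row T) ◂ r     ≡⟨ cong (_◂ r) (P-A-row nT tT) ⟩
  T ◂ r               ≡⟨ ◂-row nT tT nr sr ab ⟩
  r ∷ T               ∎
  where open ≡-Reasoning

-- The means by which Schensted tableaux are identified from here on: it suffices to exhibit a
-- tableau whose row word is Knuth equivalent to the given word.
P-A-unique : All NonEmpty T → Tab T → w ≡A row T → P-A w ≡ T
P-A-unique nT tT w≡ = trans (P-A-≡A w≡) (P-A-row nT tT)

P-A-Tab : (w : Word k) → Tab (P-A w)
P-A-Tab w = ◂-Tab w []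

P-A-NonEmpty : (w : Word k) → All NonEmpty (P-A w)
P-A-NonEmpty w = ◂-NonEmpty w []

row-P-A : (w : Word k) → w ≡A row (P-A w)
row-P-A w = ◂-≡A w []

-- Columns and the gluing of a new first column

variable
  c d zs : Word k

column : Word k → Filling k
column = map [_]

row-column : (c : Word k) → row (column c) ≡ reverse c
row-column []      = refl
row-column (x ∷ c) = trans (row-∷ [ x ] (column c)) (trans (cong (_++ [ x ]) (row-column c)) (sym (unfold-reverse x c)))

heads-column : (c : Word k) → heads (column c) ≡ c
heads-column []      = refl
heads-column (x ∷ c) = cong (x ∷_) (heads-column c)

tab-column : Ascending c → Tab (column c)
tab-column []                   = []
tab-column ([] ∷ [])            = tab ([] ∷ []) [] []
tab-column ((x<y ∷ _) ∷ ac@(_ ∷ _)) = tab ([] ∷ []) (x<y ∷ []) (tab-column ac)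

column-NonEmpty : (c : Word k) → All NonEmpty (column c)
column-NonEmpty []      = []
column-NonEmpty (_ ∷ c) = nonEmpty ∷ column-NonEmpty c

-- The columns d and z can be the first two columns of a tableau.
Rect : Word k → Word k → Set
Rect d z = Prefix (λ b a → a ≤ b) z d

glue : Word k → Filling k → Filling k
glue []      T       = T
glue (x ∷ d) []      = [ x ] ∷ glue d []
glue (x ∷ d) (r ∷ T) = (x ∷ r) ∷ glue d T

below-head : All NonEmpty (r ∷ T) → Tab (r ∷ T) → Rect (x ∷ d) (heads (r ∷ T)) → All (x ≤_) r
below-head (nonEmpty {x = y} ∷ _) (tab (y≤r ∷ _) _ _) (x≤y ∷ _) = x≤y ∷ All.map (ℕₚ.≤-trans x≤y) y≤r

above-glue : All (x <_) d → Above r (topRow T) → All NonEmpty T → Rect d (heads T) → Above (x ∷ r) (topRow (glue d T))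
above-glue []        _  []             _ = []
above-glue []        _  (nonEmpty ∷ _) ()
above-glue (x<y ∷ _) _  []             _ = x<y ∷ []
above-glue (x<y ∷ _) ab (_ ∷ _)        _ = x<y ∷ ab

tab-glue : Ascending d → All NonEmpty T → Tab T → Rect d (heads T) → Tab (glue d T)
tab-glue {T = []}    []          nT tT rect = []
tab-glue {T = r ∷ T} []          (nonEmpty ∷ nT) tT ()
tab-glue {T = []}    (x<d ∷ ad)  nT tT rect = tab ([] ∷ []) (above-glue x<d [] [] []) (tab-glue ad [] [] [])
tab-glue {T = r ∷ T} (x<d ∷ ad)  nT@(nonEmpty ∷ nT′) tT@(tab sr ab tT′) rect@(_ ∷ rect′) =
  tab (below-head nT tT rect ∷ sr) (above-glue x<d ab nT′ rect′) (tab-glue ad nT′ tT′ rect′)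

glue-NonEmpty : All NonEmpty T → All NonEmpty (glue d T)
glue-NonEmpty {d = []}    nT       = nT
glue-NonEmpty {d = x ∷ d} []       = nonEmpty ∷ glue-NonEmpty {d = d} []
glue-NonEmpty {d = x ∷ d} (_ ∷ nT) = nonEmpty ∷ glue-NonEmpty nT

heads-glue : All NonEmpty T → Rect d (heads T) → heads (glue d T) ≡ d
heads-glue {d = []}    []              _         = refl
heads-glue {d = []}    (nonEmpty ∷ _)  ()
heads-glue {d = x ∷ d} []              _         = cong (x ∷_) (heads-glue {d = d} [] [])
heads-glue {d = x ∷ d} (nonEmpty ∷ nT) (_ ∷ rect) = cong (x ∷_) (heads-glue nT rect)

-- The comparison is between row words because `tails` leaves an empty row for every entry of `d`
-- that has no row of `T` beside it.
row-tails-glue : All NonEmpty T → Rect d (heads T) → row (tails (glue d T)) ≡ row T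
row-tails-glue {d = []}    []              _         = refl
row-tails-glue {d = []}    (nonEmpty ∷ _)  ()
row-tails-glue {d = x ∷ d} []              _         =
  trans (row-∷ [] (tails (glue d []))) (trans (++-identityʳ _) (row-tails-glue {d = d} [] []))
row-tails-glue {T = r ∷ T} {d = x ∷ d} (nonEmpty ∷ nT) (_ ∷ rect) =
  trans (row-∷ r (tails (glue d T))) (trans (cong (_++ r) (row-tails-glue nT rect)) (sym (row-∷ r T)))

row-glue : Ascending d → All NonEmpty T → Tab T → Rect d (heads T) → row (glue d T) ≡A reverse d ++ row T
row-glue {d = d} {T = T} ad nT tT rect = begin
  row (glue d T)                                         ≈⟨ row-heads-tails (glue-NonEmpty nT) (tab-glue ad nT tT rect) ⟩
  reverse (heads (glue d T)) ++ row (tails (glue d T))   ≡⟨ cong₂ (λ u v → reverse u ++ v) (heads-glue nT rect) (row-tails-glue nT rect) ⟩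
  reverse d ++ row T                                     ∎
  where open ≡A-Reasoning

-- Sliding a letter into the neighbouring column

record Pushes {k} (x : Letter k) (T : Filling k) : Set where
  field
    heads-push : heads (insA x T) ≡ x ∷ heads T
    tails-push : row (tails (insA x T)) ≡ row (tails T)

-- Smaller than the whole first column, `x` bumps the first entry of every row in turn: the first
-- column moves down by one row and the other columns stay in place.
push : All NonEmpty T → Tab T → All (x <_) (heads T) → Pushes x T
push [] [] [] = record { heads-push = refl ; tails-push = refl }
push {T = (h ∷ t) ∷ T} {x = x} (nonEmpty ∷ nT) tT₀@(tab _ _ tT) (x<h ∷ _) with heads-Ascending (nonEmpty ∷ nT) tT₀
... | h<T ∷ _ = record
  { heads-push = trans (cong heads eq) (cong (x ∷_) (Pushes.heads-push rest))
  ; tails-push = trans (cong (λ S → row (tails S)) eq) (trans (row-∷ t (tails (insA h T))) (trans (cong (_++ t) (Pushes.tails-push rest)) (sym (row-∷ t (tails T)))))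
  }
  where
  rest : Pushes h T
  rest = push nT tT h<T
  eq : insA x ((h ∷ t) ∷ T) ≡ (x ∷ t) ∷ insA h T
  eq = insA-Ins (hit x<h)

-- The raising operator of the crystal on pairs of columns: with the letters of d as opening and those of z
-- as closing brackets, a is the largest unmatched letter of z, and it moves to d.
data Step {k} : (d z d⁺ z⁻ : Word k) → Letter k → Set where
  skip  : ∀ {d z d⁺ z⁻ a x} → All (x <_) d → Step d z d⁺ z⁻ a → Step d (x ∷ z) d⁺ (x ∷ z⁻) a
  take  : ∀ {d z a} → All (a <_) d → Rect d z → Step d (a ∷ z) (a ∷ d) z a
  match : ∀ {d z d⁺ z⁻ a x y} → x ≤ y → Step d z d⁺ z⁻ a → Step (x ∷ d) (y ∷ z) (x ∷ d⁺) (y ∷ z⁻) a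

-- Both columns are scanned from the top. A letter of `zs` that is too small for the current letter
-- of `d` stays unmatched, and the search goes on below it with the same `d`; if everything below
-- fits, this is the letter that moves.
rect-or-step : Ascending d → Ascending zs → Rect d zs ⊎ (∃[ d⁺ ] ∃[ z⁻ ] ∃[ a ] Step d zs d⁺ z⁻ a)
rect-or-step _ [] = inj₁ []
rect-or-step {zs = z ∷ zs} [] (_ ∷ az) with rect-or-step [] az
... | inj₁ rect = inj₂ (_ , _ , _ , take [] rect)
... | inj₂ (_ , _ , _ , s) = inj₂ (_ , _ , _ , skip [] s)
rect-or-step {d = x ∷ d} {zs = z ∷ zs} ad@(x<d ∷ ad′) (_ ∷ az) with z <? x
... | no z≮x with rect-or-step ad′ az
...   | inj₁ rect = inj₁ (ℕₚ.≮⇒≥ z≮x ∷ rect)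
...   | inj₂ (_ , _ , _ , s) = inj₂ (_ , _ , _ , match (ℕₚ.≮⇒≥ z≮x) s)
rect-or-step {d = x ∷ d} {zs = z ∷ zs} ad@(x<d ∷ ad′) (_ ∷ az) | yes z<x with rect-or-step ad az
...   | inj₁ rect = inj₂ (_ , _ , _ , take (z<x ∷ All.map (ℕₚ.<-trans z<x) x<d) rect)
...   | inj₂ (_ , _ , _ , s) = inj₂ (_ , _ , _ , skip (z<x ∷ All.map (ℕₚ.<-trans z<x) x<d) s)

module _ {k : ℕ} where
  private variable
    d′ z′ d⁺ z⁻ : Word k
    α : Letter k

  Step-letter : {P : Letter k → Set} → Step d′ z′ d⁺ z⁻ α → All P z′ → P α
  Step-letter (skip _ s)  (_ ∷ pz) = Step-letter s pz
  Step-letter (take _ _)  (pa ∷ _) = pa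
  Step-letter (match _ s) (_ ∷ pz) = Step-letter s pz

  Step-All⁺ : {P : Letter k → Set} → Step d′ z′ d⁺ z⁻ α → P α → All P d′ → All P d⁺
  Step-All⁺ (skip _ s)  pa pd        = Step-All⁺ s pa pd
  Step-All⁺ (take _ _)  pa pd        = pa ∷ pd
  Step-All⁺ (match _ s) pa (px ∷ pd) = px ∷ Step-All⁺ s pa pd

  Step-All⁻ : {P : Letter k → Set} → Step d′ z′ d⁺ z⁻ α → All P z′ → All P z⁻
  Step-All⁻ (skip _ s)  (px ∷ pz) = px ∷ Step-All⁻ s pz
  Step-All⁻ (take _ _)  (_ ∷ pz)  = pz
  Step-All⁻ (match _ s) (px ∷ pz) = px ∷ Step-All⁻ s pz

  Step-Ascending⁺ : Step d′ z′ d⁺ z⁻ α → Ascending d′ → Ascending z′ → Ascending d⁺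
  Step-Ascending⁺ (skip _ s)    ad (_ ∷ az)           = Step-Ascending⁺ s ad az
  Step-Ascending⁺ (take a<d _)  ad _                  = a<d ∷ ad
  Step-Ascending⁺ (match x≤y s) (x<d ∷ ad) (y<z ∷ az) =
    Step-All⁺ s (ℕₚ.≤-<-trans x≤y (Step-letter s y<z)) x<d ∷ Step-Ascending⁺ s ad az

  Step-Ascending⁻ : Step d′ z′ d⁺ z⁻ α → Ascending z′ → Ascending z⁻
  Step-Ascending⁻ (skip _ s)  (x<z ∷ az) = Step-All⁻ s x<z ∷ Step-Ascending⁻ s az
  Step-Ascending⁻ (take _ _)  (_ ∷ az)   = az
  Step-Ascending⁻ (match _ s) (x<z ∷ az) = Step-All⁻ s x<z ∷ Step-Ascending⁻ s az

  Step-length⁺ : Step d′ z′ d⁺ z⁻ α → length d⁺ ≡ suc (length d′)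
  Step-length⁺ (skip _ s)  = Step-length⁺ s
  Step-length⁺ (take _ _)  = refl
  Step-length⁺ (match _ s) = cong suc (Step-length⁺ s)

  Step-length⁻ : Step d′ z′ d⁺ z⁻ α → suc (length z⁻) ≡ length z′
  Step-length⁻ (skip _ s)  = cong suc (Step-length⁻ s)
  Step-length⁻ (take _ _)  = refl
  Step-length⁻ (match _ s) = cong suc (Step-length⁻ s)

  slip : (h y : Letter k) (c : Word k) → h ≤ y → All (y <_) c → Ascending c →
         reverse c ++ h ∷ y ∷ [] ≡A h ∷ reverse c ++ y ∷ []
  slip h y c h≤y y<c ac = subst (λ w → w ++ h ∷ y ∷ [] ≡A h ∷ w ++ y ∷ []) (row-column c)
    (row-∷-head h (h≤y ∷ []) ([] ∷ []) (above y<c) (tab-column ac))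
    where
    above : ∀ {c} → All (y <_) c → Above [ y ] (topRow (column c))
    above []        = []
    above (y<x ∷ _) = y<x ∷ []

  -- In the case `take`, `a` is inserted into the tableau with columns `d` and `z` and pushes the
  -- first column down. In the case `match`, `slip` carries the smaller letter past `z`, so that the
  -- matched pair stands at the end of the word and can be split off.
  Step-≡A : Step d′ z′ d⁺ z⁻ α → Ascending d′ → Ascending z′ → reverse d′ ++ reverse z′ ≡A reverse d⁺ ++ reverse z⁻
  Step-≡A {d′ = d} {d⁺ = d⁺} (skip {z = z} {z⁻ = z⁻} {x = x} _ s) ad (_ ∷ az) = begin
    reverse d ++ reverse (x ∷ z)        ≡⟨ cong (reverse d ++_) (unfold-reverse x z) ⟩
    reverse d ++ reverse z ∷ʳ x         ≡⟨ ++-assoc (reverse d) (reverse z) [ x ] ⟨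
    (reverse d ++ reverse z) ∷ʳ x       ≈⟨ ++ʳ [ x ] (Step-≡A s ad az) ⟩
    (reverse d⁺ ++ reverse z⁻) ∷ʳ x     ≡⟨ ++-assoc (reverse d⁺) (reverse z⁻) [ x ] ⟩
    reverse d⁺ ++ reverse z⁻ ∷ʳ x       ≡⟨ cong (reverse d⁺ ++_) (unfold-reverse x z⁻) ⟨
    reverse d⁺ ++ reverse (x ∷ z⁻)      ∎
    where open ≡A-Reasoning
  Step-≡A (take {d = d} {z = z} {a = a} a<d rect) ad (_ ∷ az) = begin
    reverse d ++ reverse (a ∷ z)                        ≡⟨ cong (reverse d ++_) (trans (unfold-reverse a z) (cong (_∷ʳ a) (sym (row-column z)))) ⟩
    reverse d ++ row (column z) ∷ʳ a                    ≡⟨ ++-assoc (reverse d) (row (column z)) [ a ] ⟨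
    (reverse d ++ row (column z)) ∷ʳ a                  ≈⟨ ++ʳ [ a ] (row-glue ad (column-NonEmpty z) (tab-column az) rect′) ⟨
    row G ∷ʳ a                                          ≈⟨ insA-≡A a tG ⟩
    row (insA a G)                                      ≈⟨ row-heads-tails (insA-NonEmpty a nG) (tab-insA a tG) ⟩
    reverse (heads (insA a G)) ++ row (tails (insA a G)) ≡⟨ cong₂ (λ u v → reverse u ++ v) heads≡ tails≡ ⟩
    reverse (a ∷ d) ++ reverse z                        ∎
    where
    open ≡A-Reasoning
    G = glue d (column z)
    rect′ : Rect d (heads (column z))
    rect′ = subst (Rect d) (sym (heads-column z)) rect
    nG : All NonEmpty G
    nG = glue-NonEmpty (column-NonEmpty z)
    tG : Tab G
    tG = tab-glue ad (column-NonEmpty z) (tab-column az) rect′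
    hG : heads G ≡ d
    hG = heads-glue (column-NonEmpty z) rect′
    pushed : Pushes a G
    pushed = push nG tG (subst (All (a <_)) (sym hG) a<d)
    heads≡ : heads (insA a G) ≡ a ∷ d
    heads≡ = trans (Pushes.heads-push pushed) (cong (a ∷_) hG)
    tails≡ : row (tails (insA a G)) ≡ reverse z
    tails≡ = trans (Pushes.tails-push pushed) (trans (row-tails-glue (column-NonEmpty z) rect′) (row-column z))
  Step-≡A (match {d = d} {z = z} {d⁺ = d⁺} {z⁻ = z⁻} {x = x} {y = y} x≤y s) (_ ∷ ad) (y<z ∷ az) = begin
    reverse (x ∷ d) ++ reverse (y ∷ z)            ≈⟨ expand d z y<z az ⟩
    (reverse d ++ reverse z) ++ x ∷ y ∷ []        ≈⟨ ++ʳ (x ∷ y ∷ []) (Step-≡A s ad az) ⟩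
    (reverse d⁺ ++ reverse z⁻) ++ x ∷ y ∷ []      ≈⟨ expand d⁺ z⁻ (Step-All⁻ s y<z) (Step-Ascending⁻ s az) ⟨
    reverse (x ∷ d⁺) ++ reverse (y ∷ z⁻)          ∎
    where
    open ≡A-Reasoning
    expand : ∀ d z → All (y <_) z → Ascending z → reverse (x ∷ d) ++ reverse (y ∷ z) ≡A (reverse d ++ reverse z) ++ x ∷ y ∷ []
    expand d z y<z az = begin
      reverse (x ∷ d) ++ reverse (y ∷ z)          ≡⟨ reverse-∷ x d (reverse (y ∷ z)) ⟩
      reverse d ++ x ∷ reverse (y ∷ z)            ≡⟨ cong (λ w → reverse d ++ x ∷ w) (unfold-reverse y z) ⟩
      reverse d ++ x ∷ reverse z ++ y ∷ []        ≈⟨ ++ˡ (reverse d) (slip x y z x≤y y<z az) ⟨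
      reverse d ++ reverse z ++ x ∷ y ∷ []        ≡⟨ ++-assoc (reverse d) (reverse z) (x ∷ y ∷ []) ⟨
      (reverse d ++ reverse z) ++ x ∷ y ∷ []      ∎

-- Berele insertion in relational form

rank-injective : rank x ≡ rank y → x ≡ y
rank-injective {x = plain i} {y = plain j} e = cong plain (Finₚ.toℕ-injective (ℕₚ.*-cancelˡ-≡ _ _ 2 e))
rank-injective {x = plain i} {y = bar j}   e = contradiction e (ℕₚ.even≢odd (toℕ i) (toℕ j))
rank-injective {x = bar i}   {y = plain j} e = contradiction (sym e) (ℕₚ.even≢odd (toℕ j) (toℕ i))
rank-injective {x = bar i}   {y = bar j}   e = cong bar (Finₚ.toℕ-injective (ℕₚ.*-cancelˡ-≡ _ _ 2 (ℕₚ.suc-injective e)))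

-- The King bound with the top row counted as row `n`, as needed when a letter has been bumped into
-- lower rows.
data Bounded {k} : ℕ → Filling k → Set where
  []  : ∀ {n} → Bounded n []
  _∷_ : ∀ {n} → All (λ x → 2 * n ℕ.≤ rank x) r → Bounded (suc n) T → Bounded n (r ∷ T)

record King {k} (n : ℕ) (T : Filling k) : Set where
  constructor king
  field
    filled  : All NonEmpty T
    tableau : Tab T
    bounded : Bounded n T

break-at : {P : Pred (Letter k) 0ℓ} (P? : Decidable P) → All (λ x → ¬ P x) p → P y → break P? (p ++ y ∷ s) ≡ (p , y ∷ s)
break-at {y = y} P? [] py with P? y
... | yes _  = refl
... | no ¬py = contradiction py ¬py
break-at {s = s} P? (_∷_ {x = x} ¬px ¬p) py with P? x
... | yes px = contradiction px ¬px
... | no _  = cong (λ (u , v) → x ∷ u , v) (break-at {s = s} P? ¬p py)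

break-none : {P : Pred (Letter k) 0ℓ} (P? : Decidable P) → All (λ x → ¬ P x) p → break P? p ≡ (p , [])
break-none P? [] = refl
break-none P? (_∷_ {x = x} ¬px ¬p) with P? x
... | yes px = contradiction px ¬px
... | no _  = cong (λ (u , v) → x ∷ u , v) (break-none P? ¬p)

insertMaybe : ℕ → Maybe (Letter k) → Filling k → Filling k
insertMaybe n nothing  T = T
insertMaybe n (just y) T = insertAt n y T

Ins-nothing : Ins x r r′ nothing → r′ ≡ r ∷ʳ x × All (λ y → ¬ x < y) r
Ins-nothing end = refl , []
Ins-nothing (pass a≤x i) = let e , l = Ins-nothing i in cong (_ ∷_) e , ℕₚ.≤⇒≯ a≤x ∷ l

Ins-just : Ins x r r′ (just y) → ∃[ p ] ∃[ s ] r ≡ p ++ y ∷ s × r′ ≡ p ++ x ∷ s × All (λ y → ¬ x < y) p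
Ins-just (hit _) = [] , _ , refl , refl , []
Ins-just (pass a≤x i) = let p , s , e , f , l = Ins-just i in _ ∷ p , s , cong (_ ∷_) e , cong (_ ∷_) f , ℕₚ.≤⇒≯ a≤x ∷ l

insertAt-append : ∀ n → ¬ Exceptional n x r → All (λ y → ¬ x < y) r → insertAt n x (r ∷ T) ≡ (r ∷ʳ x) ∷ T
insertAt-append {x = x} {r = r} n ¬exc l with exceptional? n x r
... | yes exc = contradiction exc ¬exc
... | no _ with break (x <?_) r | break-none (x <?_) l
...   | _ | refl = refl

insertAt-bump : ∀ n → ¬ Exceptional n x (p ++ y ∷ s) → All (λ y → ¬ x < y) p → x < y →
                insertAt n x ((p ++ y ∷ s) ∷ T) ≡ (p ++ x ∷ s) ∷ insertAt (suc n) y T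
insertAt-bump {x = x} {p = p} {y = y} {s = s} n ¬exc l x<y with exceptional? n x (p ++ y ∷ s)
... | yes exc = contradiction exc ¬exc
... | no _ with break (x <?_) (p ++ y ∷ s) | break-at {y = y} {s = s} (x <?_) l x<y
...   | _ | refl = refl

insertAt-ordinary : ∀ n → ¬ Exceptional n x r → Ins x r r′ o → insertAt n x (r ∷ T) ≡ r′ ∷ insertMaybe (suc n) o T
insertAt-ordinary {o = nothing} n ¬exc i with refl , l ← Ins-nothing i = insertAt-append n ¬exc l
insertAt-ordinary {o = just y}  n ¬exc i with p , s , refl , refl , l ← Ins-just i = insertAt-bump n ¬exc l (Ins-< i)

-- In row i of a King tableau only copies of plain i precede the first bar i. Therefore the
-- exceptional rule first produces the same row as Schensted insertion, discards the bumped bar i,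
-- and empties the very first box of the row.
record Cancels {k} (i : Fin k) (r : Word k) : Set where
  field
    rest     : Word k
    inserted : Ins (plain i) r (plain i ∷ rest) (just (bar i))
    before after : Word k
    split    : r ≡ before ++ bar i ∷ after
    first    : All (λ x → ¬ x ≡ bar i) before
    split′   : plain i ∷ rest ≡ before ++ plain i ∷ after

cancels : {i : Fin k} → Sorted r → All (λ x → 2 * toℕ i ℕ.≤ rank x) r → bar i ∈ r → Cancels i r
cancels {r = a ∷ r} {i = i} _ _ _ with a ≟ bar i
cancels {r = a ∷ r} {i = i} _ _ _ | yes refl = record
  { rest = r ; inserted = hit ℕₚ.≤-refl ; before = [] ; after = r ; split = refl ; first = [] ; split′ = refl }
cancels {r = a ∷ r} (_ ∷ _) _ (here eq) | no a≢ = contradiction (sym eq) a≢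
cancels {r = a ∷ r} {i = i} (a≤r ∷ sr) (i≤a ∷ i≤r) (there m) | no a≢ = record
  { rest = plain i ∷ rest
  ; inserted = subst (λ a → Ins (plain i) (a ∷ r) (plain i ∷ plain i ∷ rest) _) (sym a≡) (pass ℕₚ.≤-refl inserted)
  ; before = plain i ∷ before ; after = after
  ; split = cong₂ _∷_ a≡ split ; first = (λ ()) ∷ first ; split′ = cong (plain i ∷_) split′ }
  where
  open Cancels (cancels sr i≤r m)
  a<bar : a < bar i
  a<bar = ℕₚ.≤∧≢⇒< (All.lookup a≤r m) (λ e → a≢ (rank-injective e))
  a≡ : a ≡ plain i
  a≡ = rank-injective (ℕₚ.≤-antisym (ℕₚ.<⇒≤pred a<bar) i≤a)

cancel-at : (i : Fin k) (p s rest : Word k) (T : Filling k) → All (λ x → ¬ x ≡ bar i) p → plain i ∷ rest ≡ p ++ plain i ∷ s →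
            cancel i (p ++ bar i ∷ s) T ≡ slide [] rest T
cancel-at i p s rest T ¬bar eq with break (_≟ bar i) (p ++ bar i ∷ s) | break-at {s = s} (_≟ bar i) ¬bar refl
... | _ | refl with p ++ plain i ∷ s | eq
...   | _ | refl with break (_≟ plain i) (plain i ∷ rest) | break-at {p = []} {s = rest} (_≟ plain i) [] refl
...     | _ | refl = refl

insertAt-exceptional : {i : Fin k} {T : Filling k} → bar i ∈ r → (c : Cancels i r) →
                       insertAt (toℕ i) (plain i) (r ∷ T) ≡ slide [] (Cancels.rest c) T
insertAt-exceptional {r = r} {i = i} {T = T} m record { rest = rest ; before = p ; after = s ; split = refl ; first = ¬bar ; split′ = eq }
  with exceptional? (toℕ i) (plain i) r
... | no ¬exc = contradiction (i , refl , refl , m) ¬exc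
... | yes (j , refl , _) = cancel-at i p s rest T ¬bar eq

-- Jeu de taquin

data _≤ʰ_ {k} (b : Letter k) : Word k → Set where
  []  : b ≤ʰ []
  [_]ʰ : ∀ {r s} → b ≤ r → b ≤ʰ (r ∷ s)

data Gapless {k} (p : Word k) : Filling k → Set where
  bottom : Gapless p []
  short  : ∀ {t rs} → length t ℕ.≤ length p → Gapless p (t ∷ rs)

data Blocked {k} (p : Word k) (r : Letter k) : Filling k → Set where
  short  : ∀ {rs} → Gapless p rs → Blocked p r rs
  larger : ∀ {q b s rs} → length q ≡ length p → r < b → Blocked p r ((q ++ b ∷ s) ∷ rs)

-- The graph of `slide` without its calls of `splitAt`, so that proofs can follow the path of the
-- empty box by induction.
data Slide {k} : Word k → Word k → Filling k → Filling k → Set where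
  done  : ∀ {p rs} → Gapless p rs → Slide p [] rs (finish p rs)
  right : ∀ {p r s rs W} → Blocked p r rs → Slide (p ∷ʳ r) s rs W → Slide p (r ∷ s) rs W
  up    : ∀ {p s q b s′ rs W} → length q ≡ length p → b ≤ʰ s → Slide q s′ rs W →
          Slide p s ((q ++ b ∷ s′) ∷ rs) ((p ++ b ∷ s) ∷ W)

splitAt-[] : (n : ℕ) (t q : Word k) → splitAt n t ≡ (q , []) → length t ℕ.≤ n
splitAt-[] zero    []      q e = z≤n
splitAt-[] (suc n) []      q e = z≤n
splitAt-[] (suc n) (x ∷ t) q e with splitAt n t in eq
splitAt-[] (suc n) (x ∷ t) q refl | q′ , [] = s≤s (splitAt-[] n t q′ eq)

splitAt-∷ : (n : ℕ) (t q : Word k) → splitAt n t ≡ (q , b ∷ s) → t ≡ q ++ b ∷ s × length q ≡ n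
splitAt-∷ zero    t       q refl = refl , refl
splitAt-∷ (suc n) []      q ()
splitAt-∷ (suc n) (x ∷ t) q e with splitAt n t in eq
splitAt-∷ (suc n) (x ∷ t) q refl | q′ , b ∷ s = let e , l = splitAt-∷ n t q′ eq in cong (x ∷_) e , cong suc l

slide-Slide     : (p s : Word k) (rs : Filling k) → Slide p s rs (slide p s rs)
slideOver-Slide : (p s t : Word k) (rs : Filling k) → Slide p s (t ∷ rs) (slideOver p s t rs)

slide-Slide p s       (t ∷ rs) = slideOver-Slide p s t rs
slide-Slide p []      []       = done bottom
slide-Slide p (r ∷ s) []       = right (short bottom) (slide-Slide (p ∷ʳ r) s [])

slideOver-Slide p [] t rs with splitAt (length p) t in eq
... | q , [] = done (short (splitAt-[] (length p) t q eq))
... | q , b ∷ s′ with refl , l ← splitAt-∷ (length p) t q eq = up l [] (slide-Slide q s′ rs)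
slideOver-Slide p (r ∷ s) t rs with splitAt (length p) t in eq
... | q , [] = right (short (short (splitAt-[] (length p) t q eq))) (slideOver-Slide (p ∷ʳ r) s t rs)
... | q , b ∷ s′ with b ≤? r
...   | yes b≤r with refl , l ← splitAt-∷ (length p) t q eq = up l [ b≤r ]ʰ (slide-Slide q s′ rs)
...   | no  b≰r with refl , l ← splitAt-∷ (length p) t q eq = right (larger l (ℕₚ.≰⇒> b≰r)) (slideOver-Slide (p ∷ʳ r) s _ rs)

variable
  e f : Letter k
  s′ : Word k
  W rs : Filling k

sorted-fill : (p : Word k) → Sorted (p ++ e ∷ s) → e ≤ f → All (f ≤_) s → Sorted (p ++ f ∷ s)
sorted-fill []      (_ ∷ ss) e≤f f≤s = f≤s ∷ ss
sorted-fill {e = e} {s = s} {f = f} (x ∷ p) (x≤ ∷ ss) e≤f f≤s = go p x≤ ∷ sorted-fill {e = e} p ss e≤f f≤s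
  where
  go : ∀ p → All (x ≤_) (p ++ e ∷ s) → All (x ≤_) (p ++ f ∷ s)
  go []      (x≤e ∷ l) = ℕₚ.≤-trans x≤e e≤f ∷ l
  go (y ∷ p) (x≤y ∷ l) = x≤y ∷ go p l

all-fill : {P : Letter k → Set} (p : Word k) → P f → All P (p ++ e ∷ s) → All P (p ++ f ∷ s)
all-fill []      pf (_ ∷ l)  = pf ∷ l
all-fill (x ∷ p) pf (px ∷ l) = px ∷ all-fill p pf l

all-close : {P : Letter k → Set} (p : Word k) → All P (p ++ e ∷ s) → All P (p ++ s)
all-close []      (_ ∷ l)  = l
all-close (x ∷ p) (px ∷ l) = px ∷ all-close p l

sorted-close : (p : Word k) → Sorted (p ++ e ∷ s) → Sorted (p ++ s)
sorted-close []      (_ ∷ ss)  = ss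
sorted-close (x ∷ p) (x≤ ∷ ss) = all-close p x≤ ∷ sorted-close p ss

sorted-right : (p : Word k) → Sorted (p ++ s) → Sorted s
sorted-right []      ss       = ss
sorted-right (x ∷ p) (_ ∷ ss) = sorted-right p ss

sorted-left : (p : Word k) → Sorted (p ++ s) → Sorted p
sorted-left []      ss       = []
sorted-left (x ∷ p) (x≤ ∷ ss) = Allₚ.++⁻ˡ p x≤ ∷ sorted-left p ss

≤ʰ⇒≤ : b ≤ʰ s → Sorted s → All (b ≤_) s
≤ʰ⇒≤ [] _ = []
≤ʰ⇒≤ [ b≤r ]ʰ (r≤s ∷ _) = b≤r ∷ All.map (ℕₚ.≤-trans b≤r) r≤s

above-short : (p : Word k) {t : Word k} → length t ℕ.≤ length p → Above (p ++ s) t → Above p t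
above-short p       {[]}    l       ab         = []
above-short (x ∷ p) {y ∷ t} (s≤s l) (x<y ∷ ab) = x<y ∷ above-short p l ab

record AboveSplit {k} (p : Word k) (e : Letter k) (s q : Word k) (b : Letter k) (s′ : Word k) : Set where
  constructor aboveSplit
  field
    left-of  : Pointwise _<_ p q
    at       : e < b
    right-of : Above s s′

above-split : (p q : Word k) → length q ≡ length p → Above (p ++ e ∷ s) (q ++ b ∷ s′) → AboveSplit p e s q b s′
above-split []      []      _ (e<b ∷ ab) = aboveSplit [] e<b ab
above-split (x ∷ p) (y ∷ q) l (x<y ∷ ab) =
  let aboveSplit lt e<b ab′ = above-split p q (ℕₚ.suc-injective l) ab in aboveSplit (x<y ∷ lt) e<b ab′

above-join : Pointwise _<_ p q → e < b → Above s s′ → Above (p ++ e ∷ s) (q ++ b ∷ s′)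
above-join []         e<b ab = e<b ∷ ab
above-join (x<y ∷ lt) e<b ab = x<y ∷ above-join lt e<b ab

-- The rows u above and p ++ e ∷ s below, of which e is about to be replaced by the
-- next entry of s or by an entry from the row below e.
data OverHole {k} : (u p : Word k) → Letter k → Word k → Set where
  hole : ∀ {u e s f} → f ≤ e → All (f <_) s → Above u s → OverHole (f ∷ u) [] e s
  _∷_  : ∀ {u p e s f x} → f < x → OverHole u p e s → OverHole (f ∷ u) (x ∷ p) e s

overHole-right : All (f ≤_) s → OverHole u p e (f ∷ s) → OverHole u (p ∷ʳ f) f s
overHole-right f≤s (hole _ (g<f ∷ _) (h<f ∷ ab)) = g<f ∷ hole (ℕₚ.<⇒≤ h<f) (All.map (ℕₚ.<-≤-trans h<f) f≤s) ab
overHole-right f≤s (g<x ∷ o) = g<x ∷ overHole-right f≤s o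

overHole-up : Pointwise _<_ p q → All (b <_) s′ → Above s s′ → OverHole (p ++ b ∷ s) q b s′
overHole-up []         b<s ab = hole ℕₚ.≤-refl b<s ab
overHole-up (x<y ∷ lt) b<s ab = x<y ∷ overHole-up lt b<s ab

below-< : All (b ≤_) s → Above s s′ → Sorted s′ → All (b <_) s′
below-< _          []         _          = []
below-< (b≤x ∷ _) (x<y ∷ _)  (y≤s ∷ _)  = ℕₚ.≤-<-trans b≤x x<y ∷ All.map (ℕₚ.<-≤-trans (ℕₚ.≤-<-trans b≤x x<y)) y≤s

overHole-above : OverHole u p e [] → Above u p
overHole-above (hole _ _ _) = []
overHole-above (f<x ∷ o)    = f<x ∷ overHole-above o

overHole-fill : OverHole u p e s → e < b → Above u (p ++ b ∷ s)
overHole-fill (hole f≤e _ ab) e<b = ℕₚ.≤-<-trans f≤e e<b ∷ ab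
overHole-fill (f<x ∷ o)       e<b = f<x ∷ overHole-fill o e<b

-- The empty box is imagined to hold a letter `e` that completes the filling to a tableau. After
-- each step the role of `e` passes to the letter that has just moved, so the hypothesis of the
-- induction is again a `Tab`; `above` restores the relation to the row that the box has left.
record Slid {k} (p : Word k) (e : Letter k) (s : Word k) (rs W : Filling k) : Set where
  field
    tableau : Tab W
    word    : row W ≡A row rs ++ p ++ s
    above   : ∀ {u} → OverHole u p e s → Above u (topRow W)
    filled  : All NonEmpty W
    bounded : ∀ {n} → Bounded n ((p ++ e ∷ s) ∷ rs) → Bounded n W

Proc-left : Sorted p → Pointwise _<_ p q → Proc (q ++ w) p (p ++ w) q
Proc-left []          []         = []
Proc-left (x≤p ∷ sp) (x<y ∷ lt) = hit x<y ∷ passProc x≤p (Proc-left sp lt)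

-- Both sides meet in `q ++ p ++ s′ ++ b ∷ s`: inserting `p` into the lower row expels `q`, and
-- inserting `s` into `b ∷ s′` expels `s′` while `b` stays.
up-≡A : Sorted (q ++ b ∷ s′) → Sorted p → Sorted s → Pointwise _<_ p q → Above s s′ → All (b ≤_) s →
        (q ++ s′) ++ p ++ b ∷ s ≡A (q ++ b ∷ s′) ++ p ++ s
up-≡A {q = q} {b = b} {s′ = s′} {p = p} {s = s} sq sp ss lt ab b≤s = begin
  (q ++ s′) ++ p ++ b ∷ s      ≡⟨ ++-assoc (q ++ s′) p (b ∷ s) ⟨
  ((q ++ s′) ++ p) ++ b ∷ s    ≈⟨ ++ʳ (b ∷ s) (Proc-≡A (Proc-left {w = s′} sp lt) (sorted-close q sq)) ⟩
  (q ++ p ++ s′) ++ b ∷ s      ≡⟨ trans (++-assoc q (p ++ s′) (b ∷ s)) (cong (q ++_) (++-assoc p s′ (b ∷ s))) ⟩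
  q ++ p ++ s′ ++ b ∷ s        ≈⟨ ++ˡ q (++ˡ p (Proc-≡A (passProc b≤s (Proc-column ss ab)) (sorted-right q sq))) ⟨
  q ++ p ++ (b ∷ s′) ++ s      ≡⟨ trans (++-assoc q (p ++ b ∷ s′) s) (cong (q ++_) (++-assoc p (b ∷ s′) s)) ⟨
  (q ++ p ++ b ∷ s′) ++ s      ≈⟨ ++ʳ s (Proc-≡A (Proc-left {w = b ∷ s′} sp lt) sq) ⟨
  ((q ++ b ∷ s′) ++ p) ++ s    ≡⟨ ++-assoc (q ++ b ∷ s′) p s ⟩
  (q ++ b ∷ s′) ++ p ++ s      ∎
  where open ≡A-Reasoning

++-NonEmpty : (p : Word k) → NonEmpty (p ++ b ∷ s)
++-NonEmpty []      = nonEmpty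
++-NonEmpty (_ ∷ _) = nonEmpty

above-blocked : (p : Word k) → Blocked p f rs → Above (p ++ e ∷ f ∷ s) (topRow rs) → Above (p ++ f ∷ f ∷ s) (topRow rs)
above-blocked p (short bottom)    ab = []
above-blocked p (short (short l)) ab = above-short p l ab ++ᵖ _
above-blocked p (larger {q = q} l f<b) ab = let aboveSplit lt _ ab′ = above-split p q l ab in above-join lt f<b ab′

slid : Slide p s rs W → Tab ((p ++ e ∷ s) ∷ rs) → All NonEmpty rs → Slid p e s rs W
slid {p = []} (done bottom) _ _ = record
  { tableau = [] ; word = ≡A-refl ; above = λ _ → [] ; filled = [] ; bounded = λ _ → [] }
slid {p = []} (done (short {t = []} _)) _ (() ∷ _)
slid {p = []} (done (short {t = _ ∷ _} ())) _ _
slid {p = p@(x ∷ p′)} {rs = rs} (done g) (tab sp ab tT) nT = record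
  { tableau = tab (sorted-left p sp) (above g ab) tT
  ; word    = ≡⇒≡A (trans (row-∷ p rs) (cong (row rs ++_) (sym (++-identityʳ p))))
  ; above   = overHole-above
  ; filled  = nonEmpty ∷ nT
  ; bounded = λ { (l ∷ bd) → Allₚ.++⁻ˡ p l ∷ bd } }
  where
  above : ∀ {rs} → Gapless p rs → Above (p ++ s) (topRow rs) → Above p (topRow rs)
  above bottom    ab = []
  above (short l) ab = above-short p l ab
slid {p = p} {s = f ∷ s} {rs = rs} {W = W} {e = e} (right bl sl) (tab sp ab tT) nT = record
  { tableau = R.tableau
  ; word    = subst (λ w → row W ≡A row rs ++ w) (++-assoc p [ f ] s) R.word
  ; above   = λ o → R.above (overHole-right f≤s o)
  ; filled  = R.filled
  ; bounded = λ { (l ∷ bd) → R.bounded (subst (All _) eq (all-fill p (All.head (Allₚ.++⁻ʳ (p ∷ʳ e) (subst (All _) (sym (++-assoc p [ e ] (f ∷ s))) l))) l) ∷ bd) } }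
  where
  f≤s : All (f ≤_) s
  f≤s with _ ∷ (f≤s ∷ _) ← sorted-right p sp = f≤s
  e≤f : e ≤ f
  e≤f with (e≤f ∷ _) ∷ _ ← sorted-right p sp = e≤f
  eq : p ++ f ∷ f ∷ s ≡ (p ∷ʳ f) ++ f ∷ s
  eq = sym (++-assoc p [ f ] (f ∷ s))
  IH : Slid (p ∷ʳ f) f s rs W
  IH = slid sl (tab (subst Sorted eq (sorted-fill p sp e≤f (ℕₚ.≤-refl ∷ f≤s))) (subst (λ u → Above u (topRow rs)) eq (above-blocked p bl ab)) tT) nT
  module R = Slid IH
slid {p = p} {s = s} {e = e} (up {q = q} {b = b} {s′ = s′} {rs = rs} {W = W} l b≤ʰs sl) (tab sp ab tT@(tab sq _ _)) (_ ∷ nT) = record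
  { tableau = tab (sorted-fill p sp (ℕₚ.<⇒≤ e<b) b≤s) (R.above (overHole-up lt (below-< {b = b} b≤s ab′ (sorted-right [ b ] (sorted-right q sq))) ab′)) R.tableau
  ; word    = word
  ; above   = λ o → overHole-fill o e<b
  ; filled  = ++-NonEmpty p ∷ R.filled
  ; bounded = λ { (l ∷ l′ ∷ bd) → all-fill p (ℕₚ.≤-trans (All.head (Allₚ.++⁻ʳ p l)) (ℕₚ.<⇒≤ e<b)) l ∷ R.bounded (l′ ∷ bd) } }
  where
  split : AboveSplit p e s q b s′
  split = above-split p q l ab
  open AboveSplit split renaming (left-of to lt; at to e<b; right-of to ab′)
  ss : Sorted s
  ss = sorted-right [ e ] (sorted-right p sp)
  b≤s : All (b ≤_) s
  b≤s = ≤ʰ⇒≤ b≤ʰs ss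
  module R = Slid (slid sl tT nT)
  open ≡A-Reasoning
  word : row ((p ++ b ∷ s) ∷ W) ≡A row ((q ++ b ∷ s′) ∷ rs) ++ p ++ s
  word = begin
    row ((p ++ b ∷ s) ∷ W)                   ≡⟨ row-∷ (p ++ b ∷ s) W ⟩
    row W ++ p ++ b ∷ s                      ≈⟨ ++ʳ (p ++ b ∷ s) R.word ⟩
    (row rs ++ q ++ s′) ++ p ++ b ∷ s        ≡⟨ ++-assoc (row rs) (q ++ s′) (p ++ b ∷ s) ⟩
    row rs ++ (q ++ s′) ++ p ++ b ∷ s        ≈⟨ ++ˡ (row rs) (up-≡A sq (sorted-left p sp) ss lt ab′ b≤s) ⟩
    row rs ++ (q ++ b ∷ s′) ++ p ++ s        ≡⟨ row-++ (q ++ b ∷ s′) rs (p ++ s) ⟨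
    row ((q ++ b ∷ s′) ∷ rs) ++ p ++ s       ∎

-- The first column after an exceptional insertion

record Exception {k} (n : ℕ) (x : Letter k) (T : Filling k) : Set where
  field
    upper lower : Word k
    letter      : Fin k
    heads-split : heads (insA x T) ≡ upper ++ plain letter ∷ bar letter ∷ lower
    index       : n + length upper ≡ toℕ letter
    upper-King  : Bounded n (column upper)
    lower-King  : Bounded (suc (toℕ letter)) (column lower)
    word        : row (insertAt n x T) ≡A reverse (upper ++ lower) ++ row (tails (insA x T))
    result      : King n (insertAt n x T)
    above       : ∀ {u} → Above u (topRow (insA x T)) → Above u (topRow (insertAt n x T))

data Outcome {k} (n : ℕ) (x : Letter k) (T : Filling k) : Set where
  ordinary    : insertAt n x T ≡ insA x T → Bounded n (insA x T) → Outcome n x T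
  exceptional : Exception n x T → Outcome n x T

bounded-heads : ∀ {n} → All NonEmpty T → Bounded n T → Bounded n (column (heads T))
bounded-heads [] [] = []
bounded-heads (nonEmpty ∷ nT) ((n≤x ∷ _) ∷ bT) = (n≤x ∷ []) ∷ bounded-heads nT bT

2*suc : ∀ n → 2 * suc n ≡ suc (suc (2 * n))
2*suc n = ℕₚ.*-suc 2 n

heads-> : ∀ {n} → All NonEmpty T → Bounded n T → Tab T → rank x ℕ.< 2 * n → All (x <_) (heads T)
heads-> [] _ _ _ = []
heads-> {x = x} (nonEmpty ∷ nT) ((n≤h ∷ _) ∷ _) tT x<n with heads-Ascending (nonEmpty ∷ nT) tT
... | h<T ∷ _ = ℕₚ.<-≤-trans x<n n≤h ∷ All.map (ℕₚ.<-trans (ℕₚ.<-≤-trans x<n n≤h)) h<T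

bar-< : (i : Fin k) → rank (bar i) ℕ.< 2 * suc (toℕ i)
bar-< i = ℕₚ.≤-reflexive (sym (2*suc (toℕ i)))

-- All entries below row i exceed bar i, so the bar i bumped by Schensted insertion merely pushes
-- the first column down and ends up directly under plain i. Berele insertion drops this bar i and
-- empties the box of plain i, hence both vanish from the first column.
exceptional-row : {i : Fin k} → Tab (r ∷ T) → All NonEmpty T → Bounded (toℕ i) (r ∷ T) → bar i ∈ r →
                  Exception (toℕ i) (plain i) (r ∷ T)
exceptional-row {r = r} {T = T} {i = i} (tab sr ab tT) nT (br ∷ bT) m = record
  { upper = [] ; lower = heads T ; letter = i
  ; heads-split = trans (cong heads insA≡) (cong (plain i ∷_) (Pushes.heads-push pushed))
  ; index = ℕₚ.+-identityʳ _
  ; upper-King = []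
  ; lower-King = bounded-heads nT bT
  ; word = word
  ; result = subst (King (toℕ i)) (sym result≡) (king R.filled R.tableau (R.bounded ((ℕₚ.≤-refl ∷ Allₚ.++⁻ʳ [ plain i ] (Ins-All inserted ℕₚ.≤-refl br)) ∷ bT)))
  ; above = λ {u} ab → subst (λ W → Above u (topRow W)) (sym result≡) (R.above (over (subst (λ W → Above u (topRow W)) insA≡ ab)))
  }
  where
  canc : Cancels i r
  canc = cancels sr br m
  open Cancels canc using (rest; inserted)
  result≡ : insertAt (toℕ i) (plain i) (r ∷ T) ≡ slide [] rest T
  result≡ = insertAt-exceptional m canc
  insA≡ : insA (plain i) (r ∷ T) ≡ (plain i ∷ rest) ∷ insA (bar i) T
  insA≡ = insA-Ins inserted
  ordered : Sorted (plain i ∷ rest)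
  ordered = Ins-Sorted inserted sr
  pushed : Pushes (bar i) T
  pushed = push nT tT (heads-> {x = bar i} nT bT tT (bar-< i))
  module R = Slid (slid (slide-Slide [] rest T) (tab ordered (above-Ins inserted ab) tT) nT)
  over : ∀ {u} → Above u (plain i ∷ rest) → OverHole u [] (plain i) rest
  over (g<i ∷ ab) with i≤rest ∷ _ ← ordered = hole (ℕₚ.<⇒≤ g<i) (All.map (ℕₚ.<-≤-trans g<i) i≤rest) ab
  open ≡A-Reasoning
  word : row (insertAt (toℕ i) (plain i) (r ∷ T)) ≡A reverse (heads T) ++ row (tails (insA (plain i) (r ∷ T)))
  word = begin
    row (insertAt (toℕ i) (plain i) (r ∷ T))              ≡⟨ cong row result≡ ⟩
    row (slide [] rest T)                                 ≈⟨ R.word ⟩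
    row T ++ rest                                         ≈⟨ ++ʳ rest (row-heads-tails nT tT) ⟩
    (reverse (heads T) ++ row (tails T)) ++ rest          ≡⟨ ++-assoc (reverse (heads T)) (row (tails T)) rest ⟩
    reverse (heads T) ++ row (tails T) ++ rest            ≡⟨ cong (λ w → reverse (heads T) ++ w ++ rest) (Pushes.tails-push pushed) ⟨
    reverse (heads T) ++ row (tails (insA (bar i) T)) ++ rest ≡⟨ cong (reverse (heads T) ++_) (row-∷ rest (tails (insA (bar i) T))) ⟨
    reverse (heads T) ++ row (rest ∷ tails (insA (bar i) T)) ≡⟨ cong (λ S → reverse (heads T) ++ row (tails S)) insA≡ ⟨
    reverse (heads T) ++ row (tails (insA (plain i) (r ∷ T))) ∎

exception-below : ∀ {n} → Tab (r ∷ T) → All NonEmpty T → Ins x r (h ∷ t) (just y) → Bounded n ((h ∷ t) ∷ []) →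
                  insertAt n x (r ∷ T) ≡ (h ∷ t) ∷ insertAt (suc n) y T → Exception (suc n) y T → Exception n x (r ∷ T)
exception-below {r = r} {T = T} {x = x} {h = h} {t = t} {y = y} {n = n} tr@(tab sr ab tT) nT i ((n≤h ∷ n≤t) ∷ []) result≡ exc = record
  { upper = h ∷ X.upper ; lower = X.lower ; letter = X.letter
  ; heads-split = trans (cong heads insA≡) (cong (h ∷_) X.heads-split)
  ; index = trans (ℕₚ.+-suc n _) X.index
  ; upper-King = (n≤h ∷ []) ∷ X.upper-King
  ; lower-King = X.lower-King
  ; word = word
  ; result = subst (King n) (sym result≡) (king (nonEmpty ∷ King.filled X.result)
      (tab sht (X.above (tab-above tS)) (King.tableau X.result)) ((n≤h ∷ n≤t) ∷ King.bounded X.result))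
  ; above = λ {u} ab → subst (λ W → Above u (topRow W)) (sym result≡) (subst (λ W → Above u (topRow W)) insA≡ ab)
  }
  where
  module X = Exception exc
  S : Filling _
  S = insA y T
  insA≡ : insA x (r ∷ T) ≡ (h ∷ t) ∷ S
  insA≡ = insA-Ins i
  tS : Tab ((h ∷ t) ∷ S)
  tS = subst Tab insA≡ (tab-insA x tr)
  nS : All NonEmpty S
  nS = insA-NonEmpty y nT
  sht : Sorted (h ∷ t)
  sht = Ins-Sorted i sr
  tab-above : ∀ {r S} → Tab {_} (r ∷ S) → Above r (topRow S)
  tab-above (tab _ ab _) = ab
  open ≡A-Reasoning
  word : row (insertAt n x (r ∷ T)) ≡A reverse (h ∷ X.upper ++ X.lower) ++ row (tails (insA x (r ∷ T)))
  word = begin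
    row (insertAt n x (r ∷ T))                                     ≡⟨ cong row result≡ ⟩
    row ((h ∷ t) ∷ insertAt (suc n) y T)                           ≡⟨ row-∷ (h ∷ t) (insertAt (suc n) y T) ⟩
    row (insertAt (suc n) y T) ++ h ∷ t                            ≈⟨ row-extend (reverse (X.upper ++ X.lower)) (tails S) (AllPairs-head sht) (tab-tails (nonEmpty ∷ nS) tS) X.word ⟩
    reverse (X.upper ++ X.lower) ++ h ∷ row (t ∷ tails S)          ≡⟨ reverse-∷ h (X.upper ++ X.lower) (row (t ∷ tails S)) ⟨
    reverse (h ∷ X.upper ++ X.lower) ++ row (t ∷ tails S)          ≡⟨ cong (λ U → reverse (h ∷ X.upper ++ X.lower) ++ row (tails U)) insA≡ ⟨
    reverse (h ∷ X.upper ++ X.lower) ++ row (tails (insA x (r ∷ T))) ∎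
    where
    AllPairs-head : ∀ {h t} → Sorted {_} (h ∷ t) → All (h ≤_) t
    AllPairs-head (h≤t ∷ _) = h≤t

-- There are only two letters with ranks from 2n to 2n + 1. If the bumped letter is too small for
-- the next row, it is therefore the barred one and was bumped by the plain one: the exceptional
-- rule intervenes just where Schensted insertion would break the King condition.
bumped-bound : ∀ {n} → ¬ Exceptional n x r → All (λ a → 2 * n ℕ.≤ rank a) r → 2 * n ℕ.≤ rank x → Sorted r →
               Ins x r r′ (just y) → 2 * suc n ℕ.≤ rank y
bumped-bound {x = x} {r = r} {y = y} {n = n} ¬exc br n≤x sr i with 2 * suc n ℕ.≤? rank y
... | yes l = l
... | no ¬l = contradiction exc ¬exc
  where
  n≤x<y<n+1 : suc (rank y) ℕ.≤ suc (suc (2 * n))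
  n≤x<y<n+1 = subst (suc (rank y) ℕ.≤_) (2*suc n) (ℕₚ.≰⇒> ¬l)
  y≡ : rank y ≡ suc (2 * n)
  y≡ = ℕₚ.≤-antisym (ℕₚ.≤-pred n≤x<y<n+1) (ℕₚ.≤-<-trans n≤x (Ins-< i))
  x≡ : rank x ≡ 2 * n
  x≡ = ℕₚ.≤-antisym (ℕₚ.≤-pred (subst (rank x ℕ.<_) y≡ (Ins-< i))) n≤x
  letters : ∀ x y → rank x ≡ 2 * n → rank y ≡ suc (2 * n) → ∃[ j ] x ≡ plain j × toℕ j ≡ n × y ≡ bar j
  letters (bar j)   y         ex ey = contradiction (sym ex) (ℕₚ.even≢odd n (toℕ j))
  letters (plain j) (plain l) ex ey = contradiction ey (ℕₚ.even≢odd (toℕ l) n)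
  letters (plain j) (bar l)   ex ey = j , refl , ℕₚ.*-cancelˡ-≡ _ _ 2 ex , rank-injective (trans ey (cong suc (sym ex)))
  member : Ins x r r′ (just y) → y ∈ r
  member i with p , s , refl , _ ← Ins-just i = ∈-++⁺ʳ p (here refl)
  exc : Exceptional n x r
  exc with j , refl , j≡n , refl ← letters x y x≡ y≡ = j , refl , j≡n , member i

outcome : ∀ n → King n T → 2 * n ℕ.≤ rank x → Outcome n x T
outcome n (king [] [] []) n≤x = ordinary refl ((n≤x ∷ []) ∷ [])
outcome {T = r ∷ T} {x = x} n (king (_ ∷ nT) tT₀@(tab sr ab tT) bT₀@(br ∷ bT)) n≤x with exceptional? n x r
... | yes (i , refl , refl , m) = exceptional (exceptional-row tT₀ nT bT₀ m)
... | no ¬exc = go (ins x r)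
  where
  go : ∀ {r′ o} → Ins x r r′ o → Outcome n x (r ∷ T)
  go {o = nothing} i = ordinary (trans (insertAt-ordinary n ¬exc i) (sym (insA-Ins i))) (subst (Bounded n) (sym (insA-Ins i)) (Ins-All i n≤x br ∷ bT))
  go {r′ = r′} {o = just y} i with outcome (suc n) (king nT tT bT) (bumped-bound {x = x} {y = y} ¬exc br n≤x sr i)
  ... | ordinary e bd = ordinary (trans (insertAt-ordinary n ¬exc i) (trans (cong (r′ ∷_) e) (sym (insA-Ins i))))
                                 (subst (Bounded n) (sym (insA-Ins i)) (Ins-All i n≤x br ∷ bd))
  ... | exceptional exc with Ins-NonEmpty i
  ...   | nonEmpty = exceptional (exception-below tT₀ nT i (Ins-All i n≤x br ∷ []) (insertAt-ordinary n ¬exc i) exc)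

-- Counting functions and the path of a pair of columns

open LatticePath using (Path; path; Shift; Erase; cross; _⊑_; ⊑-refl; ⊑-trans; 2*; 2+2*; side; before; after; -1ℤ; H₁; H₂; value₁; value₂; reaches)

-- The indicators of r < t and of r = t
bit tick : ℕ → ℕ → ℕ
bit r       zero    = 0
bit zero    (suc t) = 1
bit (suc r) (suc t) = bit r t
tick zero    zero    = 1
tick zero    (suc t) = 0
tick (suc r) zero    = 0
tick (suc r) (suc t) = tick r t

bit-< : ∀ {r t} → r ℕ.< t → bit r t ≡ 1
bit-< {zero}  (s≤s _) = refl
bit-< {suc r} (s≤s l) = bit-< l

bit-≥ : ∀ {r t} → t ℕ.≤ r → bit r t ≡ 0
bit-≥ z≤n     = refl
bit-≥ (s≤s l) = bit-≥ l

bit-≤1 : ∀ r t → bit r t ℕ.≤ 1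
bit-≤1 r       zero    = z≤n
bit-≤1 zero    (suc t) = ℕₚ.≤-refl
bit-≤1 (suc r) (suc t) = bit-≤1 r t

bit-antitone : ∀ {r s} t → r ℕ.≤ s → bit s t ℕ.≤ bit r t
bit-antitone zero    _       = z≤n
bit-antitone {s = s} (suc t) z≤n = bit-≤1 s (suc t)
bit-antitone (suc t) (s≤s l) = bit-antitone t l

bit-suc : ∀ r t → bit r (suc t) ≡ bit r t + tick r t
bit-suc zero    zero    = refl
bit-suc zero    (suc t) = refl
bit-suc (suc r) zero    = refl
bit-suc (suc r) (suc t) = bit-suc r t

tick-refl : ∀ r → tick r r ≡ 1
tick-refl zero    = refl
tick-refl (suc r) = tick-refl r

tick-≢ : ∀ {r t} → ¬ r ≡ t → tick r t ≡ 0
tick-≢ {zero}  {zero}  ne = contradiction refl ne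
tick-≢ {zero}  {suc t} ne = refl
tick-≢ {suc r} {zero}  ne = refl
tick-≢ {suc r} {suc t} ne = tick-≢ (λ e → ne (cong suc e))

cnt occ : Word k → ℕ → ℕ
cnt []      t = 0
cnt (x ∷ c) t = bit (rank x) t + cnt c t
occ []      t = 0
occ (x ∷ c) t = tick (rank x) t + occ c t

cnt-suc : (c : Word k) (t : ℕ) → cnt c (suc t) ≡ cnt c t + occ c t
cnt-suc []      t = refl
cnt-suc (x ∷ c) t = trans (cong₂ _+_ (bit-suc (rank x) t) (cnt-suc c t)) (eq (bit (rank x) t) (tick (rank x) t) (cnt c t) (occ c t))
  where
  eq : ∀ a b c d → a + b + (c + d) ≡ a + c + (b + d)
  eq = solveℕ

cnt-++ : (u v : Word k) (t : ℕ) → cnt (u ++ v) t ≡ cnt u t + cnt v t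
cnt-++ []      v t = refl
cnt-++ (x ∷ u) v t = trans (cong₂ _+_ refl (cnt-++ u v t)) (sym (ℕₚ.+-assoc (bit (rank x) t) _ _))

occ-++ : (u v : Word k) (t : ℕ) → occ (u ++ v) t ≡ occ u t + occ v t
occ-++ []      v t = refl
occ-++ (x ∷ u) v t = trans (cong₂ _+_ refl (occ-++ u v t)) (sym (ℕₚ.+-assoc (tick (rank x) t) _ _))

cnt-0 : (c : Word k) → cnt c 0 ≡ 0
cnt-0 []      = refl
cnt-0 (x ∷ c) = cnt-0 c

cnt-none : ∀ {t} {c : Word k} → All (λ x → t ℕ.≤ rank x) c → cnt c t ≡ 0
cnt-none []      = refl
cnt-none (l ∷ ls) = cong₂ _+_ (bit-≥ l) (cnt-none ls)

cnt-all : ∀ {t} {c : Word k} → All (λ x → rank x ℕ.< t) c → cnt c t ≡ length c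
cnt-all []      = refl
cnt-all (l ∷ ls) = cong₂ _+_ (bit-< l) (cnt-all ls)

cnt-≤ : (c : Word k) (t : ℕ) → cnt c t ℕ.≤ length c
cnt-≤ []      t = z≤n
cnt-≤ (x ∷ c) t = ℕₚ.+-mono-≤ (bit-≤1 (rank x) t) (cnt-≤ c t)

cnt-mono : (c : Word k) (t : ℕ) → cnt c t ℕ.≤ cnt c (suc t)
cnt-mono c t = subst (cnt c t ℕ.≤_) (sym (cnt-suc c t)) (ℕₚ.m≤m+n (cnt c t) _)

occ-none : ∀ {t} {c : Word k} → All (λ x → ¬ rank x ≡ t) c → occ c t ≡ 0
occ-none []       = refl
occ-none (l ∷ ls) = cong₂ _+_ (tick-≢ l) (occ-none ls)

occ-≤1 : {c : Word k} → Ascending c → ∀ t → occ c t ℕ.≤ 1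
occ-≤1 [] t = z≤n
occ-≤1 (_∷_ {x = x} x<c ac) t with rank x ℕ.≟ t
... | yes refl = ℕₚ.≤-reflexive (cong₂ _+_ (tick-refl (rank x)) (occ-none (All.map (λ l e → ℕₚ.<⇒≢ l (sym e)) x<c)))
... | no ne = ℕₚ.≤-trans (ℕₚ.≤-reflexive (cong (_+ _) (tick-≢ ne))) (occ-≤1 ac t)

cnt-step : {c : Word k} → Ascending c → ∀ t → cnt c (suc t) ℕ.≤ suc (cnt c t)
cnt-step {c = c} ac t = begin
  cnt c (suc t)      ≡⟨ cnt-suc c t ⟩
  cnt c t + occ c t  ≤⟨ ℕₚ.+-monoʳ-≤ (cnt c t) (occ-≤1 ac t) ⟩
  cnt c t + 1        ≡⟨ ℕₚ.+-comm (cnt c t) 1 ⟩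
  suc (cnt c t)      ∎
  where open ℕₚ.≤-Reasoning

cnt-bounded : ∀ {n} {c : Word k} → Bounded n (column c) → ∀ j → cnt c (2 * j) ℕ.≤ j ∸ n
cnt-bounded {c = []} _ j = z≤n
cnt-bounded {n = n} {c = x ∷ c} ((n≤x ∷ []) ∷ bc) j with side n j
... | before j≤n = begin
  bit (rank x) (2 * j) + cnt c (2 * j)  ≡⟨ cong (_+ cnt c (2 * j)) (bit-≥ (ℕₚ.≤-trans (2* j≤n) n≤x)) ⟩
  cnt c (2 * j)                         ≤⟨ cnt-bounded bc j ⟩
  j ∸ suc n                             ≤⟨ ℕₚ.∸-monoʳ-≤ j (ℕₚ.n≤1+n n) ⟩
  j ∸ n                                 ∎
  where open ℕₚ.≤-Reasoning
... | after n<j = begin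
  bit (rank x) (2 * j) + cnt c (2 * j)  ≤⟨ ℕₚ.+-mono-≤ (bit-≤1 (rank x) (2 * j)) (cnt-bounded bc j) ⟩
  suc (j ∸ suc n)                       ≡⟨ ℕₚ.+-∸-assoc 1 n<j ⟨
  j ∸ n                                 ∎
  where open ℕₚ.≤-Reasoning

rect-cnt : Rect d zs → ∀ t → cnt zs t ℕ.≤ cnt d t
rect-cnt []           t = z≤n
rect-cnt (x≤y ∷ rect) t = ℕₚ.+-mono-≤ (bit-antitone t x≤y) (rect-cnt rect t)

-- F ≥ 0 says that c and z are adjacent columns of a tableau, and G ≥ 0 that c is a King column.
pathOf : Word k → Word k → Path
pathOf c z = path (λ t → + cnt c t ℤ.- + cnt z t) (λ j → + j ℤ.- + cnt c (2 * j))

difference-≤ : ∀ a b c d → a + b ℕ.≤ c + d → + a ℤ.- + d ℤ.≤ + c ℤ.- + b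
difference-≤ a b c d l = cross (+ c) (+ a) (+ b) (+ d) (ℤ.+≤+ l)

module _ {k : ℕ} where
  private variable
    d′ z′ d⁺ z⁻ : Word k
    α : Letter k

  Step-cnt⁺ : Step d′ z′ d⁺ z⁻ α → ∀ t → cnt d⁺ t ≡ cnt d′ t + bit (rank α) t
  Step-cnt⁺ (skip _ s) t = Step-cnt⁺ s t
  Step-cnt⁺ (take {d = d} {a = a} _ _) t = ℕₚ.+-comm (bit (rank a) t) (cnt d t)
  Step-cnt⁺ (match {x = x} _ s) t = trans (cong₂ _+_ refl (Step-cnt⁺ s t)) (sym (ℕₚ.+-assoc (bit (rank x) t) _ _))

  Step-cnt⁻ : Step d′ z′ d⁺ z⁻ α → ∀ t → cnt z′ t ≡ cnt z⁻ t + bit (rank α) t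
  Step-cnt⁻ (skip {x = x} _ s) t = trans (cong₂ _+_ refl (Step-cnt⁻ s t)) (sym (ℕₚ.+-assoc (bit (rank x) t) _ _))
  Step-cnt⁻ (take {z = z} {a = a} _ _) t = ℕₚ.+-comm (bit (rank a) t) (cnt z t)
  Step-cnt⁻ (match {y = y} _ s) t = trans (cong₂ _+_ refl (Step-cnt⁻ s t)) (sym (ℕₚ.+-assoc (bit (rank y) t) _ _))

  Step-occ⁺ : Step d′ z′ d⁺ z⁻ α → ∀ t → occ d⁺ t ≡ occ d′ t + tick (rank α) t
  Step-occ⁺ (skip _ s) t = Step-occ⁺ s t
  Step-occ⁺ (take {d = d} {a = a} _ _) t = ℕₚ.+-comm (tick (rank a) t) (occ d t)
  Step-occ⁺ (match {x = x} _ s) t = trans (cong₂ _+_ refl (Step-occ⁺ s t)) (sym (ℕₚ.+-assoc (tick (rank x) t) _ _))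

  Step-occ⁻ : Step d′ z′ d⁺ z⁻ α → ∀ t → occ z′ t ≡ occ z⁻ t + tick (rank α) t
  Step-occ⁻ (skip {x = x} _ s) t = trans (cong₂ _+_ refl (Step-occ⁻ s t)) (sym (ℕₚ.+-assoc (tick (rank x) t) _ _))
  Step-occ⁻ (take {z = z} {a = a} _ _) t = ℕₚ.+-comm (tick (rank a) t) (occ z t)
  Step-occ⁻ (match {y = y} _ s) t = trans (cong₂ _+_ refl (Step-occ⁻ s t)) (sym (ℕₚ.+-assoc (tick (rank y) t) _ _))

  private
    add-match : ∀ {A B C D b b′} → A + B ℕ.≤ C + D → b′ ℕ.≤ b → suc A + (b′ + B) ℕ.≤ b + C + suc D
    add-match {A} {B} {C} {D} {b} {b′} l b≤ = begin
      suc A + (b′ + B)     ≡⟨ eq A B b′ ⟩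
      suc (b′ + (A + B))   ≤⟨ s≤s (ℕₚ.+-mono-≤ b≤ l) ⟩
      suc (b + (C + D))    ≡⟨ eq′ C D b ⟩
      b + C + suc D        ∎
      where
      open ℕₚ.≤-Reasoning
      eq : ∀ A B b → suc A + (b + B) ≡ suc (b + (A + B))
      eq = solveℕ
      eq′ : ∀ C D b → suc (b + (C + D)) ≡ b + C + suc D
      eq′ = solveℕ

    add-skip : ∀ {A B C D b} → b ℕ.≤ 1 → A + B ℕ.≤ C + D → A + (b + B) ℕ.≤ C + suc D
    add-skip {A} {B} {C} {D} {b} b≤1 l = begin
      A + (b + B)    ≡⟨ eq A B b ⟩
      b + (A + B)    ≤⟨ ℕₚ.+-mono-≤ b≤1 l ⟩
      suc (C + D)    ≡⟨ ℕₚ.+-suc C D ⟨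
      C + suc D      ∎
      where
      open ℕₚ.≤-Reasoning
      eq : ∀ A B b → A + (b + B) ≡ b + (A + B)
      eq = solveℕ

  -- The letter α sits at the first minimum of the path.
  Step-least : Step d′ z′ d⁺ z⁻ α → Ascending z′ → ∀ t →
               cnt d′ (suc (rank α)) + cnt z′ t ℕ.≤ cnt d′ t + cnt z′ (suc (rank α))
  Step-least {α = α} (skip {d = d} {z = z} {x = x} _ s) (x<z ∷ az) t
    rewrite bit-< {rank x} {suc (rank α)} (ℕₚ.<-trans (Step-letter s x<z) ℕₚ.≤-refl) =
    add-skip {cnt d (suc (rank α))} (bit-≤1 (rank x) t) (Step-least s az t)
  Step-least {α = α} (take {d = d} {z = z} α<d rect) _ t
    rewrite bit-< {rank α} {suc (rank α)} ℕₚ.≤-refl | cnt-none {t = suc (rank α)} α<d =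
    add-skip {0} (bit-≤1 (rank α) t) (ℕₚ.≤-trans (rect-cnt rect t) (ℕₚ.m≤m+n (cnt d t) _))
  Step-least {α = α} (match {d = d} {x = x} {y = y} x≤y s) (y<z ∷ az) t
    rewrite bit-< {rank y} {suc (rank α)} (ℕₚ.<-trans (Step-letter s y<z) ℕₚ.≤-refl)
          | bit-< {rank x} {suc (rank α)} (ℕₚ.≤-<-trans x≤y (ℕₚ.<-trans (Step-letter s y<z) ℕₚ.≤-refl)) =
    add-match {cnt d (suc (rank α))} (Step-least s az t) (bit-antitone t x≤y)

  Step-first : Step d′ z′ d⁺ z⁻ α → Ascending z′ → ∀ t → t ℕ.≤ rank α →
               suc (cnt d′ (suc (rank α)) + cnt z′ t) ℕ.≤ cnt d′ t + cnt z′ (suc (rank α))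
  Step-first {α = α} (skip {d = d} {z = z} {x = x} _ s) (x<z ∷ az) t t≤α
    rewrite bit-< {rank x} {suc (rank α)} (ℕₚ.<-trans (Step-letter s x<z) ℕₚ.≤-refl) =
    add-skip {suc (cnt d (suc (rank α)))} (bit-≤1 (rank x) t) (Step-first s az t t≤α)
  Step-first {α = α} (take {d = d} {z = z} α<d rect) _ t t≤α
    rewrite bit-< {rank α} {suc (rank α)} ℕₚ.≤-refl | cnt-none {t = suc (rank α)} α<d | bit-≥ t≤α =
    ℕₚ.≤-trans (s≤s (ℕₚ.≤-trans (rect-cnt rect t) (ℕₚ.m≤m+n (cnt d t) _))) (ℕₚ.≤-reflexive (sym (ℕₚ.+-suc (cnt d t) _)))
  Step-first {α = α} (match {d = d} {x = x} {y = y} x≤y s) (y<z ∷ az) t t≤α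
    rewrite bit-< {rank y} {suc (rank α)} (ℕₚ.<-trans (Step-letter s y<z) ℕₚ.≤-refl)
          | bit-< {rank x} {suc (rank α)} (ℕₚ.≤-<-trans x≤y (ℕₚ.<-trans (Step-letter s y<z) ℕₚ.≤-refl)) =
    add-match {suc (cnt d (suc (rank α)))} (Step-first s az t t≤α) (bit-antitone t x≤y)

  Step-Shift : Step d′ z′ d⁺ z⁻ α → Ascending d′ → Ascending z′ →
               Shift (pathOf d′ z′) (pathOf d⁺ z⁻) (rank α) (+ cnt d′ (suc (rank α)) ℤ.- + cnt z′ (suc (rank α)))
  Step-Shift {d′ = d} {z′ = z} {d⁺ = d⁺} {z⁻ = z⁻} {α = α} s ad az = record
    { F-before = λ t l → F-change t 0 (bit-≥ l)
    ; F-after  = λ t l → F-change t 1 (bit-< l)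
    ; G-before = λ j l → G-change j 0 (bit-≥ l)
    ; G-after  = λ j l → G-change j 1 (bit-< l)
    ; above    = above
    ; least    = λ t → difference-≤ _ (cnt z t) (cnt d t) _ (Step-least s az t)
    ; at       = ℤₚ.≤-antisym at-≤ (above ρ ℕₚ.≤-refl)
    ; at-suc   = refl
    }
    where
    ρ : ℕ
    ρ = rank α
    F-change : ∀ t b → bit ρ t ≡ b → + cnt d⁺ t ℤ.- + cnt z⁻ t ≡ + cnt d t ℤ.- + cnt z t ℤ.+ + (b + b)
    F-change t b e rewrite Step-cnt⁺ s t | Step-cnt⁻ s t | e = eq (+ cnt d t) (+ cnt z⁻ t) (+ b)
      where
      eq : ∀ x y b → x ℤ.+ b ℤ.- y ≡ x ℤ.- (y ℤ.+ b) ℤ.+ (b ℤ.+ b)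
      eq = solveℤ
    G-change : ∀ j b → bit ρ (2 * j) ≡ b → + j ℤ.- + cnt d⁺ (2 * j) ≡ + j ℤ.- + cnt d (2 * j) ℤ.+ (ℤ.- + b)
    G-change j b e rewrite Step-cnt⁺ s (2 * j) | e = eq (+ j) (+ cnt d (2 * j)) (+ b)
      where
      eq : ∀ x y b → x ℤ.- (y ℤ.+ b) ≡ x ℤ.- y ℤ.+ (ℤ.- b)
      eq = solveℤ
    plus-one : ∀ x y → + x ℤ.- + y ℤ.+ + 1 ≡ + suc x ℤ.- + y
    plus-one x y = eq (+ x) (+ y)
      where
      eq : ∀ x y → x ℤ.- y ℤ.+ + 1 ≡ + 1 ℤ.+ x ℤ.- y
      eq = solveℤ
    above : ∀ t → t ℕ.≤ ρ → + cnt d (suc ρ) ℤ.- + cnt z (suc ρ) ℤ.+ + 1 ℤ.≤ + cnt d t ℤ.- + cnt z t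
    above t l = subst (ℤ._≤ + cnt d t ℤ.- + cnt z t) (sym (plus-one (cnt d (suc ρ)) (cnt z (suc ρ))))
      (difference-≤ _ (cnt z t) (cnt d t) _ (Step-first s az t l))
    -- `F` falls by at most one across `α`, since the column `z` contains no letter twice.
    at-≤ : + cnt d ρ ℤ.- + cnt z ρ ℤ.≤ + cnt d (suc ρ) ℤ.- + cnt z (suc ρ) ℤ.+ + 1
    at-≤ = subst (+ cnt d ρ ℤ.- + cnt z ρ ℤ.≤_) (sym (plus-one (cnt d (suc ρ)) (cnt z (suc ρ))))
      (difference-≤ (cnt d ρ) (cnt z (suc ρ)) _ (cnt z ρ)
        (ℕₚ.≤-trans (ℕₚ.+-mono-≤ (cnt-mono d ρ) (cnt-step az ρ)) (ℕₚ.≤-reflexive (ℕₚ.+-suc _ _))))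

KingColumn : ℕ → Word k → Set
KingColumn n c = Bounded n (column c)

ascending-cross : (u : Word k) {v : Word k} → Ascending (u ++ x ∷ v) → All (_< x) u
ascending-cross []      _        = []
ascending-cross (y ∷ u) (l ∷ auv) = All.head (Allₚ.++⁻ʳ u l) ∷ ascending-cross u auv

ascending-right : (u : Word k) {v : Word k} → Ascending (u ++ v) → Ascending v
ascending-right []      av        = av
ascending-right (x ∷ u) (_ ∷ auv) = ascending-right u auv

ascending-erase : (u : Word k) {v w : Word k} → Ascending (u ++ v ++ w) → Ascending (u ++ w)
ascending-erase []      {v = v} avw   = ascending-right v avw
ascending-erase (x ∷ u) {v = v} (l ∷ auvw) =
  Allₚ.++⁺ (Allₚ.++⁻ˡ u l) (Allₚ.++⁻ʳ v (Allₚ.++⁻ʳ u l)) ∷ ascending-erase u {v} auvw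

-- `pre` stands for the smaller letters not yet inserted when the pair is cancelled. At `toℕ i` the
-- function `G` equals minus the length of `pre`; before that point it is no smaller, because `A` is
-- King. The pair makes it fall by one, and as `v` is King it never falls further.
module Erasure {k} (pre A v zs : Word k) (i : Fin k) (az : Ascending zs)
               (ac : Ascending ((pre ++ A) ++ plain i ∷ bar i ∷ v))
               (size : length A ≡ toℕ i) (kA : KingColumn 0 A) (kv : KingColumn (suc (toℕ i)) v) where

  private
    I : ℕ
    I = toℕ i
    U c₀ c₁ : Word k
    U  = pre ++ A
    c₀ = U ++ plain i ∷ bar i ∷ v
    c₁ = U ++ v

  both : ℕ → ℕ
  both t = bit (2 * I) t + bit (suc (2 * I)) t

  cnt-erase : ∀ t → cnt c₀ t ≡ cnt c₁ t + both t
  cnt-erase t rewrite cnt-++ U (plain i ∷ bar i ∷ v) t | cnt-++ U v t = eq (cnt U t) (bit (2 * I) t) (bit (suc (2 * I)) t) (cnt v t)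
    where
    eq : ∀ a b c d → a + (b + (c + d)) ≡ a + d + (b + c)
    eq = solveℕ

  occ-erase : ∀ t → occ c₀ t ≡ occ c₁ t + (tick (2 * I) t + tick (suc (2 * I)) t)
  occ-erase t rewrite occ-++ U (plain i ∷ bar i ∷ v) t | occ-++ U v t = eq (occ U t) (tick (2 * I) t) (tick (suc (2 * I)) t) (occ v t)
    where
    eq : ∀ a b c d → a + (b + (c + d)) ≡ a + d + (b + c)
    eq = solveℕ

  both-low : ∀ {t} → t ℕ.≤ 2 * I → both t ≡ 0
  both-low l = cong₂ _+_ (bit-≥ l) (bit-≥ (ℕₚ.m≤n⇒m≤1+n l))

  both-mid : both (suc (2 * I)) ≡ 1
  both-mid = cong₂ _+_ (bit-< {2 * I} ℕₚ.≤-refl) (bit-≥ {suc (2 * I)} ℕₚ.≤-refl)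

  both-high : ∀ {t} → suc (2 * I) ℕ.< t → both t ≡ 2
  both-high l = cong₂ _+_ (bit-< (ℕₚ.<-trans ℕₚ.≤-refl l)) (bit-< l)

  F-change : ∀ t b → both t ≡ b → + cnt c₁ t ℤ.- + cnt zs t ≡ + cnt c₀ t ℤ.- + cnt zs t ℤ.+ (ℤ.- + b)
  F-change t b e rewrite cnt-erase t | e = eq (+ cnt c₁ t) (+ cnt zs t) (+ b)
    where
    eq : ∀ x y b → x ℤ.- y ≡ x ℤ.+ b ℤ.- y ℤ.+ (ℤ.- b)
    eq = solveℤ

  G-change : ∀ j b → both (2 * j) ≡ b → + j ℤ.- + cnt c₁ (2 * j) ≡ + j ℤ.- + cnt c₀ (2 * j) ℤ.+ + b
  G-change j b e rewrite cnt-erase (2 * j) | e = eq (+ j) (+ cnt c₁ (2 * j)) (+ b)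
    where
    eq : ∀ x y b → x ℤ.- y ≡ x ℤ.- (y ℤ.+ b) ℤ.+ b
    eq = solveℤ

  u< : All (_< plain i) U
  u< = ascending-cross U ac

  <v : All (λ x → suc (suc (2 * I)) ℕ.≤ rank x) v
  <v with _ ∷ (l ∷ _) ← ascending-right U ac = l

  size-u : length U ≡ length pre + I
  size-u = trans (Listₚ.length-++ pre) (cong₂ _+_ (refl {x = length pre}) size)

  cnt-v-low : ∀ {t} → t ℕ.≤ suc (suc (2 * I)) → cnt v t ≡ 0
  cnt-v-low l = cnt-none (All.map (ℕₚ.≤-trans l) <v)

  cnt-u-high : ∀ {t} → 2 * I ℕ.≤ t → cnt U t ≡ length U
  cnt-u-high l = cnt-all (All.map (λ m → ℕₚ.<-≤-trans m l) u<)

  cnt-c₀ : ∀ t → cnt c₀ t ≡ cnt U t + cnt v t + both t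
  cnt-c₀ t = trans (cnt-erase t) (cong (_+ both t) (cnt-++ U v t))

  at-I : cnt c₀ (2 * I) ≡ length U
  at-I = trans (cnt-c₀ (2 * I)) (trans (cong₂ _+_ (cong₂ _+_ (cnt-u-high ℕₚ.≤-refl) (cnt-v-low (ℕₚ.m≤n⇒m≤1+n (ℕₚ.n≤1+n _)))) (both-low ℕₚ.≤-refl))
    (trans (ℕₚ.+-identityʳ _) (ℕₚ.+-identityʳ _)))

  at-suc-I : cnt c₀ (2 * suc I) ≡ 2 + length U
  at-suc-I = trans (cong (cnt c₀) (ℕₚ.*-suc 2 I)) (trans (cnt-c₀ (2 + 2 * I))
    (trans (cong₂ _+_ (cong₂ _+_ (cnt-u-high (ℕₚ.m≤n⇒m≤1+n (ℕₚ.n≤1+n _))) (cnt-v-low ℕₚ.≤-refl)) (both-high ℕₚ.≤-refl)) (eq (length U))))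
    where
    eq : ∀ x → x + 0 + 2 ≡ 2 + x
    eq = solveℕ

  low : ∀ j → j ℕ.≤ I → I + cnt c₀ (2 * j) ℕ.≤ j + length U
  low j l = begin
    I + cnt c₀ (2 * j)                     ≡⟨ cong₂ _+_ (refl {x = I}) (trans (cnt-c₀ (2 * j)) (cong₂ _+_ (cong₂ _+_ (cnt-++ pre A (2 * j)) (cnt-v-low (ℕₚ.≤-trans (2* l) (ℕₚ.m≤n⇒m≤1+n (ℕₚ.n≤1+n _))))) (both-low (2* l)))) ⟩
    I + (cnt pre (2 * j) + cnt A (2 * j) + 0 + 0)   ≤⟨ ℕₚ.+-monoʳ-≤ I (ℕₚ.+-monoˡ-≤ 0 (ℕₚ.+-monoˡ-≤ 0 (ℕₚ.+-mono-≤ (cnt-≤ pre (2 * j)) (cnt-bounded kA j)))) ⟩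
    I + (length pre + j + 0 + 0)           ≡⟨ eq I (length pre) j ⟩
    j + (length pre + I)                   ≡⟨ cong₂ _+_ (refl {x = j}) size-u ⟨
    j + length U                           ∎
    where
    open ℕₚ.≤-Reasoning
    eq : ∀ I p j → I + (p + j + 0 + 0) ≡ j + (p + I)
    eq = solveℕ

  high : ∀ j → I ℕ.< j → suc I + cnt c₀ (2 * j) ℕ.≤ j + (2 + length U)
  high j l = begin
    suc I + cnt c₀ (2 * j)                         ≡⟨ cong₂ _+_ (refl {x = suc I}) (trans (cnt-c₀ (2 * j)) (cong₂ _+_ (cong (_+ cnt v (2 * j)) (cnt-u-high (2* (ℕₚ.<⇒≤ l)))) (both-high (2+2* l)))) ⟩
    suc I + (length U + cnt v (2 * j) + 2)         ≤⟨ ℕₚ.+-monoʳ-≤ (suc I) (ℕₚ.+-monoˡ-≤ 2 (ℕₚ.+-monoʳ-≤ (length U) (cnt-bounded kv j))) ⟩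
    suc I + (length U + (j ∸ suc I) + 2)           ≡⟨ eq (suc I) (length U) (j ∸ suc I) ⟩
    (suc I + (j ∸ suc I)) + (2 + length U)         ≡⟨ cong (_+ (2 + length U)) (ℕₚ.m+[n∸m]≡n l) ⟩
    j + (2 + length U)                             ∎
    where
    open ℕₚ.≤-Reasoning
    eq : ∀ a U b → a + (U + b + 2) ≡ a + b + (2 + U)
    eq = solveℕ

  m : ℤ
  m = + suc I ℤ.- + cnt c₀ (2 * suc I)

  m≡ : m ≡ + suc I ℤ.- + (2 + length U)
  m≡ = cong (λ n → + suc I ℤ.- + n) at-suc-I

  m+1≡ : m ℤ.+ + 1 ≡ + I ℤ.- + length U
  m+1≡ = trans (cong (ℤ._+ + 1) m≡) (eq (+ I) (+ length U))
    where
    eq : ∀ x y → + 1 ℤ.+ x ℤ.- (+ 2 ℤ.+ y) ℤ.+ + 1 ≡ x ℤ.- y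
    eq = solveℤ

  above : ∀ j → j ℕ.≤ I → m ℤ.+ + 1 ℤ.≤ + j ℤ.- + cnt c₀ (2 * j)
  above j l = subst (ℤ._≤ + j ℤ.- + cnt c₀ (2 * j)) (sym m+1≡) (difference-≤ I (cnt c₀ (2 * j)) j (length U) (low j l))

  least : ∀ j → m ℤ.≤ + j ℤ.- + cnt c₀ (2 * j)
  least j with side I j
  ... | before l = ℤₚ.≤-trans (ℤₚ.≤-trans (ℤₚ.≤-reflexive (sym (ℤₚ.+-identityʳ m))) (ℤₚ.+-monoʳ-≤ m (ℤ.+≤+ z≤n))) (above j l)
  ... | after l  = subst (ℤ._≤ + j ℤ.- + cnt c₀ (2 * j)) (sym m≡) (difference-≤ (suc I) (cnt c₀ (2 * j)) j (2 + length U) (high j l))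

  cnt-first : cnt c₀ (suc (2 * I)) ≡ suc (length U)
  cnt-first = trans (cnt-c₀ (suc (2 * I))) (trans (cong₂ _+_ (cong₂ _+_ (cnt-u-high (ℕₚ.n≤1+n _)) (cnt-v-low (ℕₚ.n≤1+n _))) both-mid) (eq (length U)))
    where
    eq : ∀ x → x + 0 + 1 ≡ suc x
    eq = solveℕ

  erasure : Erase (pathOf c₀ zs) (pathOf c₁ zs) I m
  erasure = record
    { F-low  = λ t l → F-change t 0 (both-low l)
    ; F-mid  = F-change (suc (2 * I)) 1 both-mid
    ; F-high = λ t l → F-change t 2 (both-high l)
    ; G-low  = λ j l → G-change j 0 (both-low (2* l))
    ; G-high = λ j l → G-change j 2 (both-high (2+2* l))
    ; above  = above
    ; least  = least
    ; at     = trans (cong (λ n → + I ℤ.- + n) at-I) (sym m+1≡)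
    ; at-suc = refl
    ; first  = difference-≤ _ (cnt zs (suc (2 * I))) _ (cnt zs (2 * I)) (subst₂ (λ p q → p + cnt zs (suc (2 * I)) ℕ.≤ q + cnt zs (2 * I)) (sym at-I) (sym cnt-first)
        (ℕₚ.≤-trans (ℕₚ.+-monoʳ-≤ (length U) (cnt-step az (2 * I))) (ℕₚ.≤-reflexive (ℕₚ.+-suc (length U) _))))
    ; second = subst (+ cnt c₀ (2 * suc I) ℤ.- + cnt zs (2 * suc I) ℤ.≤_) (eq (+ cnt c₀ (suc (2 * I))) (+ cnt zs (suc (2 * I))))
        (difference-≤ _ (cnt zs (suc (2 * I))) (suc (cnt c₀ (suc (2 * I)))) (cnt zs (2 * suc I))
          (subst₂ (λ p q → p + cnt zs (suc (2 * I)) ℕ.≤ suc q + cnt zs (2 * suc I)) (sym at-suc-I) (sym cnt-first)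
            (ℕₚ.+-monoʳ-≤ (2 + length U) (subst (λ n → cnt zs (suc (2 * I)) ℕ.≤ cnt zs n) (sym (ℕₚ.*-suc 2 I)) (cnt-mono zs (suc (2 * I)))))))
    }
    where
    eq : ∀ x y → + 1 ℤ.+ x ℤ.- y ≡ x ℤ.- y ℤ.+ + 1
    eq = solveℤ

-- The functionals are invariant at even end points only: at a level with one plain i and one bar i they do not tell
-- which of the two is in which column. This is what weight and Neutral record.

weight : Word k → Word k → ℕ → ℤ
weight c z i = + (occ c (2 * i) + occ z (2 * i)) ℤ.- + (occ c (suc (2 * i)) + occ z (suc (2 * i)))

record Neutral {k} (c z : Word k) (i : ℕ) : Set where
  constructor neutral
  field
    c-plain : occ c (2 * i) ≡ 1
    c-bar   : occ c (suc (2 * i)) ≡ 0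
    z-plain : occ z (2 * i) ≡ 0
    z-bar   : occ z (suc (2 * i)) ≡ 1

infix 4 _≈_
record _≈_ {k} (p q : Word k × Word k) : Set where
  field
    ⊑-to    : pathOf (proj₁ p) (proj₂ p) ⊑ pathOf (proj₁ q) (proj₂ q)
    ⊑-from  : pathOf (proj₁ q) (proj₂ q) ⊑ pathOf (proj₁ p) (proj₂ p)
    weights : ∀ i → weight (proj₁ p) (proj₂ p) i ≡ weight (proj₁ q) (proj₂ q) i
    to      : ∀ i → Neutral (proj₁ p) (proj₂ p) i → Neutral (proj₁ q) (proj₂ q) i
    from    : ∀ i → Neutral (proj₁ q) (proj₂ q) i → Neutral (proj₁ p) (proj₂ p) i

≈-refl : ∀ {p : Word k × Word k} → p ≈ p
≈-refl = record { ⊑-to = ⊑-refl ; ⊑-from = ⊑-refl ; weights = λ _ → refl ; to = λ _ n → n ; from = λ _ n → n }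

≈-sym : ∀ {p q : Word k × Word k} → p ≈ q → q ≈ p
≈-sym e = record { ⊑-to = E.⊑-from ; ⊑-from = E.⊑-to ; weights = λ i → sym (E.weights i) ; to = E.from ; from = E.to }
  where module E = _≈_ e

≈-trans : ∀ {p q r : Word k × Word k} → p ≈ q → q ≈ r → p ≈ r
≈-trans e f = record
  { ⊑-to = ⊑-trans E.⊑-to F.⊑-to ; ⊑-from = ⊑-trans F.⊑-from E.⊑-from
  ; weights = λ i → trans (E.weights i) (F.weights i)
  ; to = λ i n → F.to i (E.to i n) ; from = λ i n → E.from i (F.from i n) }
  where
  module E = _≈_ e
  module F = _≈_ f

tick-even-odd : ∀ i j → tick (2 * i) (suc (2 * j)) ≡ 0
tick-even-odd i j = tick-≢ (ℕₚ.even≢odd i j)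

tick-odd-even : ∀ i j → tick (suc (2 * i)) (2 * j) ≡ 0
tick-odd-even i j = tick-≢ (λ e → ℕₚ.even≢odd j i (sym e))

module _ {k} (pre A v zs : Word k) (i : Fin k) (az : Ascending zs)
         (ac : Ascending ((pre ++ A) ++ plain i ∷ bar i ∷ v))
         (size : length A ≡ toℕ i) (kA : KingColumn 0 A) (kv : KingColumn (suc (toℕ i)) v) where

  open Erasure pre A v zs i az ac size kA kv using (erasure; occ-erase)

  private
    c₀ c₁ : Word k
    c₀ = (pre ++ A) ++ plain i ∷ bar i ∷ v
    c₁ = (pre ++ A) ++ v

    at-plain : ∀ j → occ c₀ (2 * j) ≡ occ c₁ (2 * j) + tick (2 * toℕ i) (2 * j)
    at-plain j = trans (occ-erase (2 * j)) (cong (λ n → occ c₁ (2 * j) + n)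
      (trans (cong₂ _+_ (refl {x = tick (2 * toℕ i) (2 * j)}) (tick-odd-even (toℕ i) j)) (ℕₚ.+-identityʳ _)))

    at-bar : ∀ j → occ c₀ (suc (2 * j)) ≡ occ c₁ (suc (2 * j)) + tick (2 * toℕ i) (2 * j)
    at-bar j = trans (occ-erase (suc (2 * j))) (cong (λ n → occ c₁ (suc (2 * j)) + n)
      (cong (_+ tick (2 * toℕ i) (2 * j)) (tick-even-odd (toℕ i) j)))

    off : ∀ {j} → ¬ toℕ i ≡ j → tick (2 * toℕ i) (2 * j) ≡ 0
    off {j} ne = tick-≢ (λ e → ne (ℕₚ.*-cancelˡ-≡ (toℕ i) j 2 e))

    untouched : ∀ {x y z} → x ≡ y + z → z ≡ 0 → x ≡ y
    untouched e refl = trans e (ℕₚ.+-identityʳ _)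

    weights : ∀ j → weight c₀ zs j ≡ weight c₁ zs j
    weights j rewrite at-plain j | at-bar j = eq (+ occ c₁ (2 * j)) (+ tick (2 * toℕ i) (2 * j)) (+ occ zs (2 * j)) (+ occ c₁ (suc (2 * j))) (+ occ zs (suc (2 * j)))
      where
      eq : ∀ a t b a′ b′ → a ℤ.+ t ℤ.+ b ℤ.- (a′ ℤ.+ t ℤ.+ b′) ≡ a ℤ.+ b ℤ.- (a′ ℤ.+ b′)
      eq = solveℤ

    to : ∀ j → Neutral c₀ zs j → Neutral c₁ zs j
    to j (neutral e₁ e₂ e₃ e₄) with toℕ i ℕ.≟ j
    ... | yes refl = contradiction (trans (sym e₂) (trans (at-bar j) (cong₂ _+_ (refl {x = occ c₁ (suc (2 * j))}) (tick-refl (2 * j))))) (ne (occ c₁ (suc (2 * j))))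
      where
      ne : ∀ n → ¬ 0 ≡ n + 1
      ne zero    ()
      ne (suc n) ()
    ... | no i≢j = neutral (trans (sym (untouched (at-plain j) (off i≢j))) e₁) (trans (sym (untouched (at-bar j) (off i≢j))) e₂) e₃ e₄

    from : ∀ j → Neutral c₁ zs j → Neutral c₀ zs j
    from j (neutral e₁ e₂ e₃ e₄) with toℕ i ℕ.≟ j
    ... | yes refl = contradiction (subst (ℕ._≤ 1) (trans (at-plain j) (cong₂ _+_ e₁ (tick-refl (2 * j)))) (occ-≤1 ac (2 * j))) λ { (s≤s ()) }
    ... | no i≢j = neutral (trans (untouched (at-plain j) (off i≢j)) e₁) (trans (untouched (at-bar j) (off i≢j)) e₂) e₃ e₄

  erase-≈ : (c₀ , zs) ≈ (c₁ , zs)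
  erase-≈ = record
    { ⊑-to = Erase.erase-⊑ erasure ; ⊑-from = Erase.erase-⊒ erasure
    ; weights = weights ; to = to ; from = from }

module _ {k} {d z d⁺ z⁻ : Word k} {α : Letter k} (step : Step d z d⁺ z⁻ α) (ad : Ascending d) (az : Ascending z) where

  private
    weights : ∀ i → weight d z i ≡ weight d⁺ z⁻ i
    weights i = cong₂ (λ p q → + p ℤ.- + q) (sums (2 * i)) (sums (suc (2 * i)))
      where
      eq : ∀ a b t → a + (b + t) ≡ a + t + b
      eq = solveℕ
      sums : ∀ t → occ d t + occ z t ≡ occ d⁺ t + occ z⁻ t
      sums t rewrite Step-occ⁺ step t | Step-occ⁻ step t = eq (occ d t) (occ z⁻ t) (tick (rank α) t)

    ≢0 : ∀ {x y t} → x ≡ y + tick t t → ¬ x ≡ 0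
    ≢0 {x} {zero} {t} e e′ rewrite tick-refl t = contradiction (trans (sym e) e′) λ ()
    ≢0 {x} {suc y} e e′ = contradiction (trans (sym e) e′) λ ()

    untouched : ∀ {x y t} → x ≡ y + tick (rank α) t → ¬ rank α ≡ t → x ≡ y
    untouched e ne = trans e (trans (cong₂ _+_ refl (tick-≢ ne)) (ℕₚ.+-identityʳ _))

    to : ∀ i → Neutral d z i → Neutral d⁺ z⁻ i
    to i (neutral e₁ e₂ e₃ e₄) with rank α ℕ.≟ 2 * i | rank α ℕ.≟ suc (2 * i)
    ... | yes e | _ = contradiction e₃ (≢0 {y = occ z⁻ (2 * i)} {t = 2 * i} (subst (λ r → occ z (2 * i) ≡ occ z⁻ (2 * i) + tick r (2 * i)) e (Step-occ⁻ step (2 * i))))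
    -- If bar i left `z` at a neutral level, the first minimum of `F` would be at 2i + 2, yet `F`
    -- has the same value at 2i.
    ... | no _ | yes e = contradiction (subst (λ a → suc (cnt d (suc a) + cnt z (2 * i)) ℕ.≤ cnt d (2 * i) + cnt z (suc a)) e
                           (Step-first step az (2 * i) (subst (2 * i ℕ.≤_) (sym e) (ℕₚ.n≤1+n _))))
                         (ℕₚ.<⇒≱ (ℕₚ.≤-<-trans (ℕₚ.≤-reflexive balanced) ℕₚ.≤-refl))
      where
      two-up : (c : Word k) → cnt c (suc (suc (2 * i))) ≡ cnt c (2 * i) + occ c (2 * i) + occ c (suc (2 * i))
      two-up c = trans (cnt-suc c (suc (2 * i))) (cong (_+ occ c (suc (2 * i))) (cnt-suc c (2 * i)))
      balanced : cnt d (2 * i) + cnt z (suc (suc (2 * i))) ≡ cnt d (suc (suc (2 * i))) + cnt z (2 * i)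
      balanced rewrite two-up d | two-up z | e₁ | e₂ | e₃ | e₄ = eq (cnt d (2 * i)) (cnt z (2 * i))
        where
        eq : ∀ a b → a + (b + 0 + 1) ≡ a + 1 + 0 + b
        eq = solveℕ
    ... | no ne | no ne′ = neutral (trans (untouched (Step-occ⁺ step _) ne) e₁) (trans (untouched (Step-occ⁺ step _) ne′) e₂)
                             (trans (sym (untouched (Step-occ⁻ step _) ne)) e₃) (trans (sym (untouched (Step-occ⁻ step _) ne′)) e₄)

    from : ∀ i → Neutral d⁺ z⁻ i → Neutral d z i
    from i (neutral e₁ e₂ e₃ e₄) with rank α ℕ.≟ 2 * i | rank α ℕ.≟ suc (2 * i)
    -- If plain i had come from `z`, the minimum of `F` would be at 2i + 1; but bar i, which is in
    -- `z` and not in `d`, makes `F` fall once more.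
    ... | yes e | _ = contradiction (subst (λ a → cnt d (suc a) + cnt z (suc (suc (2 * i))) ℕ.≤ cnt d (suc (suc (2 * i))) + cnt z (suc a)) e (Step-least step az (suc (suc (2 * i)))))
                        (ℕₚ.<⇒≱ (ℕₚ.≤-reflexive unbalanced))
      where
      odd≢ : ¬ rank α ≡ suc (2 * i)
      odd≢ e′ = ℕₚ.even≢odd i i (trans (sym e) e′)
      d-bar : occ d (suc (2 * i)) ≡ 0
      d-bar = trans (sym (untouched (Step-occ⁺ step _) odd≢)) e₂
      z-bar : occ z (suc (2 * i)) ≡ 1
      z-bar = trans (untouched (Step-occ⁻ step _) odd≢) e₄
      unbalanced : suc (cnt d (suc (suc (2 * i))) + cnt z (suc (2 * i))) ≡ cnt d (suc (2 * i)) + cnt z (suc (suc (2 * i)))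
      unbalanced rewrite cnt-suc d (suc (2 * i)) | cnt-suc z (suc (2 * i)) | d-bar | z-bar = eq (cnt d (suc (2 * i))) (cnt z (suc (2 * i)))
        where
        eq : ∀ a b → suc (a + 0 + b) ≡ a + (b + 1)
        eq = solveℕ
    ... | no _ | yes e = contradiction e₂ (≢0 {y = occ d (suc (2 * i))} {t = suc (2 * i)} (subst (λ r → occ d⁺ (suc (2 * i)) ≡ occ d (suc (2 * i)) + tick r (suc (2 * i))) e (Step-occ⁺ step (suc (2 * i)))))
    ... | no ne | no ne′ = neutral (trans (sym (untouched (Step-occ⁺ step _) ne)) e₁) (trans (sym (untouched (Step-occ⁺ step _) ne′)) e₂)
                             (trans (untouched (Step-occ⁻ step _) ne) e₃) (trans (untouched (Step-occ⁻ step _) ne′) e₄)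

  step-≈ : (d , z) ≈ (d⁺ , z⁻)
  step-≈ = record
    { ⊑-to = Shift.shift-⊑ shift ; ⊑-from = Shift.shift-⊒ shift
    ; weights = weights ; to = to ; from = from }
    where shift = Step-Shift step ad az

-- King pairs are determined by the invariants

record NonNegative (π : Path) : Set where
  field
    F≥0 : ∀ t → 0ℤ ℤ.≤ Path.F π t
    G≥0 : ∀ j → 0ℤ ℤ.≤ Path.G π j

≤-minus : ∀ {v h q} → v ℤ.≤ h ℤ.- q → 0ℤ ℤ.≤ q → v ℤ.≤ h
≤-minus {v} {h} {q} v≤ 0≤q = ℤₚ.≤-trans v≤ (ℤₚ.≤-trans (ℤₚ.+-monoʳ-≤ h (ℤₚ.neg-mono-≤ 0≤q)) (ℤₚ.≤-reflexive (ℤₚ.+-identityʳ h)))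

≥0-+ : ∀ {x y} → 0ℤ ℤ.≤ x → 0ℤ ℤ.≤ y → 0ℤ ℤ.≤ x ℤ.+ y
≥0-+ = ℤₚ.+-mono-≤

-- With all indices 0 nothing is subtracted, so the end value of `π` is itself a value of the
-- functional, whereas for the nonnegative `ρ` no value exceeds the end value.
H₁-mono : ∀ {π ρ} → π ⊑ ρ → Path.F π 0 ≡ 0ℤ → Path.G π 0 ≡ 0ℤ → NonNegative ρ → ∀ L → H₁ π L ℤ.≤ H₁ ρ L
H₁-mono {π} {ρ} π⊑ρ F0 G0 nn L with reaches s j t _ _ _ v≤ ← _⊑_.reach₁ π⊑ρ L 0 0 0 z≤n z≤n z≤n =
  subst (ℤ._≤ H₁ ρ L) start (≤-minus v≤ (≥0-+ (≥0-+ (F≥0 s) (≥0-+ (G≥0 j) (G≥0 j))) (F≥0 t)))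
  where
  open NonNegative nn
  start : value₁ π L 0 0 0 ≡ H₁ π L
  start rewrite F0 | G0 = ℤₚ.+-identityʳ _

H₂-mono : ∀ {π ρ} → π ⊑ ρ → Path.F π 0 ≡ 0ℤ → Path.G π 0 ≡ 0ℤ → NonNegative ρ → ∀ L → H₂ π L ℤ.≤ H₂ ρ L
H₂-mono {π} {ρ} π⊑ρ F0 G0 nn L with reaches i s j _ _ _ v≤ ← _⊑_.reach₂ π⊑ρ L 0 0 0 z≤n z≤n z≤n =
  subst (ℤ._≤ H₂ ρ L) start (≤-minus v≤ (≥0-+ (≥0-+ (≥0-+ (G≥0 i) (G≥0 i)) (≥0-+ (F≥0 s) (F≥0 s))) (≥0-+ (G≥0 j) (G≥0 j))))
  where
  open NonNegative nn
  start : value₂ π L 0 0 0 ≡ H₂ π L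
  start rewrite F0 | G0 = ℤₚ.+-identityʳ _

record KingPair {k} (c z : Word k) : Set where
  field
    ascending-c : Ascending c
    ascending-z : Ascending z
    rect        : Rect c z
    king-c      : KingColumn 0 c

  nonNegative : NonNegative (pathOf c z)
  nonNegative = record
    { F≥0 = λ t → difference-≤ 0 (cnt z t) (cnt c t) 0 (subst (cnt z t ℕ.≤_) (sym (ℕₚ.+-identityʳ _)) (rect-cnt rect t))
    ; G≥0 = λ j → difference-≤ 0 (cnt c (2 * j)) j 0 (subst (cnt c (2 * j) ℕ.≤_) (sym (ℕₚ.+-identityʳ _)) (cnt-bounded king-c j)) }

  F0 : + cnt c 0 ℤ.- + cnt z 0 ≡ 0ℤ
  F0 rewrite cnt-0 c | cnt-0 z = refl

  G0 : + 0 ℤ.- + cnt c 0 ≡ 0ℤ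
  G0 rewrite cnt-0 c = refl

halve : ∀ m n → m + m ≡ n + n → m ≡ n
halve zero    zero    _ = refl
halve (suc m) (suc n) e = cong suc (halve m n (ℕₚ.suc-injective (trans (sym (ℕₚ.+-suc m m)) (trans (ℕₚ.suc-injective e) (ℕₚ.+-suc n n)))))

data Bit : ℕ → Set where
  b0 : Bit 0
  b1 : Bit 1

toBit : ∀ {n} → n ℕ.≤ 1 → Bit n
toBit z≤n       = b0
toBit (s≤s z≤n) = b1

-- a, b are the multiplicities of plain i and bar i in the first column, c, d those in the second one.
module Multiplicities {a b c d a′ b′ c′ d′ : ℕ} (first : a + b ≡ a′ + b′) (second : c + d ≡ c′ + d′)
             (diff : (a + c) + (b′ + d′) ≡ (a′ + c′) + (b + d)) where

  plains : a + c ≡ a′ + c′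
  plains = halve (a + c) (a′ + c′) (ℕₚ.+-cancelʳ-≡ (b + d + (b′ + d′)) _ _ (begin
    a + c + (a + c) + (b + d + (b′ + d′))           ≡⟨ eq a b c d b′ d′ ⟩
    (a + b) + (c + d) + ((a + c) + (b′ + d′))       ≡⟨ cong₂ _+_ (cong₂ _+_ first second) diff ⟩
    (a′ + b′) + (c′ + d′) + ((a′ + c′) + (b + d))   ≡⟨ eq′ a′ b′ c′ d′ b d ⟩
    a′ + c′ + (a′ + c′) + (b + d + (b′ + d′))       ∎))
    where
    open ≡-Reasoning
    eq : ∀ a b c d b′ d′ → a + c + (a + c) + (b + d + (b′ + d′)) ≡ (a + b) + (c + d) + ((a + c) + (b′ + d′))
    eq = solveℕ
    eq′ : ∀ a′ b′ c′ d′ b d → (a′ + b′) + (c′ + d′) + ((a′ + c′) + (b + d)) ≡ a′ + c′ + (a′ + c′) + (b + d + (b′ + d′))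
    eq′ = solveℕ

  same-a : a ≡ a′ → b ≡ b′ × c ≡ c′ × d ≡ d′
  same-a refl with refl ← ℕₚ.+-cancelˡ-≡ a b b′ first | refl ← ℕₚ.+-cancelˡ-≡ a c c′ plains =
    refl , refl , ℕₚ.+-cancelˡ-≡ c d d′ second

one-zero : ∀ {a b m n} → a ≡ 1 → b ≡ 0 → a + m ≡ b + n → Bit m → Bit n → m ≡ 0 × n ≡ 1
one-zero refl refl _ b0 b1 = refl , refl

module _ {k} {c z c′ z′ : Word k} (K : KingPair c z) (K′ : KingPair c′ z′) (e : (c , z) ≈ (c′ , z′)) where
  private
    module K  = KingPair K
    module K′ = KingPair K′
    module e  = _≈_ e

    H₁≡ : ∀ L → H₁ (pathOf c z) L ≡ H₁ (pathOf c′ z′) L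
    H₁≡ L = ℤₚ.≤-antisym (H₁-mono e.⊑-to K.F0 K.G0 K′.nonNegative L) (H₁-mono e.⊑-from K′.F0 K′.G0 K.nonNegative L)

    H₂≡ : ∀ L → H₂ (pathOf c z) L ≡ H₂ (pathOf c′ z′) L
    H₂≡ L = ℤₚ.≤-antisym (H₂-mono e.⊑-to K.F0 K.G0 K′.nonNegative L) (H₂-mono e.⊑-from K′.F0 K′.G0 K.nonNegative L)

    -- For the path of a pair, `H₁` is `L` minus the count of the second column, and `H₂` minus `H₁`
    -- is `L` minus the count of the first.
    cnt-c : ∀ L → cnt c (2 * L) ≡ cnt c′ (2 * L)
    cnt-c L = ℤₚ.+-injective (trans (eq (+ L) (+ cnt c (2 * L)) (+ cnt z (2 * L)))
      (trans (cong₂ (λ p q → + L ℤ.- (q ℤ.- p)) (H₁≡ L) (H₂≡ L)) (sym (eq (+ L) (+ cnt c′ (2 * L)) (+ cnt z′ (2 * L))))))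
      where
      eq : ∀ L c z → c ≡ L ℤ.- (c ℤ.- z ℤ.+ (L ℤ.- c ℤ.+ (L ℤ.- c)) ℤ.- (c ℤ.- z ℤ.+ (L ℤ.- c)))
      eq = solveℤ

    cnt-z : ∀ L → cnt z (2 * L) ≡ cnt z′ (2 * L)
    cnt-z L = ℤₚ.+-injective (trans (eq (+ L) (+ cnt c (2 * L)) (+ cnt z (2 * L)))
      (trans (cong (λ p → + L ℤ.- p) (H₁≡ L)) (sym (eq (+ L) (+ cnt c′ (2 * L)) (+ cnt z′ (2 * L))))))
      where
      eq : ∀ L c z → z ≡ L ℤ.- (c ℤ.- z ℤ.+ (L ℤ.- c))
      eq = solveℤ

    two-up : (c : Word k) (i : ℕ) → cnt c (2 * suc i) ≡ cnt c (2 * i) + (occ c (2 * i) + occ c (suc (2 * i)))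
    two-up c i = trans (cong (cnt c) (ℕₚ.*-suc 2 i)) (trans (cnt-suc c (suc (2 * i)))
      (trans (cong (_+ occ c (suc (2 * i))) (cnt-suc c (2 * i))) (ℕₚ.+-assoc (cnt c (2 * i)) _ _)))

    level-sum : (c c′ : Word k) → (∀ L → cnt c (2 * L) ≡ cnt c′ (2 * L)) → ∀ i →
                occ c (2 * i) + occ c (suc (2 * i)) ≡ occ c′ (2 * i) + occ c′ (suc (2 * i))
    level-sum c c′ eq i = ℕₚ.+-cancelˡ-≡ (cnt c (2 * i)) _ _
      (trans (sym (two-up c i)) (trans (eq (suc i)) (trans (two-up c′ i) (cong (_+ (occ c′ (2 * i) + occ c′ (suc (2 * i)))) (sym (eq i))))))

    diff : ∀ i → (occ c (2 * i) + occ z (2 * i)) + (occ c′ (suc (2 * i)) + occ z′ (suc (2 * i))) ≡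
                 (occ c′ (2 * i) + occ z′ (2 * i)) + (occ c (suc (2 * i)) + occ z (suc (2 * i)))
    diff i = ℤₚ.+-injective (uncross (occ c (2 * i) + occ z (2 * i)) _ _ (occ c′ (suc (2 * i)) + occ z′ (suc (2 * i))) (e.weights i))
      where
      uncross : ∀ p q p′ q′ → + p ℤ.- + q ≡ + p′ ℤ.- + q′ → + (p + q′) ≡ + (p′ + q)
      uncross p q p′ q′ eq = trans (e₁ (+ p) (+ q) (+ q′)) (trans (cong (ℤ._+ (+ q ℤ.+ + q′)) eq) (e₂ (+ p′) (+ q) (+ q′)))
        where
        e₁ : ∀ p q q′ → p ℤ.+ q′ ≡ p ℤ.- q ℤ.+ (q ℤ.+ q′)
        e₁ = solveℤ
        e₂ : ∀ p q q′ → p ℤ.- q′ ℤ.+ (q ℤ.+ q′) ≡ p ℤ.+ q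
        e₂ = solveℤ

    -- The counts at even points fix how many letters of level i each column has, the weight fixes
    -- how many of them are plain. One ambiguity remains, a plain i in one column and a bar i in the
    -- other, and `Neutral` tells its two forms apart.
    level : ∀ i → occ c (2 * i) ≡ occ c′ (2 * i) × occ c (suc (2 * i)) ≡ occ c′ (suc (2 * i)) ×
                  occ z (2 * i) ≡ occ z′ (2 * i) × occ z (suc (2 * i)) ≡ occ z′ (suc (2 * i))
    level i = by-a (toBit (occ-≤1 K.ascending-c (2 * i))) (toBit (occ-≤1 K′.ascending-c (2 * i))) refl refl
      where
      open Multiplicities {occ c (2 * i)} {occ c (suc (2 * i))} {occ z (2 * i)} {occ z (suc (2 * i))}
                 {occ c′ (2 * i)} {occ c′ (suc (2 * i))} {occ z′ (2 * i)} {occ z′ (suc (2 * i))} (level-sum c c′ cnt-c i) (level-sum z z′ cnt-z i) (diff i)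
      bit-of : {c : Word k} → Ascending c → ∀ t → Bit (occ c t)
      bit-of ac t = toBit (occ-≤1 ac t)
      Goal : Set
      Goal = occ c (2 * i) ≡ occ c′ (2 * i) × occ c (suc (2 * i)) ≡ occ c′ (suc (2 * i)) ×
             occ z (2 * i) ≡ occ z′ (2 * i) × occ z (suc (2 * i)) ≡ occ z′ (suc (2 * i))
      by-a : ∀ {m n} → Bit m → Bit n → occ c (2 * i) ≡ m → occ c′ (2 * i) ≡ n → Goal
      by-a b0 b0 p q = trans p (sym q) , same-a (trans p (sym q))
      by-a b1 b1 p q = trans p (sym q) , same-a (trans p (sym q))
      by-a b1 b0 p q = contradiction (trans (sym q) (Neutral.c-plain (e.to i (neutral p (proj₁ c-bars) (proj₁ z-plains) (proj₂ z-bars))))) λ ()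
        where
        c-bars : occ c (suc (2 * i)) ≡ 0 × occ c′ (suc (2 * i)) ≡ 1
        c-bars = one-zero p q (level-sum c c′ cnt-c i) (bit-of K.ascending-c (suc (2 * i))) (bit-of K′.ascending-c (suc (2 * i)))
        z-plains : occ z (2 * i) ≡ 0 × occ z′ (2 * i) ≡ 1
        z-plains = one-zero p q plains (bit-of K.ascending-z (2 * i)) (bit-of K′.ascending-z (2 * i))
        z-bars : occ z′ (suc (2 * i)) ≡ 0 × occ z (suc (2 * i)) ≡ 1
        z-bars = one-zero (proj₂ z-plains) (proj₁ z-plains) (sym (level-sum z z′ cnt-z i)) (bit-of K′.ascending-z (suc (2 * i))) (bit-of K.ascending-z (suc (2 * i)))
      by-a b0 b1 p q = contradiction (trans (sym p) (Neutral.c-plain (e.from i (neutral q (proj₁ c-bars) (proj₁ z-plains) (proj₂ z-bars))))) λ ()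
        where
        c-bars : occ c′ (suc (2 * i)) ≡ 0 × occ c (suc (2 * i)) ≡ 1
        c-bars = one-zero q p (sym (level-sum c c′ cnt-c i)) (bit-of K′.ascending-c (suc (2 * i))) (bit-of K.ascending-c (suc (2 * i)))
        z-plains : occ z′ (2 * i) ≡ 0 × occ z (2 * i) ≡ 1
        z-plains = one-zero q p (sym plains) (bit-of K′.ascending-z (2 * i)) (bit-of K.ascending-z (2 * i))
        z-bars : occ z (suc (2 * i)) ≡ 0 × occ z′ (suc (2 * i)) ≡ 1
        z-bars = one-zero (proj₂ z-plains) (proj₁ z-plains) (level-sum z z′ cnt-z i) (bit-of K.ascending-z (suc (2 * i))) (bit-of K′.ascending-z (suc (2 * i)))

    half : ∀ t → ∃[ i ] (t ≡ 2 * i ⊎ t ≡ suc (2 * i))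
    half zero = 0 , inj₁ refl
    half (suc t) with half t
    ... | i , inj₁ refl = i , inj₂ refl
    ... | i , inj₂ refl = suc i , inj₁ (sym (ℕₚ.*-suc 2 i))

    occ-c : ∀ t → occ c t ≡ occ c′ t
    occ-c t with half t
    ... | i , inj₁ refl = proj₁ (level i)
    ... | i , inj₂ refl = proj₁ (proj₂ (level i))

    occ-z : ∀ t → occ z t ≡ occ z′ t
    occ-z t with half t
    ... | i , inj₁ refl = proj₁ (proj₂ (proj₂ (level i)))
    ... | i , inj₂ refl = proj₂ (proj₂ (proj₂ (level i)))

    occ-head : (x : Letter k) (c : Word k) → ¬ occ (x ∷ c) (rank x) ≡ 0
    occ-head x c eq rewrite tick-refl (rank x) = contradiction eq λ ()

    occ-below : {x y : Letter k} {c : Word k} → x < y → Ascending (y ∷ c) → occ (y ∷ c) (rank x) ≡ 0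
    occ-below {x} {y} {c} x<y (y<c ∷ _) = occ-none {c = y ∷ c} ((λ eq → ℕₚ.<⇒≢ x<y (sym eq)) ∷ All.map (λ y<w eq → ℕₚ.<⇒≢ (ℕₚ.<-trans {rank x} x<y y<w) (sym eq)) y<c)

    occ-injective : {c c′ : Word k} → Ascending c → Ascending c′ → (∀ t → occ c t ≡ occ c′ t) → c ≡ c′
    occ-injective {[]}    {[]}     _ _ _ = refl
    occ-injective {[]}    {y ∷ c′} _ _ eq = contradiction (sym (eq (rank y))) (occ-head y c′)
    occ-injective {x ∷ c} {[]}     _ _ eq = contradiction (eq (rank x)) (occ-head x c)
    occ-injective {x ∷ c} {y ∷ c′} ac@(_ ∷ ac₁) ac′@(_ ∷ ac₁′) eq with ℕₚ.<-cmp (rank x) (rank y)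
    ... | tri< x<y _ _ = contradiction (trans (eq (rank x)) (occ-below {x} {y} x<y ac′)) (occ-head x c)
    ... | tri> _ _ y<x = contradiction (trans (sym (eq (rank y))) (occ-below {y} {x} y<x ac)) (occ-head y c′)
    ... | tri≈ _ x≡y _ with refl ← rank-injective {x = x} {y = y} x≡y =
      cong (x ∷_) (occ-injective ac₁ ac₁′ (λ t → ℕₚ.+-cancelˡ-≡ (tick (rank x) t) _ _ (eq t)))

  kingPair-unique : c ≡ c′ × z ≡ z′
  kingPair-unique = occ-injective K.ascending-c K′.ascending-c occ-c , occ-injective K.ascending-z K′.ascending-z occ-z

-- Berele insertion of column words

insA-column : All (x <_) c → Ascending c → insA x (column c) ≡ column (x ∷ c)
insA-column [] [] = refl
insA-column {x = x} (x<y ∷ _) (y<c ∷ ac) = trans (insA-Ins (hit x<y)) (cong ([ x ] ∷_) (insA-column y<c ac))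

row-tails-column : (c : Word k) → row (tails (column c)) ≡ []
row-tails-column []      = refl
row-tails-column (x ∷ c) = trans (row-∷ [] (tails (column c))) (trans (++-identityʳ _) (row-tails-column c))

P-C-++ : (u v : Word k) → P-C (u ++ v) ≡ foldl _←C_ (P-C u) v
P-C-++ u v = foldl-++ _←C_ [] u v

P-C-∷ʳ : (w : Word k) (x : Letter k) → P-C (w ∷ʳ x) ≡ P-C w ←C x
P-C-∷ʳ w x = foldl-∷ʳ _←C_ [] x w

P-A-∷ʳ : (w : Word k) (x : Letter k) → P-A (w ∷ʳ x) ≡ insA x (P-A w)
P-A-∷ʳ w x = foldl-∷ʳ (λ T x → insA x T) [] x w

bounded-weaken : ∀ {n} → Bounded (suc n) T → Bounded n T
bounded-weaken [] = []
bounded-weaken {n = n} (l ∷ bT) = All.map (ℕₚ.≤-trans (ℕₚ.*-monoʳ-≤ 2 (ℕₚ.n≤1+n n))) l ∷ bounded-weaken bT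

kingColumn-join : ∀ {n i} (u : Word k) {v : Word k} → KingColumn n u → KingColumn (suc i) v → n + length u ≡ i → KingColumn n (u ++ v)
kingColumn-join [] _ kv e rewrite trans (sym (ℕₚ.+-identityʳ _)) e = bounded-weaken kv
kingColumn-join (x ∷ u) (l ∷ ku) kv e = l ∷ kingColumn-join u ku kv (trans (sym (ℕₚ.+-suc _ _)) e)

¬kingColumn : ∀ {n} (u : Word k) {i : Fin k} {v : Word k} → n + length u ≡ toℕ i → ¬ KingColumn n (u ++ plain i ∷ bar i ∷ v)
¬kingColumn [] e (_ ∷ (l ∷ []) ∷ _) rewrite trans (sym (ℕₚ.+-identityʳ _)) e = ℕₚ.<⇒≱ (bar-< _) l
¬kingColumn (x ∷ u) e (_ ∷ ku) = ¬kingColumn u (trans (sym (ℕₚ.+-suc _ _)) e) ku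

kingColumn? : ∀ n (c : Word k) → Dec (KingColumn n c)
kingColumn? n [] = yes []
kingColumn? n (x ∷ c) with 2 * n ℕ.≤? rank x | kingColumn? (suc n) c
... | yes l | yes kc = yes ((l ∷ []) ∷ kc)
... | yes _ | no ¬kc = no λ { (_ ∷ kc) → ¬kc kc }
... | no ¬l | _      = no λ { ((l ∷ []) ∷ _) → ¬l l }

bounded-from-heads : ∀ {n} → All NonEmpty T → Tab T → KingColumn n (heads T) → Bounded n T
bounded-from-heads [] [] [] = []
bounded-from-heads (nonEmpty ∷ nT) (tab (x≤r ∷ _) _ tT) ((l ∷ []) ∷ kT) = (l ∷ All.map (ℕₚ.≤-trans l) x≤r) ∷ bounded-from-heads nT tT kT

column-unique : Ascending c → {K : Filling k} → All NonEmpty K → Tab K → row K ≡A reverse c → K ≡ column c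
column-unique {c = c} ac {K} nK tK e = trans (sym (P-A-row nK tK))
  (P-A-unique (column-NonEmpty c) (tab-column ac) (≡A-trans e (≡⇒≡A (sym (row-column c)))))

-- `similar` holds under any `pre` because the recursion inserts further letters on top, and beside
-- any `zs` because reductions are later compared within pairs of columns.
record Reduct {k} (c : Word k) : Set₁ where
  field
    reduced   : Word k
    P-C≡      : P-C (reverse c) ≡ column reduced
    ascending : Ascending reduced
    king-red  : KingColumn 0 reduced
    keeps     : {P : Letter k → Set} → All P c → All P reduced
    shrinks   : length reduced ℕ.< length c ⊎ reduced ≡ c
    similar   : ∀ pre zs → Ascending zs → Ascending (pre ++ c) → (pre ++ c , zs) ≈ (pre ++ reduced , zs)

  front : ∀ v → P-C (reverse c ++ v) ≡ foldl _←C_ (column reduced) v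
  front v = trans (P-C-++ (reverse c) v) (cong (λ T → foldl _←C_ T v) P-C≡)

ascending-replace : (pre : Word k) {c c₀ : Word k} → ({P : Letter k → Set} → All P c → All P c₀) → Ascending c₀ → Ascending (pre ++ c) → Ascending (pre ++ c₀)
ascending-replace []        keeps ac₀ _ = ac₀
ascending-replace (x ∷ pre) keeps ac₀ (l ∷ a) = Allₚ.++⁺ (Allₚ.++⁻ˡ pre l) (keeps (Allₚ.++⁻ʳ pre l)) ∷ ascending-replace pre keeps ac₀ a

-- The smallest letter is inserted last, into the reduct of the others. Smaller than all of them, it
-- pushes the whole column down, and at most one pair is cancelled on the way.
reduct : Ascending c → Reduct c
reduct [] = record
  { reduced = [] ; P-C≡ = refl ; ascending = [] ; king-red = [] ; keeps = λ p → p ; shrinks = inj₂ refl ; similar = λ _ _ _ _ → ≈-refl }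
reduct {c = x ∷ c} (x<c ∷ ac) = go (outcome 0 (king (column-NonEmpty R.reduced) (tab-column R.ascending) R.king-red) z≤n)
  where
  module R = Reduct (reduct ac)
  x<c₀ : All (x <_) R.reduced
  x<c₀ = R.keeps x<c
  insA≡ : insA x (column R.reduced) ≡ column (x ∷ R.reduced)
  insA≡ = insA-column x<c₀ R.ascending
  P-C-step : P-C (reverse (x ∷ c)) ≡ insertAt 0 x (column R.reduced)
  P-C-step = trans (cong P-C (unfold-reverse x c)) (trans (P-C-∷ʳ (reverse c) x) (cong (_←C x) R.P-C≡))
  similar′ : ∀ pre zs → Ascending zs → Ascending (pre ++ x ∷ c) → (pre ++ x ∷ c , zs) ≈ (pre ++ x ∷ R.reduced , zs)
  similar′ pre zs az ap = subst₂ (λ u v → (u , zs) ≈ (v , zs)) (++-assoc pre [ x ] c) (++-assoc pre [ x ] R.reduced)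
    (R.similar (pre ∷ʳ x) zs az (subst Ascending (sym (++-assoc pre [ x ] c)) ap))
  shrinks′ : length R.reduced ℕ.≤ length c
  shrinks′ with R.shrinks
  ... | inj₁ l = ℕₚ.<⇒≤ l
  ... | inj₂ e = ℕₚ.≤-reflexive (cong length e)
  go : Outcome 0 x (column R.reduced) → Reduct (x ∷ c)
  go (ordinary e bd) = record
    { reduced = x ∷ R.reduced ; P-C≡ = trans P-C-step (trans e insA≡) ; ascending = x<c₀ ∷ R.ascending
    ; king-red = subst (Bounded 0) insA≡ bd ; keeps = λ { (p ∷ ps) → p ∷ R.keeps ps }
    ; shrinks = shrinks-cons R.shrinks
    ; similar = similar′ }
    where
    shrinks-cons : length R.reduced ℕ.< length c ⊎ R.reduced ≡ c → length (x ∷ R.reduced) ℕ.< length (x ∷ c) ⊎ x ∷ R.reduced ≡ x ∷ c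
    shrinks-cons (inj₁ l) = inj₁ (s≤s l)
    shrinks-cons (inj₂ e) = inj₂ (cong (x ∷_) e)
  go (exceptional exc) = record
    { reduced = X.upper ++ X.lower
    ; P-C≡ = trans P-C-step (column-unique ascending′ (King.filled X.result) (King.tableau X.result)
        (≡A-trans X.word (≡⇒≡A (trans (cong (λ S → reverse (X.upper ++ X.lower) ++ row (tails S)) insA≡)
          (trans (cong (reverse (X.upper ++ X.lower) ++_) (row-tails-column (x ∷ R.reduced))) (++-identityʳ _))))))
    ; ascending = ascending′
    ; king-red = kingColumn-join X.upper X.upper-King X.lower-King X.index
    ; keeps = λ { (p ∷ ps) → keeps′ (subst (All _) split (p ∷ R.keeps ps)) }
    ; shrinks = inj₁ shorter
    ; similar = λ pre zs az ap → ≈-trans (similar′ pre zs az ap) (similar″ pre zs az (ascending-replace pre (λ { (p ∷ ps) → p ∷ R.keeps ps }) (x<c₀ ∷ R.ascending) ap)) }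
    where
    module X = Exception exc
    split : x ∷ R.reduced ≡ X.upper ++ plain X.letter ∷ bar X.letter ∷ X.lower
    split = trans (sym (heads-column (x ∷ R.reduced))) (trans (cong heads (sym insA≡)) X.heads-split)
    ascending′ : Ascending (X.upper ++ X.lower)
    ascending′ = ascending-erase X.upper {plain X.letter ∷ bar X.letter ∷ []} (subst Ascending split (x<c₀ ∷ R.ascending))
    keeps′ : {P : Letter _ → Set} → All P (X.upper ++ plain X.letter ∷ bar X.letter ∷ X.lower) → All P (X.upper ++ X.lower)
    keeps′ ps with _ ∷ _ ∷ pl ← Allₚ.++⁻ʳ X.upper ps = Allₚ.++⁺ (Allₚ.++⁻ˡ X.upper ps) pl
    shorter : length (X.upper ++ X.lower) ℕ.< suc (length c)
    shorter = ℕₚ.<-≤-trans (subst₂ ℕ._<_ (sym (length-++ X.upper)) (sym (trans (cong length split) (length-++ X.upper)))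
      (ℕₚ.+-monoʳ-< (length X.upper) (ℕₚ.m<n⇒m<1+n (ℕₚ.n<1+n _)))) (s≤s shrinks′)
    similar″ : ∀ pre zs → Ascending zs → Ascending (pre ++ x ∷ R.reduced) → (pre ++ x ∷ R.reduced , zs) ≈ (pre ++ X.upper ++ X.lower , zs)
    similar″ pre zs az ap = subst₂ (λ u v → (u , zs) ≈ (v , zs)) (sym whole) (++-assoc pre X.upper X.lower)
      (erase-≈ pre X.upper X.lower zs X.letter az (subst Ascending whole ap) X.index X.upper-King X.lower-King)
      where
      whole : pre ++ x ∷ R.reduced ≡ (pre ++ X.upper) ++ plain X.letter ∷ bar X.letter ∷ X.lower
      whole = trans (cong (pre ++_) split) (sym (++-assoc pre X.upper _))

single : Ascending c → KingColumn 0 c → KingPair c []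
single ac kc = record { ascending-c = ac ; ascending-z = [] ; rect = [] ; king-c = kc }

-- A King column forms a King pair with the empty column, so the uniqueness of King pairs applies.
reduct-unique : (ac : Ascending c) {c₁ : Word k} → Ascending c₁ → KingColumn 0 c₁ → (c , []) ≈ (c₁ , []) → Reduct.reduced (reduct ac) ≡ c₁
reduct-unique ac ac₁ kc₁ e = proj₁ (kingPair-unique (single R.ascending R.king-red) (single ac₁ kc₁) (≈-trans (≈-sym (R.similar [] [] [] ac)) e))
  where module R = Reduct (reduct ac)

P-C-king-column : Ascending c → KingColumn 0 c → P-C (reverse c) ≡ column c
P-C-king-column ac kc = trans (Reduct.P-C≡ (reduct ac)) (cong column (reduct-unique ac ac kc ≈-refl))

reduct-shorter : (ac : Ascending c) → ¬ KingColumn 0 c → length (Reduct.reduced (reduct ac)) ℕ.< length c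
reduct-shorter ac ¬kc with Reduct.shrinks (reduct ac)
... | inj₁ l = l
... | inj₂ e = contradiction (subst (KingColumn 0) e (Reduct.king-red (reduct ac))) ¬kc

-- A King column is its own insertion tableau, so the words of `c` and of its reduct lead to the
-- same tableau before `v` is read.
front-reduced : (ac : Ascending c) (v : Word k) → P-C (reverse c ++ v) ≡ P-C (reverse (Reduct.reduced (reduct ac)) ++ v)
front-reduced ac v = trans (R.front v) (sym (trans (P-C-++ (reverse R.reduced) v) (cong (λ T → foldl _←C_ T v) (P-C-king-column R.ascending R.king-red))))
  where module R = Reduct (reduct ac)

-- Without the new letter the letters below it move up, where the bound is weaker. Contrapositively,
-- a slide cannot repair a column that violates the bound, so this column can still be reduced.
kingColumn-Step : ∀ {n z d⁺ z⁻ α} → Step d z d⁺ z⁻ α → KingColumn n d⁺ → KingColumn n d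
kingColumn-Step (skip _ s)  kd       = kingColumn-Step s kd
kingColumn-Step (take _ _)  (_ ∷ kd) = bounded-weaken kd
kingColumn-Step (match _ s) (l ∷ kd) = l ∷ kingColumn-Step s kd

Ins-All⁻ : ∀ {n} → Ins x r r′ o → All (λ a → n ℕ.≤ rank a) r′ → All (λ a → n ℕ.≤ rank a) r
Ins-All⁻ end        _        = []
Ins-All⁻ (hit x<a)  (l ∷ ls) = ℕₚ.≤-trans l (ℕₚ.<⇒≤ x<a) ∷ ls
Ins-All⁻ (pass _ i) (l ∷ ls) = l ∷ Ins-All⁻ i ls

-- Insertion never increases the entry of an existing box. Hence a word whose Schensted tableau is
-- not King cannot be extended to one whose tableau is.
bounded-insA⁻ : ∀ {n} (x : Letter k) (T : Filling k) → Bounded n (insA x T) → Bounded n T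
bounded-insA⁻ x [] _ = []
bounded-insA⁻ x (r ∷ T) b with bumped x r | ins x r
bounded-insA⁻ x (r ∷ T) (l ∷ b) | nothing | i = Ins-All⁻ i l ∷ b
bounded-insA⁻ x (r ∷ T) (l ∷ b) | just y  | i = Ins-All⁻ i l ∷ bounded-insA⁻ y T b

-- Knuth invariance of Berele insertion

⇝-length : v ⇝ w → length v ≡ length w
⇝-length (yxz u v _ _) = trans (length-++ u) (sym (length-++ u))
⇝-length (xzy u v _ _) = trans (length-++ u) (sym (length-++ u))

≡A-length : v ≡A w → length v ≡ length w
≡A-length = Eq.gfold Eqₚ.isEquivalence length ⇝-length

-- Both cases depend on P-A w only, so that Knuth invariance of P-C follows.
record Claim {k} (w : Word k) : Set where
  field
    king-case  : Bounded 0 (P-A w) → P-C w ≡ P-A w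
    other-case : ¬ KingColumn 0 (heads (P-A w)) → P-C w ≡ P-C (reverse (heads (P-A w)) ++ row (tails (P-A w)))

bounded-P-A : (w : Word k) → KingColumn 0 (heads (P-A w)) → Bounded 0 (P-A w)
bounded-P-A w = bounded-from-heads (P-A-NonEmpty w) (P-A-Tab w)

decompose : (w : Word k) → w ≡A reverse (heads (P-A w)) ++ row (tails (P-A w))
decompose w = ≡A-trans (row-P-A w) (row-heads-tails (P-A-NonEmpty w) (P-A-Tab w))

heads-P-A-Ascending : (w : Word k) → Ascending (heads (P-A w))
heads-P-A-Ascending w = heads-Ascending (P-A-NonEmpty w) (P-A-Tab w)

length-∷ʳ : (w : Word k) (x : Letter k) → length (w ∷ʳ x) ≡ suc (length w)
length-∷ʳ w x = trans (length-++ w) (ℕₚ.+-comm (length w) 1)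

length-reverse-++ : (c v : Word k) → length (reverse c ++ v) ≡ length c + length v
length-reverse-++ c v = trans (length-++ (reverse c)) (cong (_+ length v) (length-reverse c))

record NormalForm {k} (d z : Word k) : Set where
  field
    first second : Word k
    kingPair     : KingPair first second
    similar      : (d , z) ≈ (first , second)
    P-C≡         : P-C (reverse d ++ reverse z) ≡ glue first (column second)

module Induction {k} (n : ℕ) (claim< : (w : Word k) → length w ℕ.< n → Claim w) where

  invariant : {w w′ : Word k} → length w ℕ.< n → w ≡A w′ → P-C w ≡ P-C w′
  invariant {w} {w′} l e with kingColumn? 0 (heads (P-A w))
  ... | yes kh = trans (Claim.king-case (claim< w l) bw) (trans (P-A-≡A e) (sym (Claim.king-case (claim< w′ l′) (subst (Bounded 0) (P-A-≡A e) bw))))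
    where
    l′ = subst (ℕ._< n) (≡A-length e) l
    bw : Bounded 0 (P-A w)
    bw = bounded-P-A w kh
  ... | no ¬kh = trans (Claim.other-case (claim< w l) ¬kh) (trans (cong (λ S → P-C (reverse (heads S) ++ row (tails S))) (P-A-≡A e))
                   (sym (Claim.other-case (claim< w′ l′) (subst (λ S → ¬ KingColumn 0 (heads S)) (P-A-≡A e) ¬kh))))
    where l′ = subst (ℕ._< n) (≡A-length e) l

  module _ {d : Word k} (ad : Ascending d) where
    private
      d₀ : Word k
      d₀ = Reduct.reduced (reduct ad)

    front-≡A : ¬ KingColumn 0 d → {v v′ : Word k} → length d + length v ℕ.≤ n → v ≡A v′ → P-C (reverse d ++ v) ≡ P-C (reverse d ++ v′)
    front-≡A ¬kd {v} {v′} l e = trans (front-reduced ad v) (trans (invariant below-n (++ˡ (reverse d₀) e)) (sym (front-reduced ad v′)))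
      where
      below-n : length (reverse d₀ ++ v) ℕ.< n
      below-n = ℕₚ.<-≤-trans (subst (ℕ._< length d + length v) (sym (length-reverse-++ d₀ v)) (ℕₚ.+-monoˡ-< (length v) (reduct-shorter ad ¬kd))) l

  -- `m` bounds the length of `d` plus twice the length of `z`, which falls with every slide and
  -- with every reduction of `d`. The words stay shorter than `n`, so slides preserve `P-C` by the
  -- induction hypothesis.
  normalForm : ∀ m {d z : Word k} → Ascending d → Ascending z → length d + length z ℕ.< n → length d + (length z + length z) ℕ.< m → NormalForm d z
  normalForm (suc m) {d} {z} ad az l (s≤s lm) with rect-or-step ad az
  ... | inj₂ (d⁺ , z⁻ , α , s) = record
    { first = N.first ; second = N.second ; kingPair = N.kingPair
    ; similar = ≈-trans (step-≈ s ad az) N.similar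
    ; P-C≡ = trans (invariant (subst (ℕ._< n) (sym (trans (length-reverse-++ d (reverse z)) (cong (λ j → length d + j) (length-reverse z)))) l) (Step-≡A s ad az)) N.P-C≡ }
    where
    total : length d⁺ + length z⁻ ≡ length d + length z
    total rewrite Step-length⁺ s | sym (Step-length⁻ s) = sym (ℕₚ.+-suc (length d) (length z⁻))
    smaller : suc (length d⁺ + (length z⁻ + length z⁻)) ≡ length d + (length z + length z)
    smaller rewrite Step-length⁺ s | sym (Step-length⁻ s) = eq (length d) (length z⁻)
      where
      eq : ∀ a b → suc (suc a + (b + b)) ≡ a + (suc b + suc b)
      eq = solveℕ
    module N = NormalForm (normalForm m (Step-Ascending⁺ s ad az) (Step-Ascending⁻ s az) (subst (ℕ._< n) (sym total) l) (subst (ℕ._≤ m) (sym smaller) lm))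
  ... | inj₁ rect with kingColumn? 0 d
  ...   | yes kd = record
    { first = d ; second = z
    ; kingPair = record { ascending-c = ad ; ascending-z = az ; rect = rect ; king-c = kd }
    ; similar = ≈-refl
    ; P-C≡ = trans (Claim.king-case (claim< dz (subst (ℕ._< n) (sym (trans (length-reverse-++ d (reverse z)) (cong (λ j → length d + j) (length-reverse z)))) l))
                     (subst (Bounded 0) (sym P≡) (bounded-from-heads nG tG (subst (KingColumn 0) (sym (heads-glue (column-NonEmpty z) rect′)) kd)))) P≡ }
    where
    dz : Word k
    dz = reverse d ++ reverse z
    rect′ : Rect d (heads (column z))
    rect′ = subst (Rect d) (sym (heads-column z)) rect
    nG : All NonEmpty (glue d (column z))
    nG = glue-NonEmpty (column-NonEmpty z)
    tG : Tab (glue d (column z))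
    tG = tab-glue ad (column-NonEmpty z) (tab-column az) rect′
    P≡ : P-A dz ≡ glue d (column z)
    P≡ = P-A-unique nG tG (≡A-sym (≡A-trans (row-glue ad (column-NonEmpty z) (tab-column az) rect′) (≡⇒≡A (cong (reverse d ++_) (row-column z)))))
  ...   | no ¬kd = record
    { first = N.first ; second = N.second ; kingPair = N.kingPair
    ; similar = ≈-trans (R.similar [] z az ad) N.similar
    ; P-C≡ = trans (front-reduced ad (reverse z)) N.P-C≡ }
    where
    module R = Reduct (reduct ad)
    shorter : length R.reduced ℕ.< length d
    shorter = reduct-shorter ad ¬kd
    module N = NormalForm (normalForm m R.ascending az (ℕₚ.<-trans (ℕₚ.+-monoˡ-< (length z) shorter) l) (ℕₚ.<-≤-trans (ℕₚ.+-monoˡ-< (length z + length z) shorter) lm))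

  -- The two words may have length `n`, out of reach of `invariant`. But neither first column is
  -- King, so both words reduce to shorter ones, whose normal forms are King pairs with the same
  -- invariants and therefore coincide.
  step-P-C : {d z d⁺ z⁻ : Word k} {α : Letter k} → Step d z d⁺ z⁻ α → Ascending d → Ascending z → ¬ KingColumn 0 d → length d + length z ℕ.≤ n →
             P-C (reverse d ++ reverse z) ≡ P-C (reverse d⁺ ++ reverse z⁻)
  step-P-C {d} {z} {d⁺} {z⁻} s ad az ¬kd l = begin
    P-C (reverse d ++ reverse z)                 ≡⟨ front-reduced ad (reverse z) ⟩
    P-C (reverse R.reduced ++ reverse z)         ≡⟨ N.P-C≡ ⟩
    glue N.first (column N.second)               ≡⟨ cong₂ (λ c e → glue c (column e)) (proj₁ unique) (proj₂ unique) ⟩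
    glue N⁺.first (column N⁺.second)             ≡⟨ N⁺.P-C≡ ⟨
    P-C (reverse R⁺.reduced ++ reverse z⁻)       ≡⟨ front-reduced ad⁺ (reverse z⁻) ⟨
    P-C (reverse d⁺ ++ reverse z⁻)               ∎
    where
    open ≡-Reasoning
    ad⁺ : Ascending d⁺
    ad⁺ = Step-Ascending⁺ s ad az
    az⁻ : Ascending z⁻
    az⁻ = Step-Ascending⁻ s az
    module R = Reduct (reduct ad)
    module R⁺ = Reduct (reduct ad⁺)
    total : length d⁺ + length z⁻ ≡ length d + length z
    total rewrite Step-length⁺ s | sym (Step-length⁻ s) = sym (ℕₚ.+-suc (length d) (length z⁻))
    module N = NormalForm (normalForm _ R.ascending az (ℕₚ.<-≤-trans (ℕₚ.+-monoˡ-< (length z) (reduct-shorter ad ¬kd)) l) ℕₚ.≤-refl)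
    module N⁺ = NormalForm (normalForm _ R⁺.ascending az⁻
      (ℕₚ.<-≤-trans (ℕₚ.+-monoˡ-< (length z⁻) (reduct-shorter ad⁺ (λ kd⁺ → ¬kd (kingColumn-Step s kd⁺)))) (subst (ℕ._≤ n) (sym total) l)) ℕₚ.≤-refl)
    unique : N.first ≡ N⁺.first × N.second ≡ N⁺.second
    unique = kingPair-unique N.kingPair N⁺.kingPair
      (≈-trans (≈-sym N.similar) (≈-trans (≈-sym (R.similar [] z az ad)) (≈-trans (step-≈ s ad az) (≈-trans (R⁺.similar [] z⁻ az⁻ ad⁺) N⁺.similar))))

  -- First `v` is replaced by the word of its Schensted tableau, so that a slide concerns only `d`
  -- and the first column `Z`; the letters of `V` are inserted afterwards in both words alike. Every
  -- slide takes a letter from `v`, which `m` counts, and the process ends when `d` fits beside the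
  -- tableau of `v`.
  rectify : ∀ m {d v : Word k} → Ascending d → ¬ KingColumn 0 d → length d + length v ℕ.≤ n → length v ℕ.< m →
            let S = P-A (reverse d ++ v) in P-C (reverse d ++ v) ≡ P-C (reverse (heads S) ++ row (tails S))
  rectify (suc m) {d} {v} ad ¬kd l (s≤s lm) with rect-or-step ad (heads-P-A-Ascending v)
  ... | inj₁ rect = trans (front-≡A ad ¬kd l (row-P-A v)) (cong P-C (sym (cong₂ (λ u w → reverse u ++ w)
                      (trans (cong heads P≡) (heads-glue nZ rect)) (trans (cong (λ S → row (tails S)) P≡) (row-tails-glue nZ rect)))))
    where
    nZ : All NonEmpty (P-A v)
    nZ = P-A-NonEmpty v
    P≡ : P-A (reverse d ++ v) ≡ glue d (P-A v)
    P≡ = P-A-unique (glue-NonEmpty nZ) (tab-glue ad nZ (P-A-Tab v) rect)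
      (≡A-trans (++ˡ (reverse d) (row-P-A v)) (≡A-sym (row-glue ad nZ (P-A-Tab v) rect)))
  ... | inj₂ (d⁺ , z⁻ , α , s) = begin
    P-C (reverse d ++ v)                                  ≡⟨ front-≡A ad ¬kd l (decompose v) ⟩
    P-C (reverse d ++ reverse Z ++ V)                     ≡⟨ cong P-C (++-assoc (reverse d) (reverse Z) V) ⟨
    P-C ((reverse d ++ reverse Z) ++ V)                   ≡⟨ P-C-++ (reverse d ++ reverse Z) V ⟩
    foldl _←C_ (P-C (reverse d ++ reverse Z)) V           ≡⟨ cong (λ T → foldl _←C_ T V) (step-P-C s ad az ¬kd (ℕₚ.≤-trans (ℕₚ.+-monoʳ-≤ (length d) Z≤v) l)) ⟩
    foldl _←C_ (P-C (reverse d⁺ ++ reverse z⁻)) V         ≡⟨ P-C-++ (reverse d⁺ ++ reverse z⁻) V ⟨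
    P-C ((reverse d⁺ ++ reverse z⁻) ++ V)                 ≡⟨ cong P-C (++-assoc (reverse d⁺) (reverse z⁻) V) ⟩
    P-C (reverse d⁺ ++ reverse z⁻ ++ V)                   ≡⟨ rectify m (Step-Ascending⁺ s ad az) (λ kd⁺ → ¬kd (kingColumn-Step s kd⁺)) (subst (ℕ._≤ n) (sym total) l) (subst (ℕ._≤ m) (sym shorter) lm) ⟩
    P-C (reverse (heads (P-A w⁺)) ++ row (tails (P-A w⁺))) ≡⟨ cong (λ S → P-C (reverse (heads S) ++ row (tails S))) (P-A-≡A w⁺≡) ⟩
    P-C (reverse (heads (P-A (reverse d ++ v))) ++ row (tails (P-A (reverse d ++ v)))) ∎
    where
    open ≡-Reasoning
    Z V w⁺ : Word k
    Z = heads (P-A v)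
    V = row (tails (P-A v))
    w⁺ = reverse d⁺ ++ reverse z⁻ ++ V
    az : Ascending Z
    az = heads-P-A-Ascending v
    length-v : length v ≡ length Z + length V
    length-v = trans (≡A-length (decompose v)) (length-reverse-++ Z V)
    Z≤v : length Z ℕ.≤ length v
    Z≤v = subst (length Z ℕ.≤_) (sym length-v) (ℕₚ.m≤m+n (length Z) (length V))
    shorter : suc (length (reverse z⁻ ++ V)) ≡ length v
    shorter = trans (cong suc (length-reverse-++ z⁻ V)) (trans (cong (_+ length V) (Step-length⁻ s)) (sym length-v))
    total : length d⁺ + length (reverse z⁻ ++ V) ≡ length d + length v
    total rewrite Step-length⁺ s = trans (sym (ℕₚ.+-suc (length d) _)) (cong (λ j → length d + j) shorter)
    w⁺≡ : w⁺ ≡A reverse d ++ v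
    w⁺≡ = ≡A-trans (≡⇒≡A (sym (++-assoc (reverse d⁺) (reverse z⁻) V)))
      (≡A-trans (++ʳ V (≡A-sym (Step-≡A s ad az)))
      (≡A-trans (≡⇒≡A (++-assoc (reverse d) (reverse Z) V)) (++ˡ (reverse d) (≡A-sym (decompose v)))))

  claim-∷ʳ : (w : Word k) (x : Letter k) → length (w ∷ʳ x) ℕ.≤ n → Claim (w ∷ʳ x)
  claim-∷ʳ w x l with kingColumn? 0 (heads (P-A w))
  ... | no ¬kd = record
    { king-case = λ b → contradiction (bounded-heads (P-A-NonEmpty w) (bounded-insA⁻ x (P-A w) (subst (Bounded 0) (P-A-∷ʳ w x) b))) ¬kd
    ; other-case = λ _ → begin
        P-C (w ∷ʳ x)                     ≡⟨ P-C-∷ʳ w x ⟩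
        P-C w ←C x                       ≡⟨ cong (_←C x) (Claim.other-case (claim< w lw) ¬kd) ⟩
        P-C (reverse D ++ U) ←C x        ≡⟨ P-C-∷ʳ (reverse D ++ U) x ⟨
        P-C ((reverse D ++ U) ∷ʳ x)      ≡⟨ cong P-C (++-assoc (reverse D) U [ x ]) ⟩
        P-C (reverse D ++ U ∷ʳ x)        ≡⟨ rectify _ (heads-P-A-Ascending w) ¬kd (subst (ℕ._≤ n) total l) ℕₚ.≤-refl ⟩
        _                                ≡⟨ cong (λ S → P-C (reverse (heads S) ++ row (tails S))) (P-A-≡A (≡A-sym w≡)) ⟩
        _                                ∎ }
    where
    open ≡-Reasoning
    D U : Word k
    D = heads (P-A w)
    U = row (tails (P-A w))
    lw : length w ℕ.< n
    lw = subst (ℕ._≤ n) (length-∷ʳ w x) l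
    w≡ : w ∷ʳ x ≡A reverse D ++ U ∷ʳ x
    w≡ = ≡A-trans (++ʳ [ x ] (decompose w)) (≡⇒≡A (++-assoc (reverse D) U [ x ]))
    total : length (w ∷ʳ x) ≡ length D + length (U ∷ʳ x)
    total = trans (≡A-length w≡) (length-reverse-++ D (U ∷ʳ x))
  ... | yes kd = go (outcome 0 (king (P-A-NonEmpty w) (P-A-Tab w) bw) z≤n)
    where
    bw : Bounded 0 (P-A w)
    bw = bounded-P-A w kd
    P-C≡ : P-C (w ∷ʳ x) ≡ insertAt 0 x (P-A w)
    P-C≡ = trans (P-C-∷ʳ w x) (cong (_←C x) (Claim.king-case (claim< w (subst (ℕ._≤ n) (length-∷ʳ w x) l)) bw))
    S≡ : P-A (w ∷ʳ x) ≡ insA x (P-A w)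
    S≡ = P-A-∷ʳ w x
    go : Outcome 0 x (P-A w) → Claim (w ∷ʳ x)
    go (ordinary e bd) = record
      { king-case = λ _ → trans P-C≡ (trans e (sym S≡))
      ; other-case = λ ¬kh → contradiction (bounded-heads (P-A-NonEmpty (w ∷ʳ x)) (subst (Bounded 0) (sym S≡) bd)) ¬kh }
    go (exceptional exc) = record
      { king-case = λ b → contradiction (subst (KingColumn 0) split (bounded-heads (P-A-NonEmpty (w ∷ʳ x)) b)) (¬kingColumn X.upper X.index)
      -- Erasing the pair from `heads S` gives a King column with the same invariants, hence the
      -- reduct. The word `reverse c₁ ++ U` is shorter and its Schensted tableau is the King tableau
      -- `K`, so the claim for shorter words applies.
      ; other-case = λ _ → begin
          P-C (w ∷ʳ x)                           ≡⟨ P-C≡ ⟩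
          K                                      ≡⟨ P≡ ⟨
          P-A (reverse c₁ ++ U)                  ≡⟨ Claim.king-case (claim< (reverse c₁ ++ U) below-n) (subst (Bounded 0) (sym P≡) (King.bounded X.result)) ⟨
          P-C (reverse c₁ ++ U)                  ≡⟨ cong (λ c → P-C (reverse c ++ U)) (reduct-unique ah ac₁ kc₁ erased) ⟨
          P-C (reverse (Reduct.reduced (reduct ah)) ++ U) ≡⟨ front-reduced ah U ⟨
          P-C (reverse (heads S) ++ U)           ∎ }
      where
      open ≡-Reasoning
      module X = Exception exc
      K S : Filling k
      K = insertAt 0 x (P-A w)
      S = P-A (w ∷ʳ x)
      c₁ U : Word k
      c₁ = X.upper ++ X.lower
      U = row (tails S)
      split : heads S ≡ X.upper ++ plain X.letter ∷ bar X.letter ∷ X.lower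
      split = trans (cong heads S≡) X.heads-split
      ah : Ascending (heads S)
      ah = heads-P-A-Ascending (w ∷ʳ x)
      ac₁ : Ascending c₁
      ac₁ = ascending-erase X.upper {plain X.letter ∷ bar X.letter ∷ []} (subst Ascending split ah)
      kc₁ : KingColumn 0 c₁
      kc₁ = kingColumn-join X.upper X.upper-King X.lower-King X.index
      erased : (heads S , []) ≈ (c₁ , [])
      erased = subst (λ c → (c , []) ≈ (c₁ , [])) (sym split)
        (erase-≈ [] X.upper X.lower [] X.letter [] (subst Ascending split ah) X.index X.upper-King X.lower-King)
      P≡ : P-A (reverse c₁ ++ U) ≡ K
      P≡ = P-A-unique (King.filled X.result) (King.tableau X.result)
        (≡A-sym (subst (λ S → row K ≡A reverse c₁ ++ row (tails S)) (sym S≡) X.word))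
      below-n : length (reverse c₁ ++ U) ℕ.< n
      below-n = ℕₚ.<-≤-trans (subst₂ ℕ._<_ (sym (length-reverse-++ c₁ U)) (sym (trans (≡A-length (decompose (w ∷ʳ x))) (length-reverse-++ (heads S) U)))
        (ℕₚ.+-monoˡ-< (length U) (subst₂ ℕ._<_ (sym (length-++ X.upper)) (sym (trans (cong length split) (length-++ X.upper)))
          (ℕₚ.+-monoʳ-< (length X.upper) (ℕₚ.m<n⇒m<1+n (ℕₚ.n<1+n _)))))) l

claim-[] : Claim {k} []
claim-[] = record { king-case = λ _ → refl ; other-case = λ ¬k → contradiction [] ¬k }

claim< : ∀ n (w : Word k) → length w ℕ.< n → Claim w
claim< (suc n) w (s≤s l) with initLast w
... | []       = claim-[]
... | w′ ∷ʳ′ x = Induction.claim-∷ʳ n (claim< n) w′ x l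

claim : (w : Word k) → Claim w
claim w = claim< (suc (length w)) w ℕₚ.≤-refl

P-C-≡A : v ≡A w → P-C v ≡ P-C w
P-C-≡A {v = v} e = Induction.invariant (suc (length v)) (claim< (suc (length v))) ℕₚ.≤-refl e

-- King tableaux

IsKing⇒King : {T : Filling k} → IsKing T → King 0 T
IsKing⇒King {k} {T} isK = king (filled T positive) (tableau T (IsKing.rows isK) (IsKing.columns isK)) (bounded 0 T (IsKing.bounded isK))
  where
  open IsPartition (IsKing.partition isK) using (positive)
  filled : (T : Filling k) → All (ℕ._> 0) (shape T) → All NonEmpty T
  filled []            []         = []
  filled ((_ ∷ _) ∷ T) (_ ∷ ps)   = nonEmpty ∷ filled T ps
  tableau : (T : Filling k) → All (Linked _≤_) T → Linked (λ upper lower → Prefix _>_ lower upper) T → Tab T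
  tableau []           _        _        = []
  tableau (r ∷ [])     (l ∷ []) _        = tab (Linkedₚ.Linked⇒AllPairs ℕₚ.≤-trans l) [] []
  tableau (r ∷ T@(_ ∷ _)) (l ∷ ls) (ab ∷ cs) = tab (Linkedₚ.Linked⇒AllPairs ℕₚ.≤-trans l) ab (tableau T ls cs)
  bounded : ∀ n (T : Filling k) → (∀ (j : Fin (length T)) → All (λ x → 2 * (n + toℕ j) ℕ.≤ rank x) (lookup T j)) → Bounded n T
  bounded n []      _ = []
  bounded n (r ∷ T) b = subst (λ m → All (λ x → 2 * m ℕ.≤ rank x) r) (ℕₚ.+-identityʳ n) (b Fin.zero)
    ∷ bounded (suc n) T (λ j → subst (λ m → All (λ x → 2 * m ℕ.≤ rank x) (lookup T j)) (ℕₚ.+-suc n (toℕ j)) (b (Fin.suc j)))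

King⇒IsKing : {T : Filling k} → King 0 T → IsKing T
King⇒IsKing {k} {T} (king nT tT bT) = record
  { partition = record { decreasing = Linkedₚ.map⁺ (Linked.map Prefixₚ.length-mono (columns T tT)) ; positive = positive T nT }
  ; rows = rows T tT
  ; columns = columns T tT
  ; bounded = bounded 0 T bT }
  where
  positive : (T : Filling k) → All NonEmpty T → All (ℕ._> 0) (shape T)
  positive []      []              = []
  positive (_ ∷ T) (nonEmpty ∷ nT) = s≤s z≤n ∷ positive T nT
  columns : (T : Filling k) → Tab T → Linked (λ upper lower → Prefix _>_ lower upper) T
  columns []          _                            = []
  columns (r ∷ [])    _                            = [-]
  columns (r ∷ T@(_ ∷ _)) (tab _ ab tT)            = ab ∷ columns T tT
  rows : (T : Filling k) → Tab T → All (Linked _≤_) T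
  rows []      _             = []
  rows (r ∷ T) (tab sr _ tT) = Linkedₚ.AllPairs⇒Linked sr ∷ rows T tT
  bounded : ∀ n (T : Filling k) → Bounded n T → (j : Fin (length T)) → All (λ x → 2 * (n + toℕ j) ℕ.≤ rank x) (lookup T j)
  bounded n (r ∷ T) (l ∷ b) Fin.zero    = subst (λ m → All (λ x → 2 * m ℕ.≤ rank x) r) (sym (ℕₚ.+-identityʳ n)) l
  bounded n (r ∷ T) (l ∷ b) (Fin.suc j) = subst (λ m → All (λ x → 2 * m ℕ.≤ rank x) (lookup T j)) (sym (ℕₚ.+-suc n (toℕ j))) (bounded (suc n) T b j)

P-C-row : King 0 T → P-C (row T) ≡ T
P-C-row {T = T} (king nT tT bT) = trans (Claim.king-case (claim (row T)) (subst (Bounded 0) (sym P≡) bT)) P≡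
  where
  P≡ : P-A (row T) ≡ T
  P≡ = P-A-row nT tT

-- Type C Knuth equivalence

-- `P-C` is a left fold, so columns with the same insertion tableau can be exchanged at the front of
-- a word, and `≡₅` does this up to Knuth moves.
P-C-≡C : v ≡C w → P-C v ≡ P-C w
P-C-≡C ε = refl
P-C-≡C (inj₁ m ◅ ms) = trans (P-C-≡A (m ◅ ε)) (P-C-≡C ms)
P-C-≡C (inj₂ (u , c , c′ , _ , _ , v≡ , w≡ , c∼c′) ◅ ms) = trans (trans (P-C-≡A v≡)
  (trans (P-C-++ c u) (trans (cong (λ T → foldl _←C_ T u) c∼c′) (sym (P-C-++ c′ u))))) (trans (sym (P-C-≡A w≡)) (P-C-≡C ms))

≡A⇒≡C : v ≡A w → v ≡C w
≡A⇒≡C = Star.map inj₁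

-- `≡₅` exchanges columns at the front of a word, so appended letters just become part of the common
-- remainder. Compatibility on this side is what an insertion letter by letter asks for.
≡C-++ʳ : (q : Word k) → v ≡C w → v ++ q ≡C w ++ q
≡C-++ʳ q = Star.gmap (_++ q) step
  where
  step : ∀ {v w} → (SymClosure _⇝_ ∪ _≡₅_) v w → (SymClosure _⇝_ ∪ _≡₅_) (v ++ q) (w ++ q)
  step (inj₁ m) = inj₁ (Sym.gmap (_++ q) (⇝-++ʳ q) m)
  step (inj₂ (u , c , c′ , cc , cc′ , v≡ , w≡ , c∼c′)) = inj₂ (u ++ q , c , c′ , cc , cc′ ,
    ≡A-trans (++ʳ q v≡) (≡⇒≡A (++-assoc c u q)) , ≡A-trans (++ʳ q w≡) (≡⇒≡A (++-assoc c′ u q)) , c∼c′)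

columnWord : Ascending c → IsColumnWord (reverse c)
columnWord ac = Linkedₚ.AllPairs⇒Linked (descending ac)
  where
  snoc : ∀ {c x} → AllPairs _>_ c → All (x <_) c → AllPairs {A = Letter _} _>_ (c ∷ʳ x)
  snoc []       _          = [] ∷ []
  snoc (l ∷ ls) (x<y ∷ x<) = Allₚ.∷ʳ⁺ l x<y ∷ snoc ls x<
  all-reverse : ∀ {P : Letter _ → Set} {c} → All P c → All P (reverse c)
  all-reverse [] = []
  all-reverse {c = x ∷ c} (px ∷ ps) = subst (All _) (sym (unfold-reverse x c)) (Allₚ.∷ʳ⁺ (all-reverse ps) px)
  descending : ∀ {c} → Ascending c → AllPairs {A = Letter _} _>_ (reverse c)
  descending [] = []
  descending {c = x ∷ c} (x<c ∷ ac) = subst (AllPairs _>_) (sym (unfold-reverse x c)) (snoc (descending ac) (all-reverse x<c))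

-- An exceptional insertion is a single `≡₅` step. The common remainder is the word of the other
-- columns of the Schensted tableau; the two columns in front have the same `P-C`, because one is
-- King and arises from the other by erasing a pair, which preserves the invariants.
insertion-≡C : (x : Letter k) → King 0 T → row T ∷ʳ x ≡C row (T ←C x) × King 0 (T ←C x)
insertion-≡C {T = T} x kT@(king nT tT bT) = go (outcome 0 kT z≤n)
  where
  go : Outcome 0 x T → row T ∷ʳ x ≡C row (T ←C x) × King 0 (T ←C x)
  go (ordinary e bd) = subst (λ S → row T ∷ʳ x ≡C row S × King 0 S) (sym e)
    (≡A⇒≡C (insA-≡A x tT) , king (insA-NonEmpty x nT) (tab-insA x tT) bd)
  go (exceptional exc) = inj₂ (U , reverse (heads S) , reverse c₁ , columnWord ah , columnWord ac₁ ,
      ≡A-trans (insA-≡A x tT) (row-heads-tails nS tS) , X.word , equal) ◅ ε , X.result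
    where
    module X = Exception exc
    S : Filling _
    S = insA x T
    c₁ U : Word _
    c₁ = X.upper ++ X.lower
    U = row (tails S)
    nS : All NonEmpty S
    nS = insA-NonEmpty x nT
    tS : Tab S
    tS = tab-insA x tT
    ah : Ascending (heads S)
    ah = heads-Ascending nS tS
    ah′ : Ascending (X.upper ++ plain X.letter ∷ bar X.letter ∷ X.lower)
    ah′ = subst Ascending X.heads-split ah
    ac₁ : Ascending c₁
    ac₁ = ascending-erase X.upper {plain X.letter ∷ bar X.letter ∷ []} ah′
    kc₁ : KingColumn 0 c₁
    kc₁ = kingColumn-join X.upper X.upper-King X.lower-King X.index
    erased : (heads S , []) ≈ (c₁ , [])
    erased = subst (λ c → (c , []) ≈ (c₁ , [])) (sym X.heads-split)
      (erase-≈ [] X.upper X.lower [] X.letter [] ah′ X.index X.upper-King X.lower-King)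
    equal : P-C (reverse (heads S)) ≡ P-C (reverse c₁)
    equal = trans (Reduct.P-C≡ (reduct ah)) (trans (cong column (reduct-unique ah ac₁ kc₁ erased)) (sym (P-C-king-column ac₁ kc₁)))

≡C-row-P-C : (w : Word k) → w ≡C row (P-C w) × King 0 (P-C w)
≡C-row-P-C w = go w (initLast w) (length w) ℕₚ.≤-refl
  where
  -- The bound `n` carries the termination, as splitting off the last letter is not structural
  -- recursion.
  go : ∀ w → InitLast w → ∀ n → length w ℕ.≤ n → w ≡C row (P-C w) × King 0 (P-C w)
  go .[] [] n l = ε , king [] [] []
  go .(w ∷ʳ x) (w ∷ʳ′ x) zero l = contradiction l (ℕₚ.<⇒≱ (subst (0 ℕ.<_) (sym (length-∷ʳ w x)) (s≤s z≤n)))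
  go .(w ∷ʳ x) (w ∷ʳ′ x) (suc n) l with go w (initLast w) n (ℕₚ.≤-pred (subst (ℕ._≤ suc n) (length-∷ʳ w x) l))
  ... | w≡ , kP with insertion-≡C x kP
  ...   | wx≡ , kQ = subst (λ S → w ∷ʳ x ≡C row S × King 0 S) (sym (P-C-∷ʳ w x)) (≡C-++ʳ [ x ] w≡ ◅◅ wx≡ , kQ)

theorem3p17 : (k : ℕ) → .{{_ : NonZero k}} → (w : Word k) →
    ∃! _≡_ (λ (T : Filling k) → IsKing T × w ≡C row T)
    × ((T : Filling k) → IsKing T → w ≡C row T → T ≡ P-C w)
theorem3p17 k w = (P-C w , (King⇒IsKing kP , w≡) , λ (isK , e) → sym (unique _ isK e)) , unique
  where
  w≡ : w ≡C row (P-C w)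
  w≡ = proj₁ (≡C-row-P-C w)
  kP : King 0 (P-C w)
  kP = proj₂ (≡C-row-P-C w)
  unique : (T : Filling k) → IsKing T → w ≡C row T → T ≡ P-C w
  unique T isK e = trans (sym (P-C-row (IsKing⇒King isK))) (sym (P-C-≡C e))
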